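{- Let $pds_{2D}(n)$ be the number of (two-dimensional, non-oriented) partially directed snakes of length $n$. Then, as formal power series, $$\sum_{n\ge 0} pds_{2D}(n)\,q^n=\frac{q^5+q^3+q^2-2q+1}{(1-q)(1-2q-q^3)}.$$ Moreover $pds_{2D}(0)=pds_{2D}(1)=1$ and for all $n\ge 2$ $$pds_{2D}(n)=\frac{1}{59}\sum_{\alpha:\,1-2\alpha-\alpha^3=0}\left(13\alpha^{ -1}+11-5\alpha\right)\alpha^{ -n}\;-\;1,$$ where the sum runs over the complex roots $\alpha$ of $1-2\alpha-\alpha^3$.
   Context: Cells are the unit squares of the square lattice; two cells are adjacent if they share an edge. A polyomino is a finite edge-connected set of cells, considered up to translation; it is viewed as a graph with cells as vertices and edge contacts as edges. A snake of length $n$ is a polyomino with $n$ cells, no cycle, and every cell of degree at most two (so its adjacency graph is a path). Snakes are non-oriented, i.e. counted as sets of cells up to translation. A snake is a partially directed snake (PDS) towards the North if its cells can be listed $c_1,\dots,c_n$ from one end of the path (the tail) to the other (the head) so that each step from $c_i$ to $c_{i+1}$ is in one of the directions North, East or West. By convention the empty snake is the unique PDS of length $0$. -}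

module Defs where

open import Algebra.Bundles using (CommutativeMonoid)
open import Algebra.Bundles.Raw using (RawRing)
import Algebra.Definitions.RawSemiring as RawSemiringDefinitions
import Algebra.Properties.AbelianGroup as AbelianGroupProperties
import Algebra.Properties.CommutativeSemigroup as CommutativeSemigroupProperties
import Algebra.Properties.Ring as RingProperties
open import Data.Fin.Base using (Fin; toℕ)
open import Data.Integer.Base as ℤ using (ℤ; +_; 0ℤ; 1ℤ)
import Data.Integer.Properties as ℤ
open import Data.List.Base using (List; []; _∷_; _∷ʳ_; length; filter; foldr; map)
open import Data.List.Membership.Propositional using (_∈_)
open import Data.List.Relation.Binary.Permutation.Propositional using (_↭_)
open import Data.List.Relation.Unary.All using (All)
open import Data.List.Relation.Unary.AllPairs using (AllPairs)
open import Data.List.Relation.Unary.Any using (Any)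
open import Data.List.Relation.Unary.Linked using (Linked)
open import Data.List.Relation.Unary.Unique.Propositional using (Unique)
open import Data.Nat.Base as ℕ using (ℕ; zero; suc)
import Data.Nat.Properties as ℕ
open import Data.Product using (∃; ∃-syntax; _×_; _,_; proj₁; proj₂)
open import Data.Rational.Base as ℚ using (ℚ; 0ℚ; 1ℚ; ½)
import Data.Rational.Properties as ℚ
open import Function.Base using (_∘_)
open import Function.Bundles using (_⇔_; mk⇔; Equivalence; Bijection)
open import Level using (0ℓ)
open import Relation.Binary.Bundles using (Setoid)
open import Relation.Binary.Construct.Closure.ReflexiveTransitive using (Star)
open import Relation.Binary.PropositionalEquality
  using (_≡_; _≗_; refl; sym; trans; cong; cong₂; subst; setoid)
open import Relation.Nullary using (¬_)
open import Relation.Unary using (Decidable)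

HasCardinality : Setoid 0ℓ 0ℓ → ℕ → Set
HasCardinality S k = Bijection S (setoid (Fin k))

------------------------------------------------------------------------
-- Partially directed snakes

-- A cell is given by the coordinates of its lower-left corner.
Cell : Set
Cell = ℤ × ℤ

translate : ℤ × ℤ → Cell → Cell
translate (a , b) (x , y) = (x ℤ.+ a , y ℤ.+ b)

distance : Cell → Cell → ℕ
distance (x , y) (x′ , y′) = ℤ.∣ x ℤ.- x′ ∣ ℕ.+ ℤ.∣ y ℤ.- y′ ∣

-- Two unit squares share an edge iff they differ by one in exactly one
-- coordinate.
Adjacent : Cell → Cell → Set
Adjacent c d = distance c d ≡ 1

Adjacent? : ∀ c → Decidable (Adjacent c)
Adjacent? c d = distance c d ℕ.≟ 1

-- Finite sets of cells are represented by duplicate-free lists, and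
-- compared through their members only.

Connected : List Cell → Set
Connected P = ∀ {c d} → c ∈ P → d ∈ P →
  Star (λ a b → a ∈ P × b ∈ P × Adjacent a b) c d

record IsPolyomino (P : List Cell) : Set where
  field
    unique    : Unique P
    connected : Connected P

-- A cycle is c₁, …, cₖ with k ≥ 3, all distinct, in which consecutive
-- cells are adjacent and cₖ is adjacent to c₁ = start.
record Cycle (P : List Cell) : Set where
  field
    start    : Cell
    others   : List Cell
    length≥3 : 3 ℕ.≤ length (start ∷ others)
    distinct : Unique (start ∷ others)
    inside   : All (_∈ P) (start ∷ others)
    closed   : Linked Adjacent ((start ∷ others) ∷ʳ start)

degree : List Cell → Cell → ℕ
degree P c = length (filter (Adjacent? c) P)

record IsSnake (P : List Cell) : Set where
  field
    isPolyomino : IsPolyomino P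
    acyclic     : ¬ Cycle P
    degree≤2    : ∀ {c} → c ∈ P → degree P c ℕ.≤ 2

data Step (c : Cell) : Cell → Set where
  north : Step c (translate (0ℤ , 1ℤ) c)
  east  : Step c (translate (1ℤ , 0ℤ) c)
  west  : Step c (translate (ℤ.-1ℤ , 0ℤ) c)

-- In a snake, a listing of all the cells whose consecutive cells are
-- adjacent necessarily runs from one end of the path to the other.
record IsPDS (P : List Cell) : Set where
  field
    isSnake  : IsSnake P
    listing  : List Cell
    lists    : listing ↭ P
    directed : Linked Step listing

record PDS (n : ℕ) : Set where
  field
    cells  : List Cell
    size   : length cells ≡ n
    isPDS  : IsPDS cells

_≈ᵗ_ : List Cell → List Cell → Set
P ≈ᵗ Q = ∃[ v ] (∀ c → c ∈ P ⇔ translate v c ∈ Q)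

module TranslationProperties where

  open Equivalence using (to; from)

  pair-≡ : ∀ {x x′ y y′ : ℤ} → x ≡ x′ → y ≡ y′ → (x , y) ≡ (x′ , y′)
  pair-≡ = cong₂ _,_

  translate-0 : ∀ c → translate (0ℤ , 0ℤ) c ≡ c
  translate-0 (x , y) = pair-≡ (ℤ.+-identityʳ x) (ℤ.+-identityʳ y)

  translate-+ : ∀ v w c → translate w (translate v c) ≡ translate (translate w v) c
  translate-+ (a , b) (a′ , b′) (x , y) = pair-≡ (ℤ.+-assoc x a a′) (ℤ.+-assoc y b b′)

  neg : ℤ × ℤ → ℤ × ℤ
  neg (a , b) = (ℤ.- a , ℤ.- b)

  translate-neg : ∀ v c → translate v (translate (neg v) c) ≡ c
  translate-neg v@(a , b) c =
    trans (translate-+ (neg v) v c)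
    (trans (cong (λ u → translate u c) (pair-≡ (ℤ.+-inverseˡ a) (ℤ.+-inverseˡ b)))
           (translate-0 c))

  ≈ᵗ-refl : ∀ {P} → P ≈ᵗ P
  ≈ᵗ-refl {P} = (0ℤ , 0ℤ) , λ c →
    mk⇔ (subst (_∈ P) (sym (translate-0 c))) (subst (_∈ P) (translate-0 c))

  ≈ᵗ-sym : ∀ {P Q} → P ≈ᵗ Q → Q ≈ᵗ P
  ≈ᵗ-sym {P} {Q} (v , e) = neg v , λ c → mk⇔
    (λ c∈Q → from (e (translate (neg v) c)) (subst (_∈ Q) (sym (translate-neg v c)) c∈Q))
    (λ d∈P → subst (_∈ Q) (translate-neg v c) (to (e (translate (neg v) c)) d∈P))

  ≈ᵗ-trans : ∀ {P Q R} → P ≈ᵗ Q → Q ≈ᵗ R → P ≈ᵗ R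
  ≈ᵗ-trans {R = R} (v , e) (w , f) = translate w v , λ c → mk⇔
    (λ c∈P → subst (_∈ R) (translate-+ v w c) (to (f _) (to (e c) c∈P)))
    (λ d∈R → from (e c) (from (f _) (subst (_∈ R) (sym (translate-+ v w c)) d∈R)))

open TranslationProperties

-- Snakes are non-oriented: the listing plays no role in the equality.
PDS-setoid : ℕ → Setoid 0ℓ 0ℓ
PDS-setoid n = record
  { Carrier       = PDS n
  ; _≈_           = λ S T → PDS.cells S ≈ᵗ PDS.cells T
  ; isEquivalence = record
    { refl  = ≈ᵗ-refl
    ; sym   = ≈ᵗ-sym
    ; trans = ≈ᵗ-trans
    }
  }

------------------------------------------------------------------------
-- Ring notation

module RingNotation {c ℓ} (R : RawRing c ℓ) where

  open RawRing R public
  open RawSemiringDefinitions rawSemiring public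
    using (_^_; sum) renaming (_×_ to _·_)

  infixl 6 _-_
  _-_ : Carrier → Carrier → Carrier
  x - y = x + (- y)

  -- x = a b⁻¹, including the claim that b is invertible (in a
  -- commutative ring, b⁻¹ is then unique).
  _≈_÷_ : Carrier → Carrier → Carrier → Set _
  x ≈ a ÷ b = ∃[ b⁻¹ ] (b * b⁻¹ ≈ 1# × x ≈ a * b⁻¹)

------------------------------------------------------------------------
-- Formal power series with integer coefficients

ℤ⟦q⟧ : RawRing 0ℓ 0ℓ
ℤ⟦q⟧ = record
  { Carrier = ℕ → ℤ
  ; _≈_     = _≗_
  ; _+_     = λ f g n → f n ℤ.+ g n
  ; _*_     = λ f g n → ∑ {suc n} (λ i → f (toℕ i) ℤ.* g (n ℕ.∸ toℕ i))
  ; -_      = λ f n → ℤ.- f n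
  ; 0#      = λ _ → 0ℤ
  ; 1#      = λ { zero → 1ℤ ; (suc _) → 0ℤ }
  }
  where open RawSemiringDefinitions ℤ.+-*-rawSemiring using () renaming (sum to ∑)

module PowerSeries where

  open RingNotation ℤ⟦q⟧ public

  q : Carrier
  q 1 = 1ℤ
  q _ = 0ℤ

  generatingFunction : (ℕ → ℕ) → Carrier
  generatingFunction a n = + a n

  numerator : Carrier
  numerator = q ^ 5 + q ^ 3 + q ^ 2 - 2 · q + 1#

  denominator : Carrier
  denominator = (1# - q) * (1# - 2 · q - q ^ 3)

------------------------------------------------------------------------
-- Real numbers: Cauchy sequences of rationals modulo null sequences

IsCauchy : (ℕ → ℚ) → Set
IsCauchy x = ∀ ε → 0ℚ ℚ.< ε →
  ∃[ N ] (∀ m n → N ℕ.≤ m → N ℕ.≤ n → ℚ.∣ x m ℚ.- x n ∣ ℚ.< ε)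

record ℝ : Set where
  constructor mkℝ
  field
    seq    : ℕ → ℚ
    cauchy : IsCauchy seq

open ℝ

infix 4 _≈ℝ_
_≈ℝ_ : ℝ → ℝ → Set
x ≈ℝ y = ∀ ε → 0ℚ ℚ.< ε →
  ∃[ N ] (∀ n → N ℕ.≤ n → ℚ.∣ seq x n ℚ.- seq y n ∣ ℚ.< ε)

module CauchyProperties where

  open AbelianGroupProperties ℚ.+-0-abelianGroup using (⁻¹-∙-comm)
  open CommutativeSemigroupProperties
    (CommutativeMonoid.commutativeSemigroup ℚ.+-0-commutativeMonoid) using (interchange)
  open RingProperties ℚ.+-*-ring using (-‿distribʳ-*)

  sum-diff : ∀ a b c d → (a ℚ.+ b) ℚ.- (c ℚ.+ d) ≡ (a ℚ.- c) ℚ.+ (b ℚ.- d)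
  sum-diff a b c d =
    trans (cong ((a ℚ.+ b) ℚ.+_) (sym (⁻¹-∙-comm c d))) (interchange a b (ℚ.- c) (ℚ.- d))

  neg-diff : ∀ a b → ℚ.- (a ℚ.- b) ≡ ℚ.- a ℚ.- ℚ.- b
  neg-diff a b = sym (⁻¹-∙-comm a (ℚ.- b))

  telescope : ∀ a b c → a ℚ.- c ≡ (a ℚ.- b) ℚ.+ (b ℚ.- c)
  telescope a b c = sym (trans (ℚ.+-assoc a (ℚ.- b) (b ℚ.- c)) (cong (a ℚ.+_)
    (trans (sym (ℚ.+-assoc (ℚ.- b) b (ℚ.- c)))
    (trans (cong (ℚ._- c) (ℚ.+-inverseˡ b)) (ℚ.+-identityˡ (ℚ.- c))))))

  diff-+ : ∀ a b → (a ℚ.- b) ℚ.+ b ≡ a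
  diff-+ a b = trans (ℚ.+-assoc a (ℚ.- b) b)
    (trans (cong (a ℚ.+_) (ℚ.+-inverseˡ b)) (ℚ.+-identityʳ a))

  *-diff : ∀ a b c → a ℚ.* (b ℚ.- c) ≡ a ℚ.* b ℚ.- a ℚ.* c
  *-diff a b c = trans (ℚ.*-distribˡ-+ a b (ℚ.- c))
    (cong (a ℚ.* b ℚ.+_) (sym (-‿distribʳ-* a c)))

  product-diff : ∀ a b c d →
    a ℚ.* b ℚ.- c ℚ.* d ≡ a ℚ.* (b ℚ.- d) ℚ.+ d ℚ.* (a ℚ.- c)
  product-diff a b c d = trans (telescope (a ℚ.* b) (a ℚ.* d) (c ℚ.* d)) (cong₂ ℚ._+_
    (sym (*-diff a b d))
    (trans (cong₂ ℚ._-_ (ℚ.*-comm a d) (ℚ.*-comm c d)) (sym (*-diff d a c))))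

  half-pos : ∀ {ε} → 0ℚ ℚ.< ε → 0ℚ ℚ.< ½ ℚ.* ε
  half-pos {ε} ε>0 =
    subst (ℚ._< ½ ℚ.* ε) (ℚ.*-zeroʳ ½) (ℚ.*-monoʳ-<-pos ½ ε>0)

  halves : ∀ ε → ½ ℚ.* ε ℚ.+ ½ ℚ.* ε ≡ ε
  halves ε = trans (sym (ℚ.*-distribʳ-+ ε ½ ½)) (ℚ.*-identityˡ ε)

  split : ∀ {p q r ε} → p ≡ q ℚ.+ r →
          ℚ.∣ q ∣ ℚ.< ½ ℚ.* ε → ℚ.∣ r ∣ ℚ.< ½ ℚ.* ε → ℚ.∣ p ∣ ℚ.< ε
  split {p} {q} {r} {ε} refl q<ε/2 r<ε/2 =
    subst (ℚ.∣ p ∣ ℚ.<_) (halves ε)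
      (ℚ.≤-<-trans (ℚ.∣p+q∣≤∣p∣+∣q∣ q r) (ℚ.+-mono-< q<ε/2 r<ε/2))

  ⊔ˡ : ∀ {a b n} → a ℕ.⊔ b ℕ.≤ n → a ℕ.≤ n
  ⊔ˡ {a} {b} = ℕ.≤-trans (ℕ.m≤m⊔n a b)

  ⊔ʳ : ∀ {a b n} → a ℕ.⊔ b ℕ.≤ n → b ℕ.≤ n
  ⊔ʳ {a} {b} = ℕ.≤-trans (ℕ.m≤n⊔m a b)

  const-cauchy : ∀ p → IsCauchy (λ _ → p)
  const-cauchy p ε ε>0 = 0 , λ _ _ _ _ →
    subst (ℚ._< ε) (sym (cong ℚ.∣_∣ (ℚ.+-inverseʳ p))) ε>0

  +-cauchy : ∀ x y → IsCauchy x → IsCauchy y → IsCauchy (λ n → x n ℚ.+ y n)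
  +-cauchy x y cx cy ε ε>0
    with cx (½ ℚ.* ε) (half-pos ε>0) | cy (½ ℚ.* ε) (half-pos ε>0)
  ... | M , hx | N , hy = M ℕ.⊔ N , λ m n m≥ n≥ →
    split (sum-diff (x m) (y m) (x n) (y n))
          (hx m n (⊔ˡ {M} {N} m≥) (⊔ˡ {M} {N} n≥))
          (hy m n (⊔ʳ {M} {N} m≥) (⊔ʳ {M} {N} n≥))

  neg-cauchy : ∀ x → IsCauchy x → IsCauchy (λ n → ℚ.- x n)
  neg-cauchy x cx ε ε>0 with cx ε ε>0
  ... | N , h = N , λ m n m≥ n≥ →
    subst (ℚ._< ε)
      (trans (sym (ℚ.∣-p∣≡∣p∣ (x m ℚ.- x n))) (cong ℚ.∣_∣ (neg-diff (x m) (x n))))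
      (h m n m≥ n≥)

  EventuallyBounded : (ℕ → ℚ) → Set
  EventuallyBounded x =
    ∃[ B ] (ℚ.Positive B × ∃[ N ] (∀ n → N ℕ.≤ n → ℚ.∣ x n ∣ ℚ.≤ B))

  bounded : ∀ x → IsCauchy x → EventuallyBounded x
  bounded x cx with cx 1ℚ (ℚ.positive⁻¹ 1ℚ)
  ... | N , h =
      1ℚ ℚ.+ ℚ.∣ x N ∣
    , ℚ.pos+nonNeg⇒pos 1ℚ ℚ.∣ x N ∣ {{ℚ.∣-∣-nonNeg (x N)}}
    , N
    , λ n n≥ → subst (λ t → ℚ.∣ t ∣ ℚ.≤ 1ℚ ℚ.+ ℚ.∣ x N ∣)
        (diff-+ (x n) (x N))
        (ℚ.≤-trans (ℚ.∣p+q∣≤∣p∣+∣q∣ (x n ℚ.- x N) (x N))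
          (ℚ.+-monoˡ-≤ ℚ.∣ x N ∣ (ℚ.<⇒≤ (h n N n≥ ℕ.≤-refl))))

  -- ∣ b ∣ ≤ B and ∣ d ∣ < ½ε / B give ∣ b d ∣ < ½ε.
  module Scale (B : ℚ) (B>0 : ℚ.Positive B) (ε : ℚ) (ε>0 : 0ℚ ℚ.< ε) where
    private
      instance
        B-pos : ℚ.Positive B
        B-pos = B>0
        B≢0 : ℚ.NonZero B
        B≢0 = ℚ.pos⇒nonZero B
        B⁻¹-pos : ℚ.Positive (ℚ.1/ B)
        B⁻¹-pos = ℚ.1/pos⇒pos B

    δ : ℚ
    δ = ℚ.1/ B ℚ.* (½ ℚ.* ε)

    δ>0 : 0ℚ ℚ.< δ
    δ>0 = subst (ℚ._< δ) (ℚ.*-zeroʳ (ℚ.1/ B)) (ℚ.*-monoʳ-<-pos (ℚ.1/ B) (half-pos ε>0))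

    Bδ : B ℚ.* δ ≡ ½ ℚ.* ε
    Bδ = trans (sym (ℚ.*-assoc B (ℚ.1/ B) (½ ℚ.* ε)))
         (trans (cong (ℚ._* (½ ℚ.* ε)) (ℚ.*-inverseʳ B)) (ℚ.*-identityˡ (½ ℚ.* ε)))

    scale : ∀ {b d} → ℚ.∣ b ∣ ℚ.≤ B → ℚ.∣ d ∣ ℚ.< δ → ℚ.∣ b ℚ.* d ∣ ℚ.< ½ ℚ.* ε
    scale {b} {d} b≤B d<δ =
      subst (ℚ._< ½ ℚ.* ε) (sym (ℚ.∣p*q∣≡∣p∣*∣q∣ b d))
        (ℚ.≤-<-trans (ℚ.*-monoʳ-≤-nonNeg ℚ.∣ d ∣ {{ℚ.∣-∣-nonNeg d}} b≤B)
          (subst (B ℚ.* ℚ.∣ d ∣ ℚ.<_) Bδ (ℚ.*-monoʳ-<-pos B d<δ)))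

  *-cauchy : ∀ x y → IsCauchy x → IsCauchy y → IsCauchy (λ n → x n ℚ.* y n)
  *-cauchy x y cx cy ε ε>0 with bounded x cx | bounded y cy
  ... | A , A>0 , K , x≤A | B , B>0 , L , y≤B = help
    where
    module SA = Scale A A>0 ε ε>0
    module SB = Scale B B>0 ε ε>0
    help : ∃[ N ] (∀ m n → N ℕ.≤ m → N ℕ.≤ n →
             ℚ.∣ x m ℚ.* y m ℚ.- x n ℚ.* y n ∣ ℚ.< ε)
    help with cx SB.δ SB.δ>0 | cy SA.δ SA.δ>0
    ... | M , hx | N , hy = (K ℕ.⊔ L) ℕ.⊔ (M ℕ.⊔ N) , λ m n m≥ n≥ →
      let K≤m = ⊔ˡ {K} {L} (⊔ˡ {K ℕ.⊔ L} {M ℕ.⊔ N} m≥)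
          L≤n = ⊔ʳ {K} {L} (⊔ˡ {K ℕ.⊔ L} {M ℕ.⊔ N} n≥)
          M≤  = λ {k} k≥ → ⊔ˡ {M} {N} {k} (⊔ʳ {K ℕ.⊔ L} {M ℕ.⊔ N} k≥)
          N≤  = λ {k} k≥ → ⊔ʳ {M} {N} {k} (⊔ʳ {K ℕ.⊔ L} {M ℕ.⊔ N} k≥)
      in split
        (product-diff (x m) (y m) (x n) (y n))
        (SA.scale (x≤A m K≤m) (hy m n (N≤ m≥) (N≤ n≥)))
        (SB.scale (y≤B n L≤n) (hx m n (M≤ m≥) (M≤ n≥)))

open CauchyProperties

fromℚ : ℚ → ℝ
fromℚ p = mkℝ (λ _ → p) (const-cauchy p)

_+ℝ_ : ℝ → ℝ → ℝ
x +ℝ y = mkℝ (λ n → seq x n ℚ.+ seq y n) (+-cauchy (seq x) (seq y) (cauchy x) (cauchy y))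

_*ℝ_ : ℝ → ℝ → ℝ
x *ℝ y = mkℝ (λ n → seq x n ℚ.* seq y n) (*-cauchy (seq x) (seq y) (cauchy x) (cauchy y))

-ℝ_ : ℝ → ℝ
-ℝ x = mkℝ (λ n → ℚ.- seq x n) (neg-cauchy (seq x) (cauchy x))

------------------------------------------------------------------------
-- Complex numbers

infix 5 _+i_
record ℂ : Set where
  constructor _+i_
  field
    re im : ℝ

open ℂ

ℂ-rawRing : RawRing 0ℓ 0ℓ
ℂ-rawRing = record
  { Carrier = ℂ
  ; _≈_     = λ z w → re z ≈ℝ re w × im z ≈ℝ im w
  ; _+_     = λ z w → (re z +ℝ re w) +i (im z +ℝ im w)
  ; _*_     = λ z w → ((re z *ℝ re w) +ℝ (-ℝ (im z *ℝ im w)))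
                   +i ((re z *ℝ im w) +ℝ (im z *ℝ re w))
  ; -_      = λ z → (-ℝ re z) +i (-ℝ im z)
  ; 0#      = fromℚ 0ℚ +i fromℚ 0ℚ
  ; 1#      = fromℚ 1ℚ +i fromℚ 0ℚ
  }

module Complex where

  open RingNotation ℂ-rawRing public hiding (Carrier; sum)

  ratio : ℚ → ℂ
  ratio p = fromℚ p +i fromℚ 0ℚ

  -- An invertible complex number together with its inverse.
  record ℂˣ : Set where
    field
      value inverse : ℂ
      invertible    : value * inverse ≈ 1#

  open ℂˣ public

  IsRoot : ℂ → Set
  IsRoot z = 1# - 2 · z - z ^ 3 ≈ 0#

  -- 0 is not a root of 1 - 2α - α³, so the roots may be listed as
  -- invertible numbers without losing any.
  record EnumeratesRoots (αs : List ℂˣ) : Set where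
    field
      roots    : All (λ α → IsRoot (value α)) αs
      distinct : AllPairs (λ α β → value α ≉ value β) αs
      complete : ∀ z → IsRoot z → Any (λ α → z ≈ value α) αs

  ∑[_]_ : List ℂˣ → (ℂˣ → ℂ) → ℂ
  ∑[ αs ] f = foldr _+_ 0# (map f αs)

{-# OPTIONS --safe #-}
-- A directed snake is read off as a word in North, East, West. The cells of a word form an
-- induced path exactly when the word avoids EW, WE, ENW and WNE; the avoiding words are
-- accepted by an automaton remembering the last horizontal step, whose transfer recurrences
-- give f(m+3) = 2 f(m+2) + f(m). Two induced paths with the same cells and different
-- starting cells traverse the same path in opposite directions; if both climb, they stay
-- in one row. Hence the snake determines its word, except that the words Eᵐ and Wᵐ draw the
-- same snake, and pds(m+1) = f(m) - 1 for m ≥ 1.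
--
-- For the closed form, the root ρ in [0, ½] and √59 are limits of monotone contractions, and
-- the other two roots are -½ρ ± i √59 / (6ρ² + 4). With β = α⁻¹ = α² + 2 one has β³ = 2β² + 1,
-- so the root sums satisfy the recurrence of f, and their first three values follow from
-- Σα = 0 and Σα² = -4.

module Submission where

open import Defs
open import Data.Integer.Base using (+_)
open import Data.List.Base using (List)
open import Data.Nat.Base using (ℕ; _≤_)
open import Data.Product using (∃-syntax; _×_; _,_)
open import Data.Rational.Base using (_/_)
open import Relation.Binary.PropositionalEquality using (_≡_)

-- Two missing decisions shape the proof. A snake carries some directed listing, but its equality
-- sees only the cell set up to translation; the counted invariant must therefore not depend on the
-- listing. Its values form `Maybe (Bent free m)`, where `nothing` stands for the row, the one shape
-- that may be drawn by two words. For the roots, equality of Cauchy sequences cannot be decided,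
-- and a vanishing product does not reveal which factor vanishes. A given root is recognised from
-- rational estimates of its imaginary part, and the other factors are cancelled after bounding them
-- away from zero. The polynomial identities are proved over an abstract ℚ-algebra and then serve ℝ
-- and ℂ alike. The number 59 is minus the discriminant of z³ + 2z - 1. It appears under the square
-- root in the two non-real roots, and it appears in the prefactor because inverting the derivative
-- of the cubic at a root brings in that discriminant.

module InducedPaths where

  open import Data.Integer.Base as ℤ using (ℤ; +_; 0ℤ)
  import Data.Integer.Properties as ℤ
  open import Data.List.Base using (List; []; _∷_; _∷ʳ_; length)
  open import Data.List.Membership.Propositional using (_∈_)
  import Data.List.Membership.DecPropositional as DecMembership
  open import Data.List.Properties using (filter-accept; filter-reject; filter-none)
  open import Data.List.Relation.Unary.All as All using (All; []; _∷_)
  open import Data.List.Relation.Unary.AllPairs using ([]; _∷_)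
  open import Data.List.Relation.Unary.Any using (here; there)
  open import Data.List.Relation.Unary.Linked using (Linked; []; [-]; _∷_)
  open import Data.List.Relation.Unary.Unique.Propositional using (Unique)
  open import Data.Nat.Base as ℕ using (ℕ; suc; z≤n; s≤s)
  import Data.Nat.Properties as ℕ
  open import Data.Product using (∃-syntax; _×_; _,_; proj₂)
  open import Data.Product.Properties using (≡-dec)
  open import Data.Sum.Base using (_⊎_; inj₁; inj₂)
  open import Function.Base using (_∘_)
  open import Relation.Binary.Construct.Closure.ReflexiveTransitive
    using (Star; ε; _◅_; _◅◅_; reverse)
  open import Relation.Binary.PropositionalEquality
  open import Relation.Nullary using (¬_; yes; no; contradiction)

  open TranslationProperties

  private
    variable
      a b c d p q : Cell
      l l′ : List Cell

  -- Lattice distance and induced paths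

  norm : ℤ × ℤ → ℕ
  norm (x , y) = ℤ.∣ x ∣ ℕ.+ ℤ.∣ y ∣

  ∣x-[x+a]∣ : ∀ x a → ℤ.∣ x ℤ.- (x ℤ.+ a) ∣ ≡ ℤ.∣ a ∣
  ∣x-[x+a]∣ x a = begin
    ℤ.∣ x ℤ.- (x ℤ.+ a) ∣  ≡⟨ ℤ.∣i-j∣≡∣j-i∣ x (x ℤ.+ a) ⟩
    ℤ.∣ x ℤ.+ a ℤ.- x ∣    ≡⟨ cong (λ t → ℤ.∣ t ℤ.- x ∣) (ℤ.+-comm x a) ⟩
    ℤ.∣ a ℤ.+ x ℤ.- x ∣    ≡⟨ cong ℤ.∣_∣ (ℤ.+-assoc a x (ℤ.- x)) ⟩
    ℤ.∣ a ℤ.+ (x ℤ.- x) ∣  ≡⟨ cong (λ t → ℤ.∣ a ℤ.+ t ∣) (ℤ.+-inverseʳ x) ⟩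
    ℤ.∣ a ℤ.+ 0ℤ ∣         ≡⟨ cong ℤ.∣_∣ (ℤ.+-identityʳ a) ⟩
    ℤ.∣ a ∣                ∎
    where open ≡-Reasoning

  distance-translate : ∀ v c → distance c (translate v c) ≡ norm v
  distance-translate (a , b) (x , y) = cong₂ ℕ._+_ (∣x-[x+a]∣ x a) (∣x-[x+a]∣ y b)

  distance-refl : ∀ c → distance c c ≡ 0
  distance-refl (x , y) = cong₂ ℕ._+_ (cong ℤ.∣_∣ (ℤ.+-inverseʳ x)) (cong ℤ.∣_∣ (ℤ.+-inverseʳ y))

  distance-sym : ∀ c d → distance c d ≡ distance d c
  distance-sym (x , y) (x′ , y′) = cong₂ ℕ._+_ (ℤ.∣i-j∣≡∣j-i∣ x x′) (ℤ.∣i-j∣≡∣j-i∣ y y′)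

  Adjacent-sym : Adjacent c d → Adjacent d c
  Adjacent-sym {c} {d} = trans (distance-sym d c)

  Adjacent-irrefl : ∀ c → ¬ Adjacent c c
  Adjacent-irrefl c adj with () ← trans (sym (distance-refl c)) adj

  -- Distance at least two excludes equality and contact at once, so a single bound yields both
  -- distinctness and the absence of chords.
  Far : Cell → Cell → Set
  Far c d = 2 ℕ.≤ distance c d

  Far⇒¬Adjacent : ∀ c d → Far c d → ¬ Adjacent c d
  Far⇒¬Adjacent _ _ far adj with s≤s () ← subst (2 ℕ.≤_) adj far

  Far⇒≢ : ∀ c d → Far c d → c ≢ d
  Far⇒≢ c _ far refl with () ← subst (2 ℕ.≤_) (distance-refl c) far

  infixr 5 _⟨_⟩∷_

  -- Chordless paths of the adjacency graph, grown at the head: a new cell touches its successor and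
  -- stays far from everything after it.
  data Induced : List Cell → Set where
    []  : Induced []
    [-] : Induced (c ∷ [])
    _⟨_⟩∷_ : Adjacent c d → All (Far c) l → Induced (d ∷ l) → Induced (c ∷ d ∷ l)

  Induced⇒Linked : Induced l → Linked Adjacent l
  Induced⇒Linked []              = []
  Induced⇒Linked [-]             = [-]
  Induced⇒Linked (adj ⟨ _ ⟩∷ ind) = adj ∷ Induced⇒Linked ind

  Induced⇒Unique : Induced l → Unique l
  Induced⇒Unique []                = []
  Induced⇒Unique [-]               = [] ∷ []
  Induced⇒Unique {c ∷ _} (adj ⟨ far ⟩∷ ind) =
    ((λ { refl → Adjacent-irrefl c adj }) ∷ All.map (Far⇒≢ c _) far) ∷ Induced⇒Unique ind

  Induced-tail : Induced (c ∷ l) → Induced l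
  Induced-tail [-]           = []
  Induced-tail (_ ⟨ _ ⟩∷ ind) = ind

  neighbour-of-head : Induced (c ∷ d ∷ l) → q ∈ c ∷ d ∷ l → Adjacent c q → q ≡ d
  neighbour-of-head {c} _ (here refl) adj = contradiction adj (Adjacent-irrefl c)
  neighbour-of-head _ (there (here q≡d)) _ = q≡d
  neighbour-of-head {c} {q = q} (_ ⟨ far ⟩∷ _) (there (there q∈l)) adj =
    contradiction adj (Far⇒¬Adjacent c q (All.lookup far q∈l))

  -- Induced paths are snakes

  degree-head : Induced (c ∷ l) → degree (c ∷ l) c ℕ.≤ 1
  degree-head {c} {l} ind = subst (λ L → length L ℕ.≤ 1)
    (sym (filter-reject (Adjacent? c) (Adjacent-irrefl c))) (rest ind)
    where
    rest : Induced (c ∷ l) → degree l c ℕ.≤ 1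
    rest [-]             = z≤n
    rest (adj ⟨ far ⟩∷ _) = subst (λ L → length L ℕ.≤ 1)
      (sym (trans (filter-accept (Adjacent? c) adj)
        (cong (_ ∷_) (filter-none (Adjacent? c) (All.map (Far⇒¬Adjacent c _) far)))))
      (s≤s z≤n)

  degree≤suc : ∀ a → degree (a ∷ l) c ℕ.≤ suc (degree l c)
  degree≤suc {l} {c} a with Adjacent? c a
  ... | yes adj = ℕ.≤-reflexive (cong length (filter-accept (Adjacent? c) {xs = l} adj))
  ... | no ¬adj = ℕ.m≤n⇒m≤1+n (ℕ.≤-reflexive (cong length (filter-reject (Adjacent? c) {xs = l} ¬adj)))

  Induced-degree : Induced l → c ∈ l → degree l c ℕ.≤ 2
  Induced-degree ind (here refl) = ℕ.m≤n⇒m≤1+n (degree-head ind)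
  Induced-degree {a ∷ d ∷ l} {c} (_ ⟨ _ ⟩∷ ind) (there (here refl)) =
    ℕ.≤-trans (degree≤suc {d ∷ l} {c} a) (s≤s (degree-head ind))
  Induced-degree {a ∷ d ∷ l} {c} (_ ⟨ far ⟩∷ ind) (there (there c∈l)) =
    subst (λ L → length L ℕ.≤ 2)
      (sym (filter-reject (Adjacent? c) (Far⇒¬Adjacent a c (All.lookup far c∈l) ∘ Adjacent-sym {c} {a})))
      (Induced-degree ind (there c∈l))

  module _ {R : Cell → Cell → Set} where

    last-linked : ∀ {x ys z} → Linked R ((x ∷ ys) ∷ʳ z) → ∃[ e ] (e ∈ x ∷ ys × R e z)
    last-linked {ys = []}     (r ∷ _)  = _ , here refl , r
    last-linked {ys = y ∷ ys} (_ ∷ rs) with e , e∈ , r ← last-linked rs = e , there e∈ , r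

    -- Here `z` is the start of a cycle, `x` its second cell and `a` a later one. The two cells
    -- found are the predecessor and the successor of `a`. The last cell wraps around to `z`, and
    -- there freshness of `z` separates the two; elsewhere uniqueness does.
    inner-neighbours : ∀ {x ys z} → Linked R ((x ∷ ys) ∷ʳ z) → Unique (x ∷ ys) → All (z ≢_) (x ∷ ys) →
      a ∈ ys → ∃[ e ] ∃[ f ] (e ∈ z ∷ x ∷ ys × f ∈ z ∷ x ∷ ys × e ≢ f × R e a × R a f)
    inner-neighbours {ys = y ∷ []} (r ∷ r′ ∷ _) _ (z≢x ∷ _) (here refl) =
      _ , _ , there (here refl) , here refl , z≢x ∘ sym , r , r′
    inner-neighbours {ys = y ∷ y′ ∷ ys} (r ∷ r′ ∷ _) ((_ ∷ x≢y′ ∷ _) ∷ _) _ (here refl) =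
      _ , _ , there (here refl) , there (there (there (here refl))) , x≢y′ , r , r′
    inner-neighbours {ys = y ∷ y′ ∷ ys} (_ ∷ rs) (_ ∷ uniq) (_ ∷ z≢) (there a∈)
      with e , f , e∈ , f∈ , e≢f , r , r′ ← inner-neighbours rs uniq z≢ a∈
      = e , f , weaken e∈ , weaken f∈ , e≢f , r , r′
      where
      weaken : ∀ {x z : Cell} {ys : List Cell} → q ∈ z ∷ ys → q ∈ z ∷ x ∷ ys
      weaken (here eq)  = here eq
      weaken (there q∈) = there (there q∈)

  -- The two neighbours are the predecessor and the successor along the cycle; length at least three
  -- is what keeps them apart.
  cycle-neighbours : (C : Cycle l) → let open Cycle C in a ∈ start ∷ others →
    ∃[ e ] ∃[ f ] (e ∈ l × f ∈ l × e ≢ f × Adjacent a e × Adjacent a f)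
  cycle-neighbours {l} {a} C = neighbours others length≥3 distinct inside closed
    where
    open Cycle C
    neighbours : ∀ ys → 3 ℕ.≤ length (start ∷ ys) → Unique (start ∷ ys) → All (_∈ l) (start ∷ ys) →
      Linked Adjacent ((start ∷ ys) ∷ʳ start) → a ∈ start ∷ ys →
      ∃[ e ] ∃[ f ] (e ∈ l × f ∈ l × e ≢ f × Adjacent a e × Adjacent a f)
    neighbours (y ∷ [])      (s≤s (s≤s ()))
    neighbours (y ∷ y′ ∷ ys) _ (_ ∷ (y≢ ∷ _)) ins (adj ∷ _ ∷ links) (here refl)
      with e , e∈ , r ← last-linked links
      = y , e , All.lookup ins (there (here refl)) , All.lookup ins (there (there e∈))
      , All.lookup y≢ e∈ , adj , Adjacent-sym {e} {a} r
    neighbours (y ∷ y′ ∷ ys) _ ((_ ∷ s≢y′ ∷ _) ∷ _) ins (adj ∷ adj′ ∷ _) (there (here refl))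
      = start , y′ , All.lookup ins (here refl) , All.lookup ins (there (there (here refl)))
      , s≢y′ , Adjacent-sym {start} {a} adj , adj′
    neighbours (y ∷ y′ ∷ ys) _ (s≢ ∷ uniq) ins (_ ∷ links) (there (there a∈))
      with e , f , e∈ , f∈ , e≢f , r , r′ ← inner-neighbours links uniq s≢ a∈
      = e , f , All.lookup ins e∈ , All.lookup ins f∈ , e≢f , Adjacent-sym {e} {a} r , r′

  -- The head has at most one neighbour, whereas a cell on a cycle has two. A cycle thus avoids the
  -- head and lives in the tail, where induction applies.
  Induced-acyclic : Induced l → ¬ Cycle l
  Induced-acyclic {[]} _ C with () ← All.head (Cycle.inside C)
  Induced-acyclic {c ∷ l} ind C with c ∈? Cycle.start C ∷ Cycle.others C
    where open DecMembership (≡-dec ℤ._≟_ ℤ._≟_) using (_∈?_)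
  ... | yes c∈ with e , f , e∈ , f∈ , e≢f , adj , adj′ ← cycle-neighbours C c∈ = e≢f (equal ind e∈ f∈)
    where
    equal : Induced (c ∷ l) → e ∈ c ∷ l → f ∈ c ∷ l → e ≡ f
    equal [-]              (here refl) _ = contradiction adj (Adjacent-irrefl c)
    equal ind@(_ ⟨ _ ⟩∷ _)  e∈ f∈         =
      trans (neighbour-of-head ind e∈ adj) (sym (neighbour-of-head ind f∈ adj′))
  ... | no c∉ = Induced-acyclic (Induced-tail ind) record
    { start    = start
    ; others   = others
    ; length≥3 = length≥3
    ; distinct = distinct
    ; inside   = All.tabulate λ q∈ → drop q∈ (All.lookup inside q∈)
    ; closed   = closed
    }
    where
    open Cycle C
    drop : q ∈ start ∷ others → q ∈ c ∷ l → q ∈ l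
    drop q∈ (here refl) = contradiction q∈ c∉
    drop _  (there q∈l) = q∈l

  Linked⇒Connected : Linked Adjacent l → Connected l
  Linked⇒Connected {[]} _ ()
  Linked⇒Connected {a ∷ l} links c∈ d∈ =
    reverse symmetric (fromHead links (λ q∈ → q∈) c∈) ◅◅ fromHead links (λ q∈ → q∈) d∈
    where
    Edge : Cell → Cell → Set
    Edge c d = c ∈ a ∷ l × d ∈ a ∷ l × Adjacent c d
    symmetric : ∀ {c d} → Edge c d → Edge d c
    symmetric {c} {d} (c∈ , d∈ , adj) = d∈ , c∈ , Adjacent-sym {c} {d} adj
    fromHead : ∀ {c l′ d} → Linked Adjacent (c ∷ l′) → (∀ {q} → q ∈ c ∷ l′ → q ∈ a ∷ l) →
      d ∈ c ∷ l′ → Star Edge c d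
    fromHead _ _ (here refl) = ε
    fromHead (adj ∷ links) sub (there d∈) =
      (sub (here refl) , sub (there (here refl)) , adj) ◅ fromHead links (sub ∘ there) d∈

  Induced⇒IsSnake : Induced l → IsSnake l
  Induced⇒IsSnake ind = record
    { isPolyomino = record
      { unique    = Induced⇒Unique ind
      ; connected = Linked⇒Connected (Induced⇒Linked ind)
      }
    ; acyclic     = Induced-acyclic ind
    ; degree≤2    = Induced-degree ind
    }

  -- Induced paths with the same cells

  _⊆_ : List Cell → List Cell → Set
  l ⊆ l′ = ∀ {q} → q ∈ l → q ∈ l′

  tail-⊆ : Unique (a ∷ l) → (a ∷ l) ⊆ (a ∷ l′) → l ⊆ l′
  tail-⊆ (a≢ ∷ _) sub q∈l with sub (there q∈l)
  ... | here refl = contradiction refl (All.lookup a≢ q∈l)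
  ... | there q∈l′ = q∈l′

  -- An end of an induced path has a single neighbour in the cell set, so the set forces the next
  -- cell; removing the common head leaves the same situation.
  Induced-same-head : Induced (a ∷ l) → Induced (a ∷ l′) → (a ∷ l) ⊆ (a ∷ l′) → (a ∷ l′) ⊆ (a ∷ l) → l ≡ l′
  Induced-same-head [-] [-] _ _ = refl
  Induced-same-head {a} [-] (adj ⟨ _ ⟩∷ _) _ sup with here refl ← sup (there (here refl)) =
    contradiction adj (Adjacent-irrefl a)
  Induced-same-head {a} (adj ⟨ _ ⟩∷ _) [-] sub _ with here refl ← sub (there (here refl)) =
    contradiction adj (Adjacent-irrefl a)
  Induced-same-head i@(adj ⟨ _ ⟩∷ ind) i′@(adj′ ⟨ _ ⟩∷ ind′) sub sup
    with refl ← neighbour-of-head i′ (sub (there (here refl))) adj =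
    cong (_ ∷_) (Induced-same-head ind ind′
      (tail-⊆ (Induced⇒Unique i) sub) (tail-⊆ (Induced⇒Unique i′) sup))

  _≼_ : Cell → Cell → Set
  c ≼ d = proj₂ c ℤ.≤ proj₂ d

  head-lowest : Linked _≼_ (a ∷ l) → All (a ≼_) (a ∷ l)
  head-lowest [-]        = ℤ.≤-refl ∷ []
  head-lowest (le ∷ les) = ℤ.≤-refl ∷ All.map (ℤ.≤-trans le) (head-lowest les)

  -- A cell with at most one neighbour is an end of the path, here the last one.
  end-highest : Linked _≼_ (c ∷ l) → Induced (c ∷ l) → a ∈ l →
    (∀ {q q′} → q ∈ c ∷ l → q′ ∈ c ∷ l → Adjacent a q → Adjacent a q′ → q ≡ q′) →
    All (_≼ a) (c ∷ l)
  end-highest {l = _ ∷ []} (le ∷ _) _ (here refl) _ = le ∷ ℤ.≤-refl ∷ []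
  end-highest {c} {a = a} (_ ∷ _) (adj ⟨ (far ∷ _) ⟩∷ (adj′ ⟨ _ ⟩∷ _)) (here refl) one =
    contradiction
      (one (here refl) (there (there (here refl))) (Adjacent-sym {c} {a} adj) adj′)
      (Far⇒≢ c _ far)
  end-highest (le ∷ les) (_ ⟨ _ ⟩∷ ind) (there a∈) one
    with le′ ∷ les′ ← end-highest les ind a∈ (λ q∈ q′∈ → one (there q∈) (there q′∈)) =
    ℤ.≤-trans le le′ ∷ le′ ∷ les′

  SameRow : Cell → Cell → Set
  SameRow c d = proj₂ c ≡ proj₂ d

  -- If the heads differ, the head `a` of `l` has at most one neighbour and is not the head of `l′`,
  -- so it is the last cell of `l′`. Heights never decrease along either list: as first cell of `l`,
  -- `a` is lowest, and as last cell of `l′` it is highest. All cells then lie in its row.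
  aligned : Induced l → Induced l′ → Linked _≼_ l → Linked _≼_ l′ → l ⊆ l′ → l′ ⊆ l →
    l ≡ l′ ⊎ ∃[ a ] (All (SameRow a) l × All (SameRow a) l′)
  aligned {[]}    {[]}    _ _ _ _ _ _ = inj₁ refl
  aligned {[]}    {_ ∷ _} _ _ _ _ _ sup with () ← sup (here refl)
  aligned {_ ∷ _} {[]}    _ _ _ _ sub _ with () ← sub (here refl)
  aligned {a ∷ l} {b ∷ l′} ind ind′ le le′ sub sup with sub (here refl)
  ... | here refl with refl ← Induced-same-head ind ind′ sub sup = inj₁ refl
  ... | there a∈l′ = inj₂ (a , All.tabulate rowˡ , All.tabulate rowʳ)
    where
    one : ∀ {q q′} → Induced (a ∷ l) → q ∈ a ∷ l → q′ ∈ a ∷ l → Adjacent a q → Adjacent a q′ → q ≡ q′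
    one [-] (here refl) _ adj _ = contradiction adj (Adjacent-irrefl a)
    one ind@(_ ⟨ _ ⟩∷ _) q∈ q′∈ adj adj′ =
      trans (neighbour-of-head ind q∈ adj) (sym (neighbour-of-head ind q′∈ adj′))
    upper : All (_≼ a) (b ∷ l′)
    upper = end-highest le′ ind′ a∈l′ λ q∈ q′∈ → one ind (sup q∈) (sup q′∈)
    rowˡ : q ∈ a ∷ l → SameRow a q
    rowˡ q∈ = ℤ.≤-antisym (All.lookup (head-lowest le) q∈) (All.lookup upper (sub q∈))
    rowʳ : q ∈ b ∷ l′ → SameRow a q
    rowʳ q∈ = ℤ.≤-antisym (All.lookup (head-lowest le) (sup q∈)) (All.lookup upper q∈)

-- Words in North, East, West and the induced paths that they draw

module DirectedWords where

  open InducedPaths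
  open import Data.Integer.Base as ℤ using (ℤ; +_; 0ℤ; 1ℤ)
  open import Algebra.Bundles using (AbelianGroup)
  import Algebra.Properties.Group as GroupProperties
  import Data.Integer.Properties as ℤ
  open import Data.List.Base using (List; []; _∷_; _++_; length; map)
  open import Data.List.Membership.Propositional using (_∈_)
  open import Data.List.Properties using (∷-injectiveˡ; ∷-injectiveʳ)
  open import Data.List.Relation.Unary.All as All using (All; []; _∷_)
  open import Data.List.Relation.Unary.AllPairs using ([]; _∷_)
  open import Data.List.Relation.Unary.Linked using (Linked; []; [-]; _∷_)
  open import Data.List.Relation.Unary.Unique.Propositional using (Unique)
  open import Data.Nat.Base as ℕ using (ℕ; zero; suc; z≤n; s≤s)
  import Data.Nat.Properties as ℕ
  open import Data.Product using (∃-syntax; _×_; _,_; proj₁; proj₂)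
  open import Data.Sign.Base as Sign using (Sign; opposite)
  open import Function.Base using (_∘_)
  open import Relation.Binary.PropositionalEquality
  open import Relation.Nullary using (¬_; contradiction)

  open TranslationProperties

  module ℤ+ = GroupProperties (AbelianGroup.group ℤ.+-0-abelianGroup)

  private
    variable
      a b c d p q : Cell
      h l l′ P : List Cell
      m n : ℕ
      σ τ : Sign

  side : Sign → Cell → Cell
  side σ = translate (σ ℤ.◃ 1 , 0ℤ)

  up : Cell → Cell
  up = translate (0ℤ , 1ℤ)

  -- The last two steps restrict the next one: on σ is the state after a step
  -- towards σ, over σ the state after a step towards σ followed by one up.
  data State : Set where
    free    : State
    on over : Sign → State

  private
    variable
      s s′ : State

  data Open : State → Sign → Set where
    free : Open free σ
    on   : Open (on σ) σ
    over : Open (over σ) σ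

  -- After a second step up the old horizontal step is two rows below, too far to be touched, so the
  -- memory is erased.
  rise : State → State
  rise free     = free
  rise (on σ)   = over σ
  rise (over _) = free

  data Word : State → ℕ → Set where
    []  : Word s 0
    ↑_  : Word (rise s) m → Word s (suc m)
    _↠_ : Open s σ → Word (on σ) m → Word s (suc m)

  infixr 5 ↑_ _↠_

  trail : Cell → Word s m → List Cell
  trail c []              = []
  trail c (↑ w)           = up c ∷ trail (up c) w
  trail c (_↠_ {σ = σ} _ w) = side σ c ∷ trail (side σ c) w

  cells : Cell → Word s m → List Cell
  cells c w = c ∷ trail c w

  trail-length : ∀ c (w : Word s m) → length (trail c w) ≡ m
  trail-length c []      = refl
  trail-length c (↑ w)   = cong suc (trail-length _ w)
  trail-length c (_ ↠ w) = cong suc (trail-length _ w)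

  trail-Step : ∀ c (w : Word s m) → Linked Step (cells c w)
  trail-Step c []      = [-]
  trail-Step c (↑ w)   = north ∷ trail-Step _ w
  trail-Step c (_↠_ {σ = Sign.+} _ w) = east ∷ trail-Step _ w
  trail-Step c (_↠_ {σ = Sign.-} _ w) = west ∷ trail-Step _ w

  -- Offsets of the cells reachable from a given state

  clearance : State → ℕ
  clearance free     = 0
  clearance (over _) = 1
  clearance (on _)   = 2

  -- An upper bound for the offsets still reachable, shaped to be preserved by every step. What it
  -- omits above the current row is the blocked side at heights below `clearance s`: two rows right
  -- after a horizontal step, one row after a further step up.
  data Region (s : State) : ℤ × ℤ → Set where
    beside : Open s σ → ∀ i j → Region s (σ ℤ.◃ i , + j)
    above  : ∀ x j → Region s (x , + (clearance s ℕ.+ j))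

  -- The bound `k` counts steps: a cell has bound 0 from itself, the trail has bound 1, and
  -- prepending one more step gives bound 2, which is the farness demanded by `Induced`.
  record Reach (s : State) (k : ℕ) (c q : Cell) : Set where
    constructor reach
    field
      {offset} : ℤ × ℤ
      region   : Region s offset
      norm≥    : k ℕ.≤ norm offset
      position : q ≡ translate offset c

  reach-start : ∀ s → Reach s 0 c c
  reach-start {c} s = reach (origin s) z≤n (sym (translate-0 c))
    where
    origin : ∀ s → Region s (0ℤ , 0ℤ)
    origin free     = above 0ℤ 0
    origin (on σ)   = beside on 0 0
    origin (over σ) = beside over 0 0

  region-rise : ∀ {x j} → Region (rise s) (x , + j) → Region s (x , + suc j)
  region-rise {free}   (beside _ i j)       = above _ (suc j)
  region-rise {free}   (above x j)          = above x (suc j)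
  region-rise {on σ}   (beside over i j)    = beside on i (suc j)
  region-rise {on σ}   (above x j)          = above x j
  region-rise {over σ} (beside _ i j)       = above _ j
  region-rise {over σ} (above x j)          = above x j

  region-above : Open s σ → ∀ x j → Region s (x , + (2 ℕ.+ j))
  region-above free x j = above x (2 ℕ.+ j)
  region-above on   x j = above x j
  region-above over x j = above x (suc j)

  ◃-suc : ∀ σ i → (σ ℤ.◃ 1) ℤ.+ (σ ℤ.◃ i) ≡ (σ ℤ.◃ suc i)
  ◃-suc Sign.+ zero    = refl
  ◃-suc Sign.+ (suc i) = refl
  ◃-suc Sign.- zero    = refl
  ◃-suc Sign.- (suc i) = refl

  region-height : ∀ {x y} → Region s (x , y) → ∃[ j ] y ≡ + j
  region-height (beside _ _ j) = j , refl
  region-height (above _ j)    = _ , refl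

  reach-up : ∀ {k} → Reach (rise s) k (up c) q → Reach s (suc k) c q
  reach-up {s} {c} {k = k} (reach {offset = x , _} r k≤ refl) with j , refl ← region-height r =
    reach (region-rise r)
      (subst (suc k ℕ.≤_) (sym (ℕ.+-suc ℤ.∣ x ∣ j)) (s≤s k≤))
      (trans (translate-+ (0ℤ , 1ℤ) (x , + j) c) (cong (λ t → translate (t , + suc j) c) (ℤ.+-identityˡ x)))

  -- In the `beside` case both displacements point the same way, so the norm grows by one. In the
  -- `above` case the horizontal parts may cancel and only the height, at least 2, is certain; hence
  -- the restriction `k ≤ 1`.
  reach-side : ∀ {k} → Open s σ → k ℕ.≤ 1 → Reach (on σ) k (side σ c) q → Reach s (suc k) c q
  reach-side {σ = σ} {c = c} {k = k} o _ (reach (beside on i j) k≤ refl) =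
    reach (beside o (suc i) j)
      (subst (λ t → suc k ℕ.≤ t ℕ.+ j) (sym (ℤ.abs-◃ σ (suc i)))
        (s≤s (subst (λ t → k ℕ.≤ t ℕ.+ j) (ℤ.abs-◃ σ i) k≤)))
      (trans (translate-+ (σ ℤ.◃ 1 , 0ℤ) (σ ℤ.◃ i , + j) c)
        (cong (λ t → translate (t , + j) c) (◃-suc σ i)))
  reach-side {σ = σ} {c = c} o k≤1 (reach (above x j) _ refl) =
    reach (region-above o _ j)
      (ℕ.≤-trans (s≤s k≤1) (ℕ.≤-trans (ℕ.m≤m+n 2 j) (ℕ.m≤n+m (2 ℕ.+ j) ℤ.∣ (σ ℤ.◃ 1) ℤ.+ x ∣)))
      (translate-+ (σ ℤ.◃ 1 , 0ℤ) (x , + (2 ℕ.+ j)) c)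

  reach-weaken : Reach s 1 c q → Reach s 0 c q
  reach-weaken (reach r _ eq) = reach r z≤n eq

  reach-trail : ∀ c (w : Word s m) → All (Reach s 1 c) (trail c w)
  reach-trail c [] = []
  reach-trail c (↑ w) =
    reach-up (reach-start _) ∷ All.map (reach-up ∘ reach-weaken) (reach-trail (up c) w)
  reach-trail c (o ↠ w) =
    reach-side o z≤n (reach-start _) ∷ All.map (reach-side o z≤n ∘ reach-weaken) (reach-trail _ w)

  reach⇒Far : ∀ c → Reach s 2 c q → Far c q
  reach⇒Far c (reach {v} _ 2≤ refl) = subst (2 ℕ.≤_) (sym (distance-translate v c)) 2≤

  up-Adjacent : ∀ c → Adjacent c (up c)
  up-Adjacent = distance-translate (0ℤ , 1ℤ)

  side-Adjacent : ∀ σ c → Adjacent c (side σ c)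
  side-Adjacent Sign.+ = distance-translate (1ℤ , 0ℤ)
  side-Adjacent Sign.- = distance-translate (ℤ.-1ℤ , 0ℤ)

  cells-Induced : ∀ c (w : Word s m) → Induced (cells c w)
  cells-Induced c []    = [-]
  cells-Induced c (↑ w) =
    up-Adjacent c ⟨ All.map (reach⇒Far c ∘ reach-up) (reach-trail (up c) w) ⟩∷ cells-Induced (up c) w
  cells-Induced c (_↠_ {σ = σ} o w) =
    side-Adjacent σ c
      ⟨ All.map (reach⇒Far c ∘ reach-side o (s≤s z≤n)) (reach-trail (side σ c) w) ⟩∷
    cells-Induced (side σ c) w

  -- Every directed listing of a snake is given by a word

  opposite-side : ∀ σ c → side (opposite σ) (side σ c) ≡ c
  opposite-side Sign.+ c = trans (translate-+ (1ℤ , 0ℤ) (ℤ.-1ℤ , 0ℤ) c) (translate-0 c)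
  opposite-side Sign.- c = trans (translate-+ (ℤ.-1ℤ , 0ℤ) (1ℤ , 0ℤ) c) (translate-0 c)

  opposite-side-up : ∀ σ c → side (opposite σ) (up (side σ c)) ≡ up c
  opposite-side-up σ c = trans (cong (side (opposite σ)) (commute σ)) (opposite-side σ (up c))
    where
    commute : ∀ σ → up (side σ c) ≡ side σ (up c)
    commute Sign.+ = trans (translate-+ (1ℤ , 0ℤ) (0ℤ , 1ℤ) c) (sym (translate-+ (0ℤ , 1ℤ) (1ℤ , 0ℤ) c))
    commute Sign.- = trans (translate-+ (ℤ.-1ℤ , 0ℤ) (0ℤ , 1ℤ) c) (sym (translate-+ (0ℤ , 1ℤ) (ℤ.-1ℤ , 0ℤ) c))

  -- The cells behind `c` that a state remembers: just enough to exhibit the repeated cell or the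
  -- square that a forbidden turn would create.
  data Past : State → List Cell → Cell → Set where
    free : Past free [] c
    on   : Past (on σ) (p ∷ []) (side σ p)
    over : Past (over σ) (p ∷ side σ p ∷ []) (up (side σ p))

  -- Turning back over the previous horizontal step closes a square.
  square : ∀ σ p → Unique (p ∷ side σ p ∷ up (side σ p) ∷ up p ∷ []) →
    All (_∈ P) (p ∷ side σ p ∷ up (side σ p) ∷ up p ∷ []) → Cycle P
  square σ p uniq inside = record
    { length≥3 = s≤s (s≤s (s≤s z≤n))
    ; distinct = uniq
    ; inside   = inside
    ; closed   = side-Adjacent σ p ∷ up-Adjacent (side σ p)
        ∷ subst (Adjacent (up (side σ p))) (opposite-side-up σ p) (side-Adjacent (opposite σ) (up (side σ p)))
        ∷ Adjacent-sym {p} {up p} (up-Adjacent p) ∷ [-]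
    }

  data Move (c : Cell) : Cell → Set where
    upward   : Move c (up c)
    sideways : ∀ σ → Move c (side σ c)

  move : Step c d → Move c d
  move north = upward
  move east  = sideways Sign.+
  move west  = sideways Sign.-

  data Compare (σ : Sign) : Sign → Set where
    equal   : Compare σ σ
    against : Compare σ (opposite σ)

  compare : ∀ σ τ → Compare σ τ
  compare Sign.+ Sign.+ = equal
  compare Sign.+ Sign.- = against
  compare Sign.- Sign.- = equal
  compare Sign.- Sign.+ = against

  -- A reversal after `on σ` would revisit `p`, against uniqueness. After `over σ` it would reach
  -- `up p` and complete a two-by-two square, against acyclicity.
  open-side : ∀ {l} → ¬ Cycle P → Past s h c → Unique (h ++ c ∷ side τ c ∷ l) →
    All (_∈ P) (h ++ c ∷ side τ c ∷ l) → Open s τ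
  open-side _ free _ _ = free
  open-side {τ = τ} _ (on {σ = σ} {p = p}) ((_ ∷ p≢ ∷ _) ∷ _) _ with compare σ τ
  ... | equal   = on
  ... | against = contradiction (sym (opposite-side σ p)) p≢
  open-side {τ = τ} acyclic (over {σ = σ} {p = p}) uniq ins with compare σ τ
  ... | equal   = over
  ... | against = contradiction
    (square σ p (first-four uniq′) (All-four (subst (λ t → All _ (p ∷ side σ p ∷ up (side σ p) ∷ t ∷ _)) (opposite-side-up σ p) ins)))
    acyclic
    where
    uniq′ = subst (λ t → Unique (p ∷ side σ p ∷ up (side σ p) ∷ t ∷ _)) (opposite-side-up σ p) uniq
    first-four : ∀ {a b c d l} → Unique (a ∷ b ∷ c ∷ d ∷ l) → Unique (a ∷ b ∷ c ∷ d ∷ [])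
    first-four ((ab ∷ ac ∷ ad ∷ _) ∷ (bc ∷ bd ∷ _) ∷ (cd ∷ _) ∷ _) =
      (ab ∷ ac ∷ ad ∷ []) ∷ (bc ∷ bd ∷ []) ∷ (cd ∷ []) ∷ [] ∷ []
    All-four : ∀ {a b c d l} → All (_∈ P) (a ∷ b ∷ c ∷ d ∷ l) → All (_∈ P) (a ∷ b ∷ c ∷ d ∷ [])
    All-four (a ∷ b ∷ c ∷ d ∷ _) = a ∷ b ∷ c ∷ d ∷ []

  drop-past : ∀ h → Unique (h ++ l) → Unique l
  drop-past []      uniq       = uniq
  drop-past (_ ∷ h) (_ ∷ uniq) = drop-past h uniq

  drop-past-All : ∀ h → All (_∈ P) (h ++ l) → All (_∈ P) l
  drop-past-All []      ins       = ins
  drop-past-All (_ ∷ h) (_ ∷ ins) = drop-past-All h ins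

  -- Uniqueness and membership are carried for the remembered cells `h` as well, because these take
  -- part in the obstruction to the next step.
  parse : ¬ Cycle P → Past s h c → Linked Step (c ∷ l) → Unique (h ++ c ∷ l) → All (_∈ P) (h ++ c ∷ l) →
    ∃[ w ] trail {s} {length l} c w ≡ l
  parse _ _ [-] _ _ = [] , refl
  parse {h = h} {c = c} acyclic past (step ∷ steps) uniq ins with move step
  parse {h = h} acyclic past (_ ∷ steps) uniq ins | sideways σ
    with w , eq ← parse acyclic on steps (drop-past h uniq) (drop-past-All h ins) =
    open-side acyclic past uniq ins ↠ w , cong (_ ∷_) eq
  parse acyclic free (_ ∷ steps) (_ ∷ uniq) (_ ∷ ins) | upward
    with w , eq ← parse acyclic free steps uniq ins = ↑ w , cong (_ ∷_) eq
  parse acyclic on (_ ∷ steps) uniq ins | upward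
    with w , eq ← parse acyclic over steps uniq ins = ↑ w , cong (_ ∷_) eq
  parse acyclic over (_ ∷ steps) (_ ∷ _ ∷ _ ∷ uniq) (_ ∷ _ ∷ _ ∷ ins) | upward
    with w , eq ← parse acyclic free steps uniq ins = ↑ w , cong (_ ∷_) eq

  translate-injective : ∀ v → translate v c ≡ translate v d → c ≡ d
  translate-injective {x , y} {x′ , y′} (a , b) eq =
    cong₂ _,_ (ℤ+.∙-cancelʳ a x x′ (cong proj₁ eq)) (ℤ+.∙-cancelʳ b y y′ (cong proj₂ eq))

  up≢side : ∀ c → up c ≢ side σ c
  up≢side {σ} (x , y) eq with () ← ℤ+.∙-cancelˡ y 1ℤ 0ℤ (cong proj₂ eq)

  side-injective : side σ c ≡ side τ c → σ ≡ τ
  side-injective {σ} {x , y} {τ} eq =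
    ◃1 σ τ (ℤ+.∙-cancelˡ x (σ ℤ.◃ 1) (τ ℤ.◃ 1) (cong proj₁ eq))
    where
    ◃1 : ∀ σ τ → σ ℤ.◃ 1 ≡ τ ℤ.◃ 1 → σ ≡ τ
    ◃1 Sign.+ Sign.+ _ = refl
    ◃1 Sign.- Sign.- _ = refl

  Open-irrelevant : (o o′ : Open s σ) → o ≡ o′
  Open-irrelevant free free = refl
  Open-irrelevant on   on   = refl
  Open-irrelevant over over = refl

  trail-injective : ∀ c (w w′ : Word s m) → trail c w ≡ trail c w′ → w ≡ w′
  trail-injective c []    []     _  = refl
  trail-injective c (↑ w) (↑ w′) eq = cong ↑_ (trail-injective (up c) w w′ (∷-injectiveʳ eq))
  trail-injective c (↑ w) (o ↠ w′) eq = contradiction (∷-injectiveˡ eq) (up≢side c)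
  trail-injective c (o ↠ w) (↑ w′) eq = contradiction (sym (∷-injectiveˡ eq)) (up≢side c)
  trail-injective c (_↠_ {σ = σ} o w) (_↠_ {σ = τ} o′ w′) eq
    with refl ← side-injective {c = c} (∷-injectiveˡ eq) =
    cong₂ _↠_ (Open-irrelevant o o′) (trail-injective (side σ c) w w′ (∷-injectiveʳ eq))

-- Snakes up to translation, classified by words

module Classification where

  open InducedPaths
  open DirectedWords
  open import Data.Integer.Base as ℤ using (ℤ; +_; 0ℤ; 1ℤ)
  import Data.Integer.Properties as ℤ
  open import Data.Integer.Solver using (module +-*-Solver)
  open import Data.List.Base using (List; []; _∷_; length; map)
  open import Data.List.Membership.Propositional using (_∈_)
  open import Data.List.Membership.Propositional.Properties using (∈-map⁺; ∈-map⁻)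
  open import Data.List.Properties using (∷-injectiveˡ; ∷-injectiveʳ)
  open import Data.List.Relation.Binary.Permutation.Propositional using (_↭_; ↭-refl; ↭-sym; ↭⇒↭ₛ)
  open import Data.List.Relation.Binary.Permutation.Propositional.Properties
    using (∈-resp-↭; ↭-length)
  import Data.List.Relation.Binary.Permutation.Setoid.Properties as Permutation
  open import Data.List.Relation.Unary.All as All using (All; []; _∷_)
  open import Data.List.Relation.Unary.Any using (here; there)
  open import Data.List.Relation.Unary.Linked as Linked using (Linked; []; _∷_)
  open import Data.Maybe.Base as Maybe using (Maybe; just; nothing)
  open import Data.Nat.Base as ℕ using (ℕ; zero; suc)
  import Data.Nat.Properties as ℕ
  open import Data.Product using (∃-syntax; _×_; _,_)
  open import Data.Sign.Base as Sign using (Sign; opposite)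
  open import Data.Sum.Base using (inj₁; inj₂)
  open import Function.Bundles using (_⇔_; mk⇔; Equivalence; Bijection)
  open import Relation.Binary.PropositionalEquality

  open TranslationProperties

  private
    variable
      a b c d p q : Cell
      h l l′ P : List Cell
      m n : ℕ
      σ τ : Sign
      s s′ : State

  -- Words that climb at least once: a horizontal prefix, a step up, then anything. These are the
  -- words recoverable from their cell sets; the straight ones are merged into `nothing` by `bend`.
  data Bent : State → ℕ → Set where
    ↑_  : Word (rise s) m → Bent s (suc m)
    _↠_ : Open s σ → Bent (on σ) m → Bent s (suc m)

  forget : Bent s m → Word s m
  forget (↑ w)   = ↑ w
  forget (o ↠ b) = o ↠ forget b

  bend : Word s m → Maybe (Bent s m)
  bend []      = nothing
  bend (↑ w)   = just (↑ w)
  bend (o ↠ w) = Maybe.map (o ↠_) (bend w)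

  bend-forget : (b : Bent s m) → bend (forget b) ≡ just b
  bend-forget (↑ w)   = refl
  bend-forget (o ↠ b) = cong (Maybe.map (o ↠_)) (bend-forget b)

  forget-bend : (w : Word s m) {b : Bent s m} → bend w ≡ just b → forget b ≡ w
  forget-bend (↑ w)   refl = refl
  forget-bend (o ↠ w) eq with just b ← bend w in eq′ | refl ← eq = cong (o ↠_) (forget-bend w eq′)

  SameRow⇒unbent : ∀ c (w : Word s m) → All (SameRow a) (cells c w) → bend w ≡ nothing
  SameRow⇒unbent c [] _ = refl
  SameRow⇒unbent (x , y) (↑ w) (eq ∷ eq′ ∷ _) with () ←
    ℤ+.∙-cancelˡ y 1ℤ 0ℤ (trans (trans (sym eq′) eq) (sym (ℤ.+-identityʳ y)))
  SameRow⇒unbent {a = a} c (_↠_ {σ = σ} o w) (_ ∷ eqs)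
    rewrite SameRow⇒unbent {a = a} (side σ c) w eqs = refl

  line : ∀ σ m → Word (on σ) m
  line σ zero    = []
  line σ (suc m) = on ↠ line σ m

  row : Cell → Sign → ℕ → List Cell
  row c σ m = cells c (line σ m)

  unbent⇒line : (w : Word (on σ) m) → bend w ≡ nothing → w ≡ line σ m
  unbent⇒line []       _  = refl
  unbent⇒line (on ↠ w) eq with nothing ← bend w in eq′ = cong (on ↠_) (unbent⇒line w eq′)

  unbent⇒row : (w : Word free m) → bend w ≡ nothing → ∃[ σ ] (∀ c → cells c w ≡ row c σ m)
  -- A single cell is a row in either direction; the sign is an arbitrary choice.
  unbent⇒row []       _  = Sign.+ , λ _ → refl
  unbent⇒row (_↠_ {σ = σ} free w) eq with nothing ← bend w in eq′ =
    σ , λ c → cong (λ w → c ∷ cells (side σ c) w) (unbent⇒line w eq′)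

  -- Translating words

  translate-comm : ∀ v w c → translate v (translate w c) ≡ translate w (translate v c)
  translate-comm v@(a , b) w@(a′ , b′) c = trans (translate-+ w v c)
    (trans (cong (λ u → translate u c) (cong₂ _,_ (ℤ.+-comm a′ a) (ℤ.+-comm b′ b))) (sym (translate-+ v w c)))

  cells-translate : ∀ v c (w : Word s m) → map (translate v) (cells c w) ≡ cells (translate v c) w
  cells-translate v c [] = refl
  cells-translate v c (↑ w) = cong (translate v c ∷_)
    (trans (cells-translate v (up c) w) (cong (λ d → cells d w) (translate-comm v (0ℤ , 1ℤ) c)))
  cells-translate v c (_↠_ {σ = σ} _ w) = cong (translate v c ∷_)
    (trans (cells-translate v (side σ c) w) (cong (λ d → cells d w) (translate-comm v (σ ℤ.◃ 1 , 0ℤ) c)))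

  ≈ᵗ-map : ∀ v l → l ≈ᵗ map (translate v) l
  ≈ᵗ-map v l = v , λ c → mk⇔ (∈-map⁺ (translate v)) λ c∈ →
    let d , d∈ , eq = ∈-map⁻ (translate v) c∈
    in subst (_∈ l) (sym (translate-injective v eq)) d∈

  difference : ∀ c d → ∃[ v ] translate v c ≡ d
  difference c@(x , y) d@(x′ , y′) = translate (neg c) d
    , trans (cong₂ _,_ (ℤ.+-comm x _) (ℤ.+-comm y _)) (translate-neg c d)

  cells-≈ᵗ : ∀ c d (w : Word s m) → cells c w ≈ᵗ cells d w
  cells-≈ᵗ c d w with v , refl ← difference c d =
    subst (cells c w ≈ᵗ_) (cells-translate v c w) (≈ᵗ-map v (cells c w))

  ∈-row⁻ : ∀ m → q ∈ row c σ m → ∃[ i ] ∃[ j ] (i ℕ.+ j ≡ m × q ≡ translate (σ ℤ.◃ i , 0ℤ) c)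
  ∈-row⁻ {c = c} m (here refl) = 0 , m , refl , sym (translate-0 c)
  ∈-row⁻ {c = c} {σ} (suc m) (there q∈) with i , j , refl , refl ← ∈-row⁻ m q∈ =
    suc i , j , refl , trans (translate-+ (σ ℤ.◃ 1 , 0ℤ) (σ ℤ.◃ i , 0ℤ) c)
      (cong (λ t → translate (t , 0ℤ) c) (◃-suc σ i))

  ∈-row⁺ : ∀ i j → translate (σ ℤ.◃ i , 0ℤ) c ∈ row c σ (i ℕ.+ j)
  ∈-row⁺ {c = c} zero j = here (translate-0 c)
  ∈-row⁺ {σ} {c} (suc i) j = there (subst (_∈ row (side σ c) σ (i ℕ.+ j))
    (trans (translate-+ (σ ℤ.◃ 1 , 0ℤ) (σ ℤ.◃ i , 0ℤ) c) (cong (λ t → translate (t , 0ℤ) c) (◃-suc σ i)))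
    (∈-row⁺ i j))

  ◃-opposite : ∀ σ i j → (σ ℤ.◃ i) ℤ.+ (opposite σ ℤ.◃ (i ℕ.+ j)) ≡ (opposite σ ℤ.◃ j)
  ◃-opposite Sign.+ i j
    rewrite ℤ.+◃n≡+n i | ℤ.-◃n≡-n (i ℕ.+ j) | ℤ.-◃n≡-n j | ℤ.pos-+ i j =
    solve 2 (λ i j → i :+ :- (i :+ j) := :- j) refl (+ i) (+ j)
    where open +-*-Solver
  ◃-opposite Sign.- i j
    rewrite ℤ.-◃n≡-n i | ℤ.+◃n≡+n (i ℕ.+ j) | ℤ.+◃n≡+n j | ℤ.pos-+ i j =
    solve 2 (λ i j → :- i :+ (i :+ j) := j) refl (+ i) (+ j)
    where open +-*-Solver

  -- Slide the row backwards by its own length: the cell `i` steps from the start lands `j` steps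
  -- along the opposite row, where `i + j = m`.
  row-reverse : ∀ c σ m → row c σ m ≈ᵗ row c (opposite σ) m
  row-reverse c σ m = (opposite σ ℤ.◃ m , 0ℤ) , λ q → mk⇔ to from
    where
    shift : ∀ i j → translate (opposite σ ℤ.◃ (i ℕ.+ j) , 0ℤ) (translate (σ ℤ.◃ i , 0ℤ) c) ≡
      translate (opposite σ ℤ.◃ j , 0ℤ) c
    shift i j = trans (translate-+ (σ ℤ.◃ i , 0ℤ) (opposite σ ℤ.◃ (i ℕ.+ j) , 0ℤ) c)
      (cong (λ t → translate (t , 0ℤ) c) (◃-opposite σ i j))
    to : q ∈ row c σ m → translate (opposite σ ℤ.◃ m , 0ℤ) q ∈ row c (opposite σ) m
    to q∈ with i , j , refl , refl ← ∈-row⁻ m q∈ =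
      subst₂ _∈_ (sym (shift i j)) (cong (row c (opposite σ)) (ℕ.+-comm j i)) (∈-row⁺ j i)
    from : translate (opposite σ ℤ.◃ m , 0ℤ) q ∈ row c (opposite σ) m → q ∈ row c σ m
    from q∈ with i , j , refl , eq ← ∈-row⁻ m q∈ =
      subst₂ _∈_
        (translate-injective (opposite σ ℤ.◃ (i ℕ.+ j) , 0ℤ)
          (trans (cong (λ k → translate (opposite σ ℤ.◃ k , 0ℤ) (translate (σ ℤ.◃ j , 0ℤ) c)) (ℕ.+-comm i j))
            (trans (shift j i) (sym eq))))
        (cong (row c σ) (ℕ.+-comm j i)) (∈-row⁺ j i)

  row-≈ᵗ : ∀ c d σ τ m → row c σ m ≈ᵗ row d τ m
  row-≈ᵗ c d σ τ m with compare σ τ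
  ... | equal   = cells-≈ᵗ c d (line σ m)
  ... | against = ≈ᵗ-trans {row c σ m} {row d σ m} (cells-≈ᵗ c d (line σ m)) (row-reverse d σ m)

  -- Classification of partially directed snakes

  cells-≼ : ∀ c (w : Word s m) → Linked _≼_ (cells c w)
  cells-≼ c w = Linked.map climb (trail-Step c w)
    where
    climb : Step a b → a ≼ b
    climb {_ , y} north = ℤ.i≤i+j y 1ℤ
    climb {_ , y} east  = ℤ.i≤i+j y 0ℤ
    climb {_ , y} west  = ℤ.i≤i+j y 0ℤ

  -- By `aligned`, either the two lists coincide, and then so do the words, or both lie in one row
  -- and both words are straight.
  same-cells⇒bend : ∀ c d (w w′ : Word free m) → cells c w ⊆ cells d w′ → cells d w′ ⊆ cells c w →
    bend w ≡ bend w′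
  same-cells⇒bend c d w w′ sub sup
    with aligned (cells-Induced c w) (cells-Induced d w′) (cells-≼ c w) (cells-≼ d w′) sub sup
  ... | inj₁ eq with refl ← ∷-injectiveˡ eq = cong bend (trail-injective c w w′ (∷-injectiveʳ eq))
  ... | inj₂ (a , flat , flat′) =
    trans (SameRow⇒unbent {a = a} c w flat) (sym (SameRow⇒unbent {a = a} d w′ flat′))

  record Traced (m : ℕ) (P : List Cell) : Set where
    constructor traced
    field
      start : Cell
      word  : Word free m
      trace : cells start word ↭ P

  trace : IsPDS P → length P ≡ suc m → Traced m P
  trace {P} {m} isPDS size = go (IsPDS.listing isPDS) (IsPDS.lists isPDS) (IsPDS.directed isPDS)
    where
    open IsSnake (IsPDS.isSnake isPDS)
    go : ∀ l → l ↭ P → Linked Step l → Traced m P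
    go [] perm _ with () ← trans (↭-length perm) size
    go (c ∷ l) perm steps with refl ← ℕ.suc-injective (trans (↭-length perm) size)
      with w , eq ← parse acyclic free steps
        (Permutation.Unique-resp-↭ (setoid Cell) (↭⇒↭ₛ (↭-sym perm)) (IsPolyomino.unique isPolyomino))
        (All.tabulate (∈-resp-↭ perm))
      = traced c w (subst (λ t → c ∷ t ↭ P) (sym eq) perm)

  PDS-trace : (S : PDS (suc m)) → Traced m (PDS.cells S)
  PDS-trace S = trace (PDS.isPDS S) (PDS.size S)

  ↭⇒≈ᵗ : l ↭ l′ → l ≈ᵗ l′
  ↭⇒≈ᵗ {l} {l′} perm = (0ℤ , 0ℤ) , λ c →
    subst (λ d → c ∈ l ⇔ d ∈ l′) (sym (translate-0 c)) (mk⇔ (∈-resp-↭ perm) (∈-resp-↭ (↭-sym perm)))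

  -- The word is read from whichever listing the snake carries; `bend` erases the dependence on that
  -- choice and leaves a complete invariant of the cell set up to translation.
  shape : PDS (suc m) → Maybe (Bent free m)
  shape S = bend (Traced.word (PDS-trace S))

  ≈ᵗ⇒bend : ∀ c d (w w′ : Word free m) → cells c w ≈ᵗ cells d w′ → bend w ≡ bend w′
  ≈ᵗ⇒bend c d w w′ (v , e) = same-cells⇒bend (translate v c) d w w′ sub sup
    where
    open Equivalence
    sub : cells (translate v c) w ⊆ cells d w′
    sub {q} q∈ with r , r∈ , refl ← ∈-map⁻ (translate v) (subst (q ∈_) (sym (cells-translate v c w)) q∈) =
      to (e r) r∈
    sup : cells d w′ ⊆ cells (translate v c) w
    sup {q} q∈ = subst₂ _∈_ (translate-neg v q) (cells-translate v c w)
      (∈-map⁺ (translate v) (from (e (translate (neg v) q)) (subst (_∈ cells d w′) (sym (translate-neg v q)) q∈)))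

  bend⇒≈ᵗ : ∀ c d (w w′ : Word free m) → bend w ≡ bend w′ → cells c w ≈ᵗ cells d w′
  bend⇒≈ᵗ {m} c d w w′ eq with bend w in eq₁ | bend w′ in eq₂
  ... | just b  | just b′ with refl ← eq with refl ← forget-bend w eq₁ | refl ← forget-bend w′ eq₂ =
    cells-≈ᵗ c d w
  ... | nothing | nothing with σ , row₁ ← unbent⇒row w eq₁ | τ , row₂ ← unbent⇒row w′ eq₂ =
    subst₂ _≈ᵗ_ (sym (row₁ c)) (sym (row₂ d)) (row-≈ᵗ c d σ τ m)

  shape-cong : ∀ (S T : PDS (suc m)) → PDS.cells S ≈ᵗ PDS.cells T → shape S ≡ shape T
  shape-cong S T e with traced c w perm ← PDS-trace S | traced d w′ perm′ ← PDS-trace T =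
    ≈ᵗ⇒bend c d w w′ (≈ᵗ-trans {cells c w} {PDS.cells S} (↭⇒≈ᵗ perm)
      (≈ᵗ-trans {PDS.cells S} {PDS.cells T} e (↭⇒≈ᵗ (↭-sym perm′))))

  shape-injective : ∀ (S T : PDS (suc m)) → shape S ≡ shape T → PDS.cells S ≈ᵗ PDS.cells T
  shape-injective S T eq with traced c w perm ← PDS-trace S | traced d w′ perm′ ← PDS-trace T =
    ≈ᵗ-trans {PDS.cells S} {cells c w} (↭⇒≈ᵗ (↭-sym perm))
      (≈ᵗ-trans {cells c w} {cells d w′} (bend⇒≈ᵗ c d w w′ eq) (↭⇒≈ᵗ perm′))

  draw : Word free m → PDS (suc m)
  draw w = record
    { cells = cells (0ℤ , 0ℤ) w
    ; size  = cong suc (trail-length _ w)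
    ; isPDS = record
      { isSnake  = Induced⇒IsSnake (cells-Induced (0ℤ , 0ℤ) w)
      ; listing  = cells (0ℤ , 0ℤ) w
      ; lists    = ↭-refl
      ; directed = trail-Step (0ℤ , 0ℤ) w
      }
    }

  -- Instead of computing `parse` on the drawn cells, compare the word it returns with `w` through
  -- their common cell set.
  shape-draw : (w : Word free m) → shape (draw w) ≡ bend w
  shape-draw w with traced c w′ perm ← PDS-trace (draw w) = ≈ᵗ⇒bend c (0ℤ , 0ℤ) w′ w (↭⇒≈ᵗ perm)

  straight : ∀ m → ∃[ w ] bend {free} {m} w ≡ nothing
  straight zero    = [] , refl
  straight (suc m) = free ↠ line Sign.+ m , cong (Maybe.map _) (unbent m)
    where
    unbent : ∀ m → bend (line Sign.+ m) ≡ nothing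
    unbent zero    = refl
    unbent (suc m) = cong (Maybe.map _) (unbent m)

  bend-surjective : (k : Maybe (Bent free m)) → ∃[ w ] bend {free} w ≡ k
  bend-surjective (just b) = forget b , bend-forget b
  bend-surjective nothing  = straight _

  shape-bijection : ∀ m → Bijection (PDS-setoid (suc m)) (setoid (Maybe (Bent free m)))
  shape-bijection m = record
    { to        = shape
    ; cong      = λ {S} {T} → shape-cong S T
    ; bijective = (λ {S} {T} → shape-injective S T) , λ k →
        let w , eq = bend-surjective k
        in draw w , λ {S} S≈ → trans (shape-cong S (draw w) S≈) (trans (shape-draw w) eq)
    }

-- Transfer recurrences and the number of snakes

module Counting where

  open InducedPaths
  open DirectedWords
  open Classification
  open import Data.Fin.Base as Fin using (Fin)
  open import Data.Fin.Properties using (+↔⊎; 1↔⊤)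
  open import Data.List.Base using ([])
  open import Data.List.Relation.Binary.Permutation.Propositional using (↭-refl)
  open import Data.List.Relation.Unary.Linked using ([])
  open import Data.Maybe.Base using (Maybe; just; nothing)
  open import Data.Nat.Base as ℕ using (ℕ; zero; suc)
  import Data.Nat.Properties as ℕ
  import Data.Nat.Solver as ℕ
  open import Data.Product using (_,_)
  open import Data.Sign.Base as Sign using (Sign)
  open import Data.Sum.Base using (_⊎_; inj₁; inj₂)
  open import Data.Sum.Function.Propositional using (_⊎-↔_)
  open import Data.Unit.Base using (tt)
  open import Function.Bundles using (_↔_; mk↔ₛ′)
  import Function.Construct.Composition as Composition
  open import Function.Properties.Inverse using (↔-sym; ↔-trans; ↔⇒⤖)
  open import Relation.Binary.PropositionalEquality

  open TranslationProperties

  private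
    variable
      m : ℕ
      s : State

  freeWords onWords overWords : ℕ → ℕ
  freeWords zero    = 1
  freeWords (suc m) = freeWords m ℕ.+ (onWords m ℕ.+ onWords m)
  onWords zero      = 1
  onWords (suc m)   = overWords m ℕ.+ onWords m
  overWords zero    = 1
  overWords (suc m) = freeWords m ℕ.+ onWords m

  words : State → ℕ → ℕ
  words free     = freeWords
  words (on _)   = onWords
  words (over _) = overWords

  -- The word recurrences with the empty word rejected. Once a step up has been made every
  -- continuation counts, so the first summands remain `freeWords` and `overWords`.
  freeBents onBents : ℕ → ℕ
  freeBents zero    = 0
  freeBents (suc m) = freeWords m ℕ.+ (onBents m ℕ.+ onBents m)
  onBents zero      = 0
  onBents (suc m)   = overWords m ℕ.+ onBents m

  infixr 1 _⊕_
  _⊕_ : ∀ {A B : Set} {k n} → A ↔ Fin k → B ↔ Fin n → (A ⊎ B) ↔ Fin (k ℕ.+ n)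
  f ⊕ g = ↔-trans (f ⊎-↔ g) (↔-sym +↔⊎)

  []↔Fin : Word s 0 ↔ Fin 1
  []↔Fin = mk↔ₛ′ (λ _ → Fin.zero) (λ _ → []) (λ { Fin.zero → refl ; (Fin.suc ()) }) (λ { [] → refl })

  Word↔Fin : ∀ s m → Word s m ↔ Fin (words s m)
  Word↔Fin free     zero = []↔Fin
  Word↔Fin (on _)   zero = []↔Fin
  Word↔Fin (over _) zero = []↔Fin
  Word↔Fin free (suc m) = ↔-trans
    (mk↔ₛ′
      (λ { (↑ w)                    → inj₁ w
         ; (free {σ = Sign.+} ↠ w)  → inj₂ (inj₁ w)
         ; (free {σ = Sign.-} ↠ w)  → inj₂ (inj₂ w) })
      (λ { (inj₁ w) → ↑ w ; (inj₂ (inj₁ w)) → free ↠ w ; (inj₂ (inj₂ w)) → free ↠ w })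
      (λ { (inj₁ w) → refl ; (inj₂ (inj₁ w)) → refl ; (inj₂ (inj₂ w)) → refl })
      (λ { (↑ w) → refl ; (free {σ = Sign.+} ↠ w) → refl ; (free {σ = Sign.-} ↠ w) → refl }))
    (Word↔Fin free m ⊕ Word↔Fin (on Sign.+) m ⊕ Word↔Fin (on Sign.-) m)
  Word↔Fin (on σ) (suc m) = ↔-trans
    (mk↔ₛ′
      (λ { (↑ w) → inj₁ w ; (on ↠ w) → inj₂ w })
      (λ { (inj₁ w) → ↑ w ; (inj₂ w) → on ↠ w })
      (λ { (inj₁ w) → refl ; (inj₂ w) → refl })
      (λ { (↑ w) → refl ; (on ↠ w) → refl }))
    (Word↔Fin (over σ) m ⊕ Word↔Fin (on σ) m)
  Word↔Fin (over σ) (suc m) = ↔-trans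
    (mk↔ₛ′
      (λ { (↑ w) → inj₁ w ; (over ↠ w) → inj₂ w })
      (λ { (inj₁ w) → ↑ w ; (inj₂ w) → over ↠ w })
      (λ { (inj₁ w) → refl ; (inj₂ w) → refl })
      (λ { (↑ w) → refl ; (over ↠ w) → refl }))
    (Word↔Fin free m ⊕ Word↔Fin (on σ) m)

  onBent↔Fin : ∀ σ m → Bent (on σ) m ↔ Fin (onBents m)
  onBent↔Fin σ zero    = mk↔ₛ′ (λ ()) (λ ()) (λ ()) (λ ())
  onBent↔Fin σ (suc m) = ↔-trans
    (mk↔ₛ′
      (λ { (↑ w) → inj₁ w ; (on ↠ b) → inj₂ b })
      (λ { (inj₁ w) → ↑ w ; (inj₂ b) → on ↠ b })
      (λ { (inj₁ w) → refl ; (inj₂ b) → refl })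
      (λ { (↑ w) → refl ; (on ↠ b) → refl }))
    (Word↔Fin (over σ) m ⊕ onBent↔Fin σ m)

  freeBent↔Fin : ∀ m → Bent free m ↔ Fin (freeBents m)
  freeBent↔Fin zero    = mk↔ₛ′ (λ ()) (λ ()) (λ ()) (λ ())
  freeBent↔Fin (suc m) = ↔-trans
    (mk↔ₛ′
      (λ { (↑ w)                    → inj₁ w
         ; (free {σ = Sign.+} ↠ b)  → inj₂ (inj₁ b)
         ; (free {σ = Sign.-} ↠ b)  → inj₂ (inj₂ b) })
      (λ { (inj₁ w) → ↑ w ; (inj₂ (inj₁ b)) → free ↠ b ; (inj₂ (inj₂ b)) → free ↠ b })
      (λ { (inj₁ w) → refl ; (inj₂ (inj₁ b)) → refl ; (inj₂ (inj₂ b)) → refl })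
      (λ { (↑ w) → refl ; (free {σ = Sign.+} ↠ b) → refl ; (free {σ = Sign.-} ↠ b) → refl }))
    (Word↔Fin free m ⊕ onBent↔Fin Sign.+ m ⊕ onBent↔Fin Sign.- m)

  Maybe↔Fin : ∀ {A : Set} {n} → A ↔ Fin n → Maybe A ↔ Fin (suc n)
  Maybe↔Fin A↔ = ↔-trans
    (mk↔ₛ′
      (λ { nothing → inj₁ tt ; (just a) → inj₂ a })
      (λ { (inj₁ tt) → nothing ; (inj₂ a) → just a })
      (λ { (inj₁ tt) → refl ; (inj₂ a) → refl })
      (λ { nothing → refl ; (just a) → refl }))
    (↔-sym 1↔⊤ ⊕ A↔)

  pds : ℕ → ℕ
  pds zero    = 1
  pds (suc m) = suc (freeBents m)

  PDS-cardinality : ∀ n → HasCardinality (PDS-setoid n) (pds n)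
  PDS-cardinality zero = record
    { to        = λ _ → Fin.zero
    ; cong      = λ _ → refl
    ; bijective = (λ {S} {T} _ → empty S T) , λ { Fin.zero → nil , λ _ → refl }
    }
    where
    empty : (S T : PDS 0) → PDS.cells S ≈ᵗ PDS.cells T
    empty record { cells = [] } record { cells = [] } = ≈ᵗ-refl {[]}
    nil : PDS 0
    nil = record
      { cells = []
      ; size  = refl
      ; isPDS = record
        { isSnake  = Induced⇒IsSnake []
        ; listing  = []
        ; lists    = ↭-refl
        ; directed = []
        }
      }
  PDS-cardinality (suc m) =
    Composition.bijection (shape-bijection m) (↔⇒⤖ (Maybe↔Fin (freeBent↔Fin m)))

  -- Cayley-Hamilton for the transfer matrix on the triple (`freeWords`, `onWords`, `overWords`),
  -- whose characteristic polynomial is x³ - 2x² - 1.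
  freeWords-recurrence : ∀ m → freeWords (3 ℕ.+ m) ≡ 2 ℕ.* freeWords (2 ℕ.+ m) ℕ.+ freeWords m
  freeWords-recurrence m =
    solve 3 (λ f o v →
        let o₁ = v :+ o ; v₁ = f :+ o ; f₁ = f :+ (o :+ o)
            o₂ = v₁ :+ o₁ ; f₂ = f₁ :+ (o₁ :+ o₁)
        in f₂ :+ (o₂ :+ o₂) := con 2 :* f₂ :+ f)
      refl (freeWords m) (onWords m) (overWords m)
    where open ℕ.+-*-Solver

  onWords-onBents : ∀ m → onWords m ≡ suc (onBents m)
  onWords-onBents zero    = refl
  onWords-onBents (suc m) = trans (cong (overWords m ℕ.+_) (onWords-onBents m)) (ℕ.+-suc _ _)

  -- From the free state exactly two words of positive length are straight, one for each direction,
  -- and they draw one row; words therefore exceed snakes by one. A single cell has only one word,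
  -- so the relation starts at two cells.
  suc-pds : ∀ m → suc (pds (2 ℕ.+ m)) ≡ freeWords (1 ℕ.+ m)
  suc-pds m rewrite onWords-onBents m =
    solve 2 (λ f o → con 2 :+ (f :+ (o :+ o)) := f :+ ((con 1 :+ o) :+ (con 1 :+ o)))
      refl (freeWords m) (onBents m)
    where open ℕ.+-*-Solver

-- Polynomials as coefficient lists inside the power series

module Polynomials where

  open import Data.Fin.Base as Fin using (Fin)
  open import Data.List.Base using (List; []; _∷_; map)
  open import Data.Nat.Base as ℕ using (ℕ; zero; suc)
  open import Data.Integer.Base as ℤ using (ℤ; +_; 0ℤ; 1ℤ)
  import Data.Integer.Properties as ℤ
  import Algebra.Definitions.RawSemiring as RawSemiringDefinitions
  open import Relation.Binary.PropositionalEquality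

  open PowerSeries
  open RawSemiringDefinitions ℤ.+-*-rawSemiring using () renaming (sum to ∑)

  private
    variable
      f g : Carrier
      p r : List ℤ

  coefficients : List ℤ → Carrier
  coefficients []      _       = 0ℤ
  coefficients (a ∷ p) zero    = a
  coefficients (a ∷ p) (suc n) = coefficients p n

  infixl 6 _+ₚ_
  infixl 7 _*ₚ_

  _+ₚ_ : List ℤ → List ℤ → List ℤ
  []      +ₚ r       = r
  (a ∷ p) +ₚ []      = a ∷ p
  (a ∷ p) +ₚ (b ∷ r) = a ℤ.+ b ∷ (p +ₚ r)

  -ₚ_ : List ℤ → List ℤ
  -ₚ_ = map (λ a → ℤ.- a)

  _*ₚ_ : List ℤ → List ℤ → List ℤ
  []      *ₚ r = []
  (a ∷ p) *ₚ r = map (a ℤ.*_) r +ₚ (0ℤ ∷ p *ₚ r)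

  _^ₚ_ : List ℤ → ℕ → List ℤ
  p ^ₚ zero  = 1ℤ ∷ []
  p ^ₚ suc k = p *ₚ p ^ₚ k

  coefficients-+ : ∀ p r n → coefficients (p +ₚ r) n ≡ coefficients p n ℤ.+ coefficients r n
  coefficients-+ []      r       n       = sym (ℤ.+-identityˡ _)
  coefficients-+ (a ∷ p) []      n       = sym (ℤ.+-identityʳ _)
  coefficients-+ (a ∷ p) (b ∷ r) zero    = refl
  coefficients-+ (a ∷ p) (b ∷ r) (suc n) = coefficients-+ p r n

  coefficients-neg : ∀ p n → coefficients (-ₚ p) n ≡ ℤ.- coefficients p n
  coefficients-neg []      n       = refl
  coefficients-neg (a ∷ p) zero    = refl
  coefficients-neg (a ∷ p) (suc n) = coefficients-neg p n

  coefficients-scale : ∀ a p n → coefficients (map (a ℤ.*_) p) n ≡ a ℤ.* coefficients p n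
  coefficients-scale a []      n       = sym (ℤ.*-zeroʳ a)
  coefficients-scale a (b ∷ p) zero    = refl
  coefficients-scale a (b ∷ p) (suc n) = coefficients-scale a p n

  ∑-zero : ∀ n (t : Fin n → ℤ) → ∑ (λ i → 0ℤ ℤ.* t i) ≡ 0ℤ
  ∑-zero zero    t = refl
  ∑-zero (suc n) t = trans (ℤ.+-identityˡ _) (∑-zero n (λ i → t (Fin.suc i)))

  ∑-cong : ∀ n {t u : Fin n → ℤ} → (∀ i → t i ≡ u i) → ∑ t ≡ ∑ u
  ∑-cong zero    t≡u = refl
  ∑-cong (suc n) t≡u = cong₂ ℤ._+_ (t≡u Fin.zero) (∑-cong n (λ i → t≡u (Fin.suc i)))

  *-cong : ∀ {f f′ g g′ : Carrier} → f ≈ f′ → g ≈ g′ → f * g ≈ f′ * g′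
  *-cong f≈ g≈ n = ∑-cong (suc n) λ i → cong₂ ℤ._*_ (f≈ (Fin.toℕ i)) (g≈ (n ℕ.∸ Fin.toℕ i))

  -- Splitting off the first summand of the convolution leaves the convolution with the tail one
  -- degree lower, which is the recursion of `_*ₚ_`.
  coefficients-* : ∀ p r → coefficients p * coefficients r ≈ coefficients (p *ₚ r)
  coefficients-* []      r n = ∑-zero (suc n) (λ i → coefficients r (n ℕ.∸ Fin.toℕ i))
  coefficients-* (a ∷ p) r zero = begin
    a ℤ.* coefficients r 0 ℤ.+ 0ℤ
      ≡⟨ cong (ℤ._+ 0ℤ) (coefficients-scale a r 0) ⟨
    coefficients (map (a ℤ.*_) r) 0 ℤ.+ 0ℤ
      ≡⟨ coefficients-+ (map (a ℤ.*_) r) (0ℤ ∷ p *ₚ r) 0 ⟨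
    coefficients ((a ∷ p) *ₚ r) 0 ∎
    where open ≡-Reasoning
  coefficients-* (a ∷ p) r (suc n) = begin
    a ℤ.* coefficients r (suc n) ℤ.+ (coefficients p * coefficients r) n
      ≡⟨ cong₂ ℤ._+_ (sym (coefficients-scale a r (suc n))) (coefficients-* p r n) ⟩
    coefficients (map (a ℤ.*_) r) (suc n) ℤ.+ coefficients (p *ₚ r) n
      ≡⟨ coefficients-+ (map (a ℤ.*_) r) (0ℤ ∷ p *ₚ r) (suc n) ⟨
    coefficients ((a ∷ p) *ₚ r) (suc n) ∎
    where open ≡-Reasoning

  infix 4 _≈ₚ_
  -- A record rather than the bare equation: pointwise equality would unfold, and the series and the
  -- list could no longer be inferred from the type.
  record _≈ₚ_ (f : Carrier) (p : List ℤ) : Set where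
    constructor ⟨_⟩
    field represents : f ≈ coefficients p

  open _≈ₚ_ public

  repr-1 : 1# ≈ₚ (1ℤ ∷ [])
  repr-1 = ⟨ (λ { zero → refl ; (suc _) → refl }) ⟩

  repr-q : q ≈ₚ (0ℤ ∷ 1ℤ ∷ [])
  repr-q = ⟨ (λ { 0 → refl ; 1 → refl ; (suc (suc _)) → refl }) ⟩

  repr-+ : f ≈ₚ p → g ≈ₚ r → f + g ≈ₚ p +ₚ r
  repr-+ {p = p} {r = r} ⟨ f≈ ⟩ ⟨ g≈ ⟩ = ⟨ (λ n →
    trans (cong₂ ℤ._+_ (f≈ n) (g≈ n)) (sym (coefficients-+ p r n))) ⟩

  repr-neg : f ≈ₚ p → - f ≈ₚ -ₚ p
  repr-neg {p = p} ⟨ f≈ ⟩ = ⟨ (λ n → trans (cong ℤ.-_ (f≈ n)) (sym (coefficients-neg p n))) ⟩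

  repr-* : f ≈ₚ p → g ≈ₚ r → f * g ≈ₚ p *ₚ r
  repr-* {f} {p} {g} {r} ⟨ f≈ ⟩ ⟨ g≈ ⟩ = ⟨ (λ n →
    trans (*-cong {f} {coefficients p} {g} {coefficients r} f≈ g≈ n) (coefficients-* p r n)) ⟩

  repr-^ : f ≈ₚ p → ∀ k → f ^ k ≈ₚ p ^ₚ k
  repr-^ f≈ zero    = repr-1
  repr-^ f≈ (suc k) = repr-* f≈ (repr-^ f≈ k)

  repr-double : f ≈ₚ p → 2 · f ≈ₚ p +ₚ (p +ₚ [])
  repr-double f≈ = repr-+ f≈ (repr-+ f≈ ⟨ (λ _ → refl) ⟩)

  numerator-coefficients denominator-coefficients : List ℤ
  numerator-coefficients   = + 1 ∷ ℤ.- + 2 ∷ + 1 ∷ + 1 ∷ + 0 ∷ + 1 ∷ []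
  denominator-coefficients = + 1 ∷ ℤ.- + 3 ∷ + 2 ∷ ℤ.- + 1 ∷ + 1 ∷ []

  -- The list operations evaluate, so the list assembled from the pieces agrees with the stated
  -- coefficients by computation.
  numerator-repr : numerator ≈ₚ numerator-coefficients
  numerator-repr =
    repr-+ (repr-+ (repr-+ (repr-+ (repr-^ repr-q 5) (repr-^ repr-q 3)) (repr-^ repr-q 2))
      (repr-neg (repr-double repr-q))) repr-1

  denominator-repr : denominator ≈ₚ denominator-coefficients
  denominator-repr =
    repr-* (repr-+ repr-1 (repr-neg repr-q))
      (repr-+ (repr-+ repr-1 (repr-neg (repr-double repr-q))) (repr-neg (repr-^ repr-q 3)))

-- The rational generating function

module GeneratingFunction where

  open Counting
  open Polynomials
  open import Data.Fin.Base as Fin using (Fin)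
  open import Data.List.Base using ([]; _∷_)
  open import Data.Nat.Base as ℕ using (ℕ; zero; suc)
  import Data.Nat.Properties as ℕ
  open import Data.Integer.Base as ℤ using (ℤ; +_; 0ℤ; 1ℤ)
  import Data.Integer.Properties as ℤ
  import Data.Integer.Solver as ℤ
  open import Function.Base using (_$_)
  open import Data.Product using (_,_)
  open import Relation.Binary.PropositionalEquality

  open PowerSeries

  step : ℤ → ℤ → ℤ → ℤ → ℤ
  step a b c d = + 3 ℤ.* d ℤ.- + 2 ℤ.* c ℤ.+ b ℤ.- a

  cong₄ : ∀ (h : ℤ → ℤ → ℤ → ℤ → ℤ) {a a′ b b′ c c′ d d′} →
    a ≡ a′ → b ≡ b′ → c ≡ c′ → d ≡ d′ → h a b c d ≡ h a′ b′ c′ d′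
  cong₄ h refl refl refl refl = refl

  -- The recurrence with characteristic polynomial (1 - q) (1 - 2q - q³).
  record Recurrent (f : Carrier) : Set where
    constructor recurrent
    field
      recurrence : ∀ n → f (4 ℕ.+ n) ≡ step (f n) (f (1 ℕ.+ n)) (f (2 ℕ.+ n)) (f (3 ℕ.+ n))

  Recurrent-shift : ∀ {f} k → Recurrent f → Recurrent (λ n → f (k ℕ.+ n))
  Recurrent-shift {f} k (recurrent rf) = recurrent λ n → subst₂ _≡_
    (cong f (shift 4 n))
    (cong₄ step refl (cong f (shift 1 n)) (cong f (shift 2 n)) (cong f (shift 3 n)))
    (rf (k ℕ.+ n))
    where
    shift : ∀ i n → i ℕ.+ (k ℕ.+ n) ≡ k ℕ.+ (i ℕ.+ n)
    shift i n = trans (sym (ℕ.+-assoc i k n)) (trans (cong (ℕ._+ n) (ℕ.+-comm i k)) (ℕ.+-assoc k i n))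

  Recurrent-+ : ∀ {f g} → Recurrent f → Recurrent g → Recurrent (λ n → f n ℤ.+ g n)
  Recurrent-+ {f} {g} (recurrent rf) (recurrent rg) = recurrent λ n →
    trans (cong₂ ℤ._+_ (rf n) (rg n)) $
    solve 8 (λ a b c d a′ b′ c′ d′ →
        (con (+ 3) :* d :- con (+ 2) :* c :+ b :- a) :+ (con (+ 3) :* d′ :- con (+ 2) :* c′ :+ b′ :- a′)
        := con (+ 3) :* (d :+ d′) :- con (+ 2) :* (c :+ c′) :+ (b :+ b′) :- (a :+ a′))
      refl (f n) (f (1 ℕ.+ n)) (f (2 ℕ.+ n)) (f (3 ℕ.+ n)) (g n) (g (1 ℕ.+ n)) (g (2 ℕ.+ n)) (g (3 ℕ.+ n))
    where open ℤ.+-*-Solver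

  Recurrent-scale : ∀ k {f} → Recurrent f → Recurrent (λ n → k ℤ.* f n)
  Recurrent-scale k {f} (recurrent rf) = recurrent λ n →
    trans (cong (k ℤ.*_) (rf n)) $
    solve 5 (λ k a b c d →
        k :* (con (+ 3) :* d :- con (+ 2) :* c :+ b :- a)
        := con (+ 3) :* (k :* d) :- con (+ 2) :* (k :* c) :+ k :* b :- k :* a)
      refl k (f n) (f (1 ℕ.+ n)) (f (2 ℕ.+ n)) (f (3 ℕ.+ n))
    where open ℤ.+-*-Solver

  Recurrent-unique : ∀ {f g} → Recurrent f → Recurrent g →
    f 0 ≡ g 0 → f 1 ≡ g 1 → f 2 ≡ g 2 → f 3 ≡ g 3 → f ≈ g
  Recurrent-unique _ _ e₀ _ _ _ 0 = e₀
  Recurrent-unique rf rg e₀ e₁ e₂ e₃ (suc n) =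
    Recurrent-unique (Recurrent-shift 1 rf) (Recurrent-shift 1 rg) e₁ e₂ e₃
      (trans (recurrence rf 0) (trans (cong₄ step e₀ e₁ e₂ e₃) (sym (recurrence rg 0)))) n
    where open Recurrent

  Recurrent-resp : ∀ {f g : Carrier} → f ≈ g → Recurrent f → Recurrent g
  Recurrent-resp f≈g (recurrent rf) = recurrent λ n → trans (sym (f≈g (4 ℕ.+ n)))
    (trans (rf n) (cong₄ step (f≈g n) (f≈g (1 ℕ.+ n)) (f≈g (2 ℕ.+ n)) (f≈g (3 ℕ.+ n))))

  -- 1 - 2q - q³ divides the characteristic polynomial, and 1 - q kills constants.
  third-order⇒Recurrent : ∀ (f : Carrier) → (∀ n → f (3 ℕ.+ n) ≡ + 2 ℤ.* f (2 ℕ.+ n) ℤ.+ f n) →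
    Recurrent (λ n → f n ℤ.- 1ℤ)
  third-order⇒Recurrent f rec = recurrent λ n → trans (cong (ℤ._- 1ℤ) (rec (1 ℕ.+ n)))
    (subst (λ d → + 2 ℤ.* d ℤ.+ f (1 ℕ.+ n) ℤ.- 1ℤ ≡
        step (f n ℤ.- 1ℤ) (f (1 ℕ.+ n) ℤ.- 1ℤ) (f (2 ℕ.+ n) ℤ.- 1ℤ) (d ℤ.- 1ℤ))
      (sym (rec n)) (identity (f n) (f (1 ℕ.+ n)) (f (2 ℕ.+ n))))
    where
    open ℤ.+-*-Solver
    identity : ∀ a b c → + 2 ℤ.* (+ 2 ℤ.* c ℤ.+ a) ℤ.+ b ℤ.- 1ℤ ≡
      step (a ℤ.- 1ℤ) (b ℤ.- 1ℤ) (c ℤ.- 1ℤ) (+ 2 ℤ.* c ℤ.+ a ℤ.- 1ℤ)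
    identity = solve 3 (λ a b c → con (+ 2) :* (con (+ 2) :* c :+ a) :+ b :- con 1ℤ
        := con (+ 3) :* (con (+ 2) :* c :+ a :- con 1ℤ) :- con (+ 2) :* (c :- con 1ℤ) :+ (b :- con 1ℤ) :- (a :- con 1ℤ))
      refl

  +freeWords-recurrence : ∀ n → + freeWords (3 ℕ.+ n) ≡ + 2 ℤ.* + freeWords (2 ℕ.+ n) ℤ.+ + freeWords n
  +freeWords-recurrence n = trans (cong +_ (freeWords-recurrence n))
    (trans (ℤ.pos-+ (2 ℕ.* freeWords (2 ℕ.+ n)) (freeWords n))
      (cong (ℤ._+ + freeWords n) (ℤ.pos-* 2 (freeWords (2 ℕ.+ n)))))

  pds-Recurrent : Recurrent (λ n → + pds (2 ℕ.+ n))
  pds-Recurrent = Recurrent-resp {λ n → + freeWords (1 ℕ.+ n) ℤ.- 1ℤ}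
    (λ n → sym (cong (λ k → + k ℤ.- 1ℤ) (suc-pds n)))
    (third-order⇒Recurrent (λ n → + freeWords (1 ℕ.+ n)) (λ n → +freeWords-recurrence (1 ℕ.+ n)))

  -- A convolution with a fixed list unfolds by evaluation down to its last coefficient; what
  -- remains is a sum of zeros of unknown length, which this lemma removes.
  constant-* : ∀ a h n → (coefficients (a ∷ []) * h) n ≡ a ℤ.* h n
  constant-* a h zero    = ℤ.+-identityʳ _
  constant-* a h (suc n) = trans (cong (λ t → a ℤ.* h (suc n) ℤ.+ t) (∑-zero (suc n) (λ i → h (n ℕ.∸ Fin.toℕ i))))
    (ℤ.+-identityʳ _)

  -- The expansion of 1 / ((1 - q)(1 - 2q - q³)). The values 1, 3, 7, 16 result from the recurrence
  -- with zeros in negative degrees.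
  reciprocal : Carrier
  reciprocal 0 = + 1
  reciprocal 1 = + 3
  reciprocal 2 = + 7
  reciprocal 3 = + 16
  reciprocal (suc i@(suc j@(suc k@(suc n)))) =
    step (reciprocal n) (reciprocal k) (reciprocal j) (reciprocal i)

  denominator-reciprocal : denominator * reciprocal ≈ 1#
  denominator-reciprocal n = trans (*-cong {denominator} {_} {reciprocal} (represents denominator-repr) (λ _ → refl) n) (lemma n)
    where
    lemma : coefficients denominator-coefficients * reciprocal ≈ 1#
    lemma 0 = refl
    lemma 1 = refl
    lemma 2 = refl
    lemma 3 = refl
    lemma (suc (suc (suc (suc n)))) = trans
      (cong (λ t → + 1 ℤ.* reciprocal (4 ℕ.+ n) ℤ.+ (ℤ.- + 3 ℤ.* d ℤ.+ (+ 2 ℤ.* c ℤ.+ (ℤ.- + 1 ℤ.* b ℤ.+ t))))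
        (constant-* (+ 1) reciprocal n))
      (cancel a b c d)
      where
      a = reciprocal n
      b = reciprocal (1 ℕ.+ n)
      c = reciprocal (2 ℕ.+ n)
      d = reciprocal (3 ℕ.+ n)
      open ℤ.+-*-Solver
      cancel : ∀ a b c d → + 1 ℤ.* step a b c d ℤ.+
        (ℤ.- + 3 ℤ.* d ℤ.+ (+ 2 ℤ.* c ℤ.+ (ℤ.- + 1 ℤ.* b ℤ.+ + 1 ℤ.* a))) ≡ 0ℤ
      cancel = solve 4 (λ a b c d →
          con (+ 1) :* (con (+ 3) :* d :- con (+ 2) :* c :+ b :- a) :+
            (con (ℤ.- + 3) :* d :+ (con (+ 2) :* c :+ (con (ℤ.- + 1) :* b :+ con (+ 1) :* a)))
          := con 0ℤ)
        refl

  -- The numerator has degree five, so from degree five on both sides obey the fourth-order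
  -- recurrence and four values settle them. The degrees below five are compared by evaluation.
  numerator-reciprocal : generatingFunction pds ≈ numerator * reciprocal
  numerator-reciprocal n = trans (lemma n)
    (sym (*-cong {numerator} {_} {reciprocal} (represents numerator-repr) (λ _ → refl) n))
    where
    scaled : ∀ k i → Recurrent (λ n → k ℤ.* reciprocal (i ℕ.+ n))
    scaled k i = Recurrent-scale k (Recurrent-shift {reciprocal} i (recurrent λ _ → refl))
    tail : Carrier
    tail n = + 1 ℤ.* reciprocal (5 ℕ.+ n) ℤ.+ (ℤ.- + 2 ℤ.* reciprocal (4 ℕ.+ n) ℤ.+
      (+ 1 ℤ.* reciprocal (3 ℕ.+ n) ℤ.+ (+ 1 ℤ.* reciprocal (2 ℕ.+ n) ℤ.+
      (+ 0 ℤ.* reciprocal (1 ℕ.+ n) ℤ.+ + 1 ℤ.* reciprocal n))))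
    tail-Recurrent : Recurrent tail
    tail-Recurrent =
      Recurrent-+ (scaled (+ 1) 5) $ Recurrent-+ (scaled (ℤ.- + 2) 4) $ Recurrent-+ (scaled (+ 1) 3) $
      Recurrent-+ (scaled (+ 1) 2) $ Recurrent-+ (scaled (+ 0) 1) (scaled (+ 1) 0)
    lemma : generatingFunction pds ≈ coefficients numerator-coefficients * reciprocal
    lemma 0 = refl
    lemma 1 = refl
    lemma 2 = refl
    lemma 3 = refl
    lemma 4 = refl
    lemma (suc (suc (suc (suc (suc n))))) =
      trans (Recurrent-unique (Recurrent-shift 3 pds-Recurrent) tail-Recurrent
        refl refl refl refl n) (sym (tail-* reciprocal))
      where
      -- Stated for an arbitrary series, so that only the convolution unfolds and not `reciprocal`.
      tail-* : ∀ h → (coefficients numerator-coefficients * h) (5 ℕ.+ n) ≡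
        + 1 ℤ.* h (5 ℕ.+ n) ℤ.+ (ℤ.- + 2 ℤ.* h (4 ℕ.+ n) ℤ.+ (+ 1 ℤ.* h (3 ℕ.+ n) ℤ.+
        (+ 1 ℤ.* h (2 ℕ.+ n) ℤ.+ (+ 0 ℤ.* h (1 ℕ.+ n) ℤ.+ + 1 ℤ.* h n))))
      tail-* h = cong (λ t → + 1 ℤ.* h (5 ℕ.+ n) ℤ.+ (ℤ.- + 2 ℤ.* h (4 ℕ.+ n) ℤ.+ (+ 1 ℤ.* h (3 ℕ.+ n) ℤ.+
        (+ 1 ℤ.* h (2 ℕ.+ n) ℤ.+ (+ 0 ℤ.* h (1 ℕ.+ n) ℤ.+ t))))) (constant-* (+ 1) h n)

  generatingFunction-pds : generatingFunction pds ≈ numerator ÷ denominator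
  generatingFunction-pds = reciprocal , denominator-reciprocal , numerator-reciprocal

-- The commutative ring of Cauchy reals and a solver for ℚ-algebras

module RealNumbers where

  open import Algebra.Bundles using (CommutativeRing)
  import Algebra.Solver.Ring as RingSolver
  import Algebra.Solver.Ring.AlmostCommutativeRing as ACR
  import Data.Maybe.Base as Maybe
  open import Data.Nat.Base as ℕ using (ℕ)
  open import Data.Product using (∃-syntax; _,_)
  open import Data.Rational.Base as ℚ using (ℚ; 0ℚ; 1ℚ; ½)
  import Data.Rational.Properties as ℚ
  open import Level using (0ℓ)
  open import Relation.Binary.PropositionalEquality as ≡ using (_≡_)
  open import Relation.Nullary.Decidable using (dec⇒maybe)

  open ℝ
  open CauchyProperties

  pointwise : ∀ x y → (∀ n → seq x n ≡ seq y n) → x ≈ℝ y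
  pointwise x y eq ε ε>0 = 0 , λ n _ →
    ≡.subst (ℚ._< ε) (≡.sym (≡.trans (≡.cong (λ t → ℚ.∣ t ℚ.- seq y n ∣) (eq n)) (≡.cong ℚ.∣_∣ (ℚ.+-inverseʳ (seq y n))))) ε>0

  ≈ℝ-refl : ∀ {x} → x ≈ℝ x
  ≈ℝ-refl {x} = pointwise x x (λ _ → ≡.refl)

  ∣p-q∣≡∣q-p∣ : ∀ p q → ℚ.∣ p ℚ.- q ∣ ≡ ℚ.∣ q ℚ.- p ∣
  ∣p-q∣≡∣q-p∣ p q = ≡.trans (≡.sym (ℚ.∣-p∣≡∣p∣ (p ℚ.- q))) (≡.cong ℚ.∣_∣
    (≡.trans (neg-diff p q) (≡.trans (ℚ.+-comm (ℚ.- p) _) (≡.cong (ℚ._- p) (neg-involutive q)))))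
    where
    open import Algebra.Properties.AbelianGroup ℚ.+-0-abelianGroup using () renaming (⁻¹-involutive to neg-involutive)

  ≈ℝ-sym : ∀ {x y} → x ≈ℝ y → y ≈ℝ x
  ≈ℝ-sym {x} {y} x≈y ε ε>0 with N , h ← x≈y ε ε>0 = N , λ n n≥ →
    ≡.subst (ℚ._< ε) (∣p-q∣≡∣q-p∣ (seq x n) (seq y n)) (h n n≥)

  ≈ℝ-trans : ∀ {x y z} → x ≈ℝ y → y ≈ℝ z → x ≈ℝ z
  ≈ℝ-trans {x} {y} {z} x≈y y≈z ε ε>0
    with M , h ← x≈y (½ ℚ.* ε) (half-pos ε>0) | N , k ← y≈z (½ ℚ.* ε) (half-pos ε>0) =
    M ℕ.⊔ N , λ n n≥ → split (telescope (seq x n) (seq y n) (seq z n))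
      (h n (⊔ˡ {M} {N} n≥)) (k n (⊔ʳ {M} {N} n≥))

  +ℝ-cong : ∀ {x x′ y y′} → x ≈ℝ x′ → y ≈ℝ y′ → x +ℝ y ≈ℝ x′ +ℝ y′
  +ℝ-cong {x} {x′} {y} {y′} x≈ y≈ ε ε>0
    with M , h ← x≈ (½ ℚ.* ε) (half-pos ε>0) | N , k ← y≈ (½ ℚ.* ε) (half-pos ε>0) =
    M ℕ.⊔ N , λ n n≥ → split (sum-diff (seq x n) (seq y n) (seq x′ n) (seq y′ n))
      (h n (⊔ˡ {M} {N} n≥)) (k n (⊔ʳ {M} {N} n≥))

  -ℝ-cong : ∀ {x x′} → x ≈ℝ x′ → (-ℝ x) ≈ℝ (-ℝ x′)
  -ℝ-cong {x} {x′} x≈ ε ε>0 with N , h ← x≈ ε ε>0 = N , λ n n≥ →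
    ≡.subst (ℚ._< ε)
      (≡.trans (≡.sym (ℚ.∣-p∣≡∣p∣ (seq x n ℚ.- seq x′ n))) (≡.cong ℚ.∣_∣ (neg-diff (seq x n) (seq x′ n))))
      (h n n≥)

  *ℝ-cong : ∀ {x x′ y y′} → x ≈ℝ x′ → y ≈ℝ y′ → x *ℝ y ≈ℝ x′ *ℝ y′
  *ℝ-cong {x} {x′} {y} {y′} x≈ y≈ ε ε>0 with bounded (seq x) (cauchy x) | bounded (seq y′) (cauchy y′)
  ... | A , A>0 , K , x≤A | B , B>0 , L , y′≤B = estimate
    where
    module SA = Scale A A>0 ε ε>0
    module SB = Scale B B>0 ε ε>0
    estimate : ∃[ N ] (∀ n → N ℕ.≤ n → ℚ.∣ seq x n ℚ.* seq y n ℚ.- seq x′ n ℚ.* seq y′ n ∣ ℚ.< ε)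
    estimate with M , h ← x≈ SB.δ SB.δ>0 | N , k ← y≈ SA.δ SA.δ>0 =
      (K ℕ.⊔ L) ℕ.⊔ (M ℕ.⊔ N) , λ n n≥ →
        let KL≤n = ⊔ˡ {K ℕ.⊔ L} {M ℕ.⊔ N} n≥
            MN≤n = ⊔ʳ {K ℕ.⊔ L} {M ℕ.⊔ N} n≥
        in split (product-diff (seq x n) (seq y n) (seq x′ n) (seq y′ n))
          (SA.scale (x≤A n (⊔ˡ {K} {L} KL≤n)) (k n (⊔ʳ {M} {N} MN≤n)))
          (SB.scale (y′≤B n (⊔ʳ {K} {L} KL≤n)) (h n (⊔ˡ {M} {N} MN≤n)))

  ℝ-commutativeRing : CommutativeRing 0ℓ 0ℓ
  ℝ-commutativeRing = record
    { Carrier = ℝ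
    ; _≈_ = _≈ℝ_
    ; _+_ = _+ℝ_
    ; _*_ = _*ℝ_
    ; -_  = -ℝ_
    ; 0#  = fromℚ 0ℚ
    ; 1#  = fromℚ 1ℚ
    ; isCommutativeRing = record
      { isRing = record
        { +-isAbelianGroup = record
          { isGroup = record
            { isMonoid = record
              { isSemigroup = record
                { isMagma = record
                  { isEquivalence = record
                    { refl  = λ {x} → ≈ℝ-refl {x}
                    ; sym   = λ {x} {y} → ≈ℝ-sym {x} {y}
                    ; trans = λ {x} {y} {z} → ≈ℝ-trans {x} {y} {z}
                    }
                  ; ∙-cong = λ {x} {x′} {y} {y′} → +ℝ-cong {x} {x′} {y} {y′}
                  }
                ; assoc = λ x y z → pointwise ((x +ℝ y) +ℝ z) (x +ℝ (y +ℝ z))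
                    (λ n → ℚ.+-assoc (seq x n) (seq y n) (seq z n))
                }
              ; identity = (λ x → pointwise (fromℚ 0ℚ +ℝ x) x (λ n → ℚ.+-identityˡ (seq x n)))
                         , (λ x → pointwise (x +ℝ fromℚ 0ℚ) x (λ n → ℚ.+-identityʳ (seq x n)))
              }
            ; inverse = (λ x → pointwise ((-ℝ x) +ℝ x) (fromℚ 0ℚ) (λ n → ℚ.+-inverseˡ (seq x n)))
                      , (λ x → pointwise (x +ℝ (-ℝ x)) (fromℚ 0ℚ) (λ n → ℚ.+-inverseʳ (seq x n)))
            ; ⁻¹-cong = λ {x} {x′} → -ℝ-cong {x} {x′}
            }
          ; comm = λ x y → pointwise (x +ℝ y) (y +ℝ x) (λ n → ℚ.+-comm (seq x n) (seq y n))
          }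
        ; *-cong = λ {x} {x′} {y} {y′} → *ℝ-cong {x} {x′} {y} {y′}
        ; *-assoc = λ x y z → pointwise ((x *ℝ y) *ℝ z) (x *ℝ (y *ℝ z))
            (λ n → ℚ.*-assoc (seq x n) (seq y n) (seq z n))
        ; *-identity = (λ x → pointwise (fromℚ 1ℚ *ℝ x) x (λ n → ℚ.*-identityˡ (seq x n)))
                     , (λ x → pointwise (x *ℝ fromℚ 1ℚ) x (λ n → ℚ.*-identityʳ (seq x n)))
        ; distrib = (λ x y z → pointwise (x *ℝ (y +ℝ z)) ((x *ℝ y) +ℝ (x *ℝ z))
                       (λ n → ℚ.*-distribˡ-+ (seq x n) (seq y n) (seq z n)))
                  , (λ x y z → pointwise ((y +ℝ z) *ℝ x) ((y *ℝ x) +ℝ (z *ℝ x))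
                       (λ n → ℚ.*-distribʳ-+ (seq x n) (seq y n) (seq z n)))
        }
      ; *-comm = λ x y → pointwise (x *ℝ y) (y *ℝ x) (λ n → ℚ.*-comm (seq x n) (seq y n))
      }
    }

  -- Identities used in both ℝ and ℂ are proved once over this structure. With an abstract carrier
  -- the solver meets neither Cauchy sequences nor pairs of them.
  record ℚAlgebra : Set₁ where
    field
      commutativeRing : CommutativeRing 0ℓ 0ℓ
    open CommutativeRing commutativeRing
    field
      ι      : ℚ → Carrier
      +-homo : ∀ p q → ι (p ℚ.+ q) ≈ ι p + ι q
      *-homo : ∀ p q → ι (p ℚ.* q) ≈ ι p * ι q
      -‿homo : ∀ p → ι (ℚ.- p) ≈ - ι p
      0-homo : ι 0ℚ ≈ 0#
      1-homo : ι 1ℚ ≈ 1#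

  module ℚAlgebraSolver (A : ℚAlgebra) where

    open ℚAlgebra A
    private
      R = ACR.fromCommutativeRing commutativeRing

      morphism : ℚ.+-*-rawRing ACR.-Raw-AlmostCommutative⟶ R
      morphism = record
        { ⟦_⟧ = ι ; +-homo = +-homo ; *-homo = *-homo ; -‿homo = -‿homo ; 0-homo = 0-homo ; 1-homo = 1-homo }

    open RingSolver ℚ.+-*-rawRing R morphism
      (λ p q → Maybe.map (λ eq → CommutativeRing.reflexive commutativeRing (≡.cong ι eq)) (dec⇒maybe (p ℚ.≟ q)))
      public using (solve; con; _:=_; _:+_; _:*_; :-_; _:-_; _:^_)

  ℝ-algebra : ℚAlgebra
  ℝ-algebra = record
    { commutativeRing = ℝ-commutativeRing
    ; ι = fromℚ
    ; +-homo = λ p q → ≈ℝ-refl {fromℚ (p ℚ.+ q)}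
    ; *-homo = λ p q → ≈ℝ-refl {fromℚ (p ℚ.* q)}
    ; -‿homo = λ p → ≈ℝ-refl {fromℚ (ℚ.- p)}
    ; 0-homo = ≈ℝ-refl {fromℚ 0ℚ}
    ; 1-homo = ≈ℝ-refl {fromℚ 1ℚ}
    }

  module ComplexIdentities (A : ℚAlgebra) where

    open ℚAlgebra A using (commutativeRing)
    open CommutativeRing commutativeRing
    open ℚAlgebraSolver A

    *-assoc-re : ∀ a b c d e f →
      (a * c + - (b * d)) * e + - ((a * d + b * c) * f) ≈ a * (c * e + - (d * f)) + - (b * (c * f + d * e))
    *-assoc-re = solve 6 (λ a b c d e f →
      (a :* c :+ :- (b :* d)) :* e :+ :- ((a :* d :+ b :* c) :* f) :=
      a :* (c :* e :+ :- (d :* f)) :+ :- (b :* (c :* f :+ d :* e))) refl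

    *-assoc-im : ∀ a b c d e f →
      (a * c + - (b * d)) * f + (a * d + b * c) * e ≈ a * (c * f + d * e) + b * (c * e + - (d * f))
    *-assoc-im = solve 6 (λ a b c d e f →
      (a :* c :+ :- (b :* d)) :* f :+ (a :* d :+ b :* c) :* e :=
      a :* (c :* f :+ d :* e) :+ b :* (c :* e :+ :- (d :* f))) refl

    *-comm-re : ∀ a b c d → a * c + - (b * d) ≈ c * a + - (d * b)
    *-comm-re = solve 4 (λ a b c d → a :* c :+ :- (b :* d) := c :* a :+ :- (d :* b)) refl

    *-comm-im : ∀ a b c d → a * d + b * c ≈ c * b + d * a
    *-comm-im = solve 4 (λ a b c d → a :* d :+ b :* c := c :* b :+ d :* a) refl

    *-identityˡ-re : ∀ a b → 1# * a + - (0# * b) ≈ a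
    *-identityˡ-re a b = trans (+-cong (*-identityˡ a) (trans (-‿cong (zeroˡ b)) -0#≈0#)) (+-identityʳ a)
      where open import Algebra.Properties.Ring ring using (-0#≈0#)

    *-identityˡ-im : ∀ a b → 1# * b + 0# * a ≈ b
    *-identityˡ-im a b = trans (+-cong (*-identityˡ b) (zeroˡ a)) (+-identityʳ b)

    distribˡ-re : ∀ a b c d e f →
      a * (c + e) + - (b * (d + f)) ≈ (a * c + - (b * d)) + (a * e + - (b * f))
    distribˡ-re = solve 6 (λ a b c d e f →
      a :* (c :+ e) :+ :- (b :* (d :+ f)) := (a :* c :+ :- (b :* d)) :+ (a :* e :+ :- (b :* f))) refl

    distribˡ-im : ∀ a b c d e f →
      a * (d + f) + b * (c + e) ≈ (a * d + b * c) + (a * f + b * e)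
    distribˡ-im = solve 6 (λ a b c d e f →
      a :* (d :+ f) :+ b :* (c :+ e) := (a :* d :+ b :* c) :+ (a :* f :+ b :* e)) refl

-- The commutative ring of complex numbers

module ComplexNumbers where

  open RealNumbers
  open import Algebra.Bundles using (CommutativeRing; RawRing)
  import Algebra.Consequences.Setoid as Consequences
  open import Data.Product using (_,_)
  open import Data.Rational.Base as ℚ using (ℚ; 0ℚ; 1ℚ)
  open import Level using (0ℓ)
  open import Relation.Binary.Bundles using (Setoid)

  open ℂ

  private
    module R = CommutativeRing ℝ-commutativeRing
    module C = RawRing ℂ-rawRing
    module I = ComplexIdentities ℝ-algebra

  ℂ-setoid : Setoid 0ℓ 0ℓ
  ℂ-setoid = record
    { Carrier = ℂ
    ; _≈_ = C._≈_
    ; isEquivalence = record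
      { refl = λ {z} → ≈ℝ-refl {re z} , ≈ℝ-refl {im z}
      ; sym  = λ {z} {w} (p , q) → ≈ℝ-sym {re z} {re w} p , ≈ℝ-sym {im z} {im w} q
      ; trans = λ {x} {y} {z} (p , q) (p′ , q′) →
          ≈ℝ-trans {re x} {re y} {re z} p p′ , ≈ℝ-trans {im x} {im y} {im z} q q′
      }
    }

  *ℂ-cong : ∀ {z z′ w w′} → z C.≈ z′ → w C.≈ w′ → (z C.* w) C.≈ (z′ C.* w′)
  *ℂ-cong {a +i b} {a′ +i b′} {c +i d} {c′ +i d′} (a≈ , b≈) (c≈ , d≈) =
    +ℝ-cong {a *ℝ c} {a′ *ℝ c′} { -ℝ (b *ℝ d)} { -ℝ (b′ *ℝ d′)}
      (*ℝ-cong {a} {a′} {c} {c′} a≈ c≈)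
      (-ℝ-cong {b *ℝ d} {b′ *ℝ d′} (*ℝ-cong {b} {b′} {d} {d′} b≈ d≈))
    , +ℝ-cong {a *ℝ d} {a′ *ℝ d′} {b *ℝ c} {b′ *ℝ c′}
      (*ℝ-cong {a} {a′} {d} {d′} a≈ d≈) (*ℝ-cong {b} {b′} {c} {c′} b≈ c≈)

  *ℂ-comm : ∀ z w → (z C.* w) C.≈ (w C.* z)
  *ℂ-comm (a +i b) (c +i d) = I.*-comm-re a b c d , I.*-comm-im a b c d

  ℂ-commutativeRing : CommutativeRing 0ℓ 0ℓ
  ℂ-commutativeRing = record
    { Carrier = ℂ
    ; _≈_ = C._≈_
    ; _+_ = C._+_
    ; _*_ = C._*_
    ; -_  = C.-_
    ; 0#  = C.0#
    ; 1#  = C.1#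
    ; isCommutativeRing = record
      { isRing = record
        { +-isAbelianGroup = record
          { isGroup = record
            { isMonoid = record
              { isSemigroup = record
                { isMagma = record
                  { isEquivalence = Setoid.isEquivalence ℂ-setoid
                  ; ∙-cong = λ {z} {z′} {w} {w′} (p , q) (p′ , q′) →
                      +ℝ-cong {re z} {re z′} {re w} {re w′} p p′ , +ℝ-cong {im z} {im z′} {im w} {im w′} q q′
                  }
                ; assoc = λ x y z → R.+-assoc (re x) (re y) (re z) , R.+-assoc (im x) (im y) (im z)
                }
              ; identity = (λ z → R.+-identityˡ (re z) , R.+-identityˡ (im z))
                         , (λ z → R.+-identityʳ (re z) , R.+-identityʳ (im z))
              }
            ; inverse = (λ z → R.-‿inverseˡ (re z) , R.-‿inverseˡ (im z))
                      , (λ z → R.-‿inverseʳ (re z) , R.-‿inverseʳ (im z))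
            ; ⁻¹-cong = λ {z} {z′} (p , q) → -ℝ-cong {re z} {re z′} p , -ℝ-cong {im z} {im z′} q
            }
          ; comm = λ z w → R.+-comm (re z) (re w) , R.+-comm (im z) (im w)
          }
        ; *-cong = λ {z} {z′} {w} {w′} → *ℂ-cong {z} {z′} {w} {w′}
        ; *-assoc = λ where
            (a +i b) (c +i d) (e +i f) → I.*-assoc-re a b c d e f , I.*-assoc-im a b c d e f
        ; *-identity = Consequences.comm∧idˡ⇒id ℂ-setoid {_∙_ = C._*_} *ℂ-comm {e = C.1#}
            (λ { (a +i b) → I.*-identityˡ-re a b , I.*-identityˡ-im a b })
        ; distrib = Consequences.comm∧distrˡ⇒distr ℂ-setoid {_∙_ = C._*_} {_◦_ = C._+_}
            (λ {z} {z′} {w} {w′} (p , q) (p′ , q′) →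
               +ℝ-cong {re z} {re z′} {re w} {re w′} p p′ , +ℝ-cong {im z} {im z′} {im w} {im w′} q q′)
            *ℂ-comm
            (λ where (a +i b) (c +i d) (e +i f) → I.distribˡ-re a b c d e f , I.distribˡ-im a b c d e f)
        }
      ; *-comm = *ℂ-comm
      }
    }

  module RealIdentities (A : ℚAlgebra) where

    open ℚAlgebra A
    open CommutativeRing commutativeRing
    open ℚAlgebraSolver A
    open import Algebra.Properties.Ring ring using (-0#≈0#)

    product-re : ∀ p q → ι (p ℚ.* q) ≈ ι p * ι q + - (ι 0ℚ * ι 0ℚ)
    product-re p q = trans (*-homo p q) (solve 2 (λ a b → a :* b := a :* b :+ :- (con 0ℚ :* con 0ℚ)) refl (ι p) (ι q))

    product-im : ∀ p q → ι 0ℚ ≈ ι p * ι 0ℚ + ι 0ℚ * ι q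
    product-im p q = solve 2 (λ a b → con 0ℚ := a :* con 0ℚ :+ con 0ℚ :* b) refl (ι p) (ι q)

  ℂ-algebra : ℚAlgebra
  ℂ-algebra = record
    { commutativeRing = ℂ-commutativeRing
    ; ι = Complex.ratio
    ; +-homo = λ p q → ≈ℝ-refl {fromℚ (p ℚ.+ q)} , ≈ℝ-refl {fromℚ 0ℚ}
    ; *-homo = λ p q → product-re p q , product-im p q
    ; -‿homo = λ p → ≈ℝ-refl {fromℚ (ℚ.- p)} , ≈ℝ-refl {fromℚ 0ℚ}
    ; 0-homo = ≈ℝ-refl {fromℚ 0ℚ} , ≈ℝ-refl {fromℚ 0ℚ}
    ; 1-homo = ≈ℝ-refl {fromℚ 1ℚ} , ≈ℝ-refl {fromℚ 0ℚ}
    }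
    where open RealIdentities ℝ-algebra

-- Fixed points of monotone contractions on rational intervals

module Contractions where

  open RealNumbers
  open import Data.Integer.Base as ℤ using (+_; -[1+_])
  import Data.Integer.Properties as ℤ
  open import Data.Nat.Base as ℕ using (ℕ; zero; suc; z≤n; s≤s)
  import Data.Nat.Properties as ℕ
  open import Data.Product using (∃-syntax; _×_; _,_; proj₁; proj₂)
  open import Data.Rational.Base as ℚ using (ℚ; 0ℚ; 1ℚ; ½; *≤*; mkℚ)
  import Data.Rational.Properties as ℚ
  open import Data.Rational.Solver using (module +-*-Solver)
  open import Data.Rational.Unnormalised.Base as ℚᵘ using (mkℚᵘ; *≡*)
  import Data.Rational.Unnormalised.Properties as ℚᵘ
  open import Data.Sum.Base using (inj₁; inj₂)
  open import Relation.Binary.PropositionalEquality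

  open ℝ
  open CauchyProperties

  p≤q⇒0≤q-p : ∀ {p q} → p ℚ.≤ q → 0ℚ ℚ.≤ q ℚ.- p
  p≤q⇒0≤q-p {p} {q} p≤q = subst (ℚ._≤ q ℚ.- p) (ℚ.+-inverseʳ p) (ℚ.+-monoˡ-≤ (ℚ.- p) p≤q)

  0≤q-p⇒p≤q : ∀ {p q} → 0ℚ ℚ.≤ q ℚ.- p → p ℚ.≤ q
  0≤q-p⇒p≤q {p} {q} 0≤q-p = subst₂ ℚ._≤_ (ℚ.+-identityˡ p) (diff-+ q p) (ℚ.+-monoˡ-≤ p 0≤q-p)

  0≤p*q : ∀ {p q} → 0ℚ ℚ.≤ p → 0ℚ ℚ.≤ q → 0ℚ ℚ.≤ p ℚ.* q
  0≤p*q {p} {q} 0≤p 0≤q = ℚ.nonNegative⁻¹ (p ℚ.* q)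
    {{ℚ.nonNeg*nonNeg⇒nonNeg p {{ℚ.nonNegative 0≤p}} q {{ℚ.nonNegative 0≤q}}}}

  0≤p+q : ∀ {p q} → 0ℚ ℚ.≤ p → 0ℚ ℚ.≤ q → 0ℚ ℚ.≤ p ℚ.+ q
  0≤p+q = ℚ.+-mono-≤

  ∣p∣≤ : ∀ {p q} → p ℚ.≤ q → ℚ.- p ℚ.≤ q → ℚ.∣ p ∣ ℚ.≤ q
  ∣p∣≤ {p} {q} p≤q -p≤q with ℚ.∣p∣≡p∨∣p∣≡-p p
  ... | inj₁ eq = subst (ℚ._≤ q) (sym eq) p≤q
  ... | inj₂ eq = subst (ℚ._≤ q) (sym eq) -p≤q

  p≤∣p∣ : ∀ p → p ℚ.≤ ℚ.∣ p ∣
  p≤∣p∣ p with ℚ.≤-total 0ℚ p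
  ... | inj₁ 0≤p = ℚ.≤-reflexive (sym (ℚ.0≤p⇒∣p∣≡p 0≤p))
  ... | inj₂ p≤0 = ℚ.≤-trans p≤0 (ℚ.0≤∣p∣ p)

  ½^ : ℕ → ℚ
  ½^ zero    = 1ℚ
  ½^ (suc k) = ½ ℚ.* ½^ k

  0<½^ : ∀ k → 0ℚ ℚ.< ½^ k
  0<½^ zero    = ℚ.positive⁻¹ 1ℚ
  0<½^ (suc k) = half-pos (0<½^ k)

  -- Repeated addition, in step with the multiples `k · x` of the ring notation.
  fromℕ : ℕ → ℚ
  fromℕ zero    = 0ℚ
  fromℕ (suc k) = 1ℚ ℚ.+ fromℕ k

  private
    toℚᵘ-fromℕ : ∀ k → ℚ.toℚᵘ (fromℕ k) ℚᵘ.≃ mkℚᵘ (+ k) 0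
    toℚᵘ-fromℕ zero    = ℚᵘ.≃-refl
    toℚᵘ-fromℕ (suc k) = ℚᵘ.≃-trans (ℚ.toℚᵘ-homo-+ 1ℚ (fromℕ k))
      (ℚᵘ.≃-trans (ℚᵘ.+-congʳ ℚᵘ.1ℚᵘ (toℚᵘ-fromℕ k))
        (*≡* (cong (ℤ._* + 1) (cong (λ t → + 1 ℤ.+ t) (ℤ.*-identityʳ (+ k))))))

    ≤fromℕ : ∀ p → ∃[ k ] p ℚ.≤ fromℕ k
    ≤fromℕ p@(mkℚ n d _) = ℤ.∣ n ∣ , ℚ.toℚᵘ-cancel-≤ (ℚᵘ.≤-respʳ-≃ (ℚᵘ.≃-sym (toℚᵘ-fromℕ ℤ.∣ n ∣))
      (ℚᵘ.*≤* (bound n)))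
      where
      bound : ∀ n → n ℤ.* + 1 ℤ.≤ + ℤ.∣ n ∣ ℤ.* + suc d
      bound (+ n)      = subst₂ ℤ._≤_ (ℤ.pos-* n 1) (ℤ.pos-* n (suc d)) (ℤ.+≤+ (ℕ.*-monoʳ-≤ n (s≤s z≤n)))
      bound (-[1+ n ]) = ℤ.-≤+

    1≤fromℕ-suc : ∀ k → 1ℚ ℚ.≤ fromℕ (suc k)
    1≤fromℕ-suc k = subst (ℚ._≤ fromℕ (suc k)) (ℚ.+-identityʳ 1ℚ) (ℚ.+-monoʳ-≤ 1ℚ (0≤fromℕ k))
      where
      0≤fromℕ : ∀ k → 0ℚ ℚ.≤ fromℕ k
      0≤fromℕ zero    = ℚ.≤-refl
      0≤fromℕ (suc k) = 0≤p+q (ℚ.nonNegative⁻¹ 1ℚ) (0≤fromℕ k)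

    fromℕ*½^ : ∀ k → fromℕ (suc k) ℚ.* ½^ k ℚ.≤ 1ℚ
    fromℕ*½^ zero    = ℚ.≤-refl
    fromℕ*½^ (suc k) = ℚ.≤-trans
      (ℚ.*-monoʳ-≤-nonNeg (½ ℚ.* ½^ k) {{ℚ.nonNegative (ℚ.<⇒≤ (0<½^ (suc k)))}}
        (ℚ.+-monoˡ-≤ (fromℕ (suc k)) (1≤fromℕ-suc k)))
      (subst (ℚ._≤ 1ℚ)
        (solve 2 (λ a h → a :* h := (a :+ a) :* (con ½ :* h)) refl (fromℕ (suc k)) (½^ k))
        (fromℕ*½^ k))
      where open +-*-Solver

  -- Choose a natural `k ≥ 1/ε`; then (k+1) ½ᵏ ≤ 1 < (k+1) ε, and k+1 cancels.
  ½^-small : ∀ ε → 0ℚ ℚ.< ε → ∃[ k ] ½^ k ℚ.< ε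
  ½^-small ε ε>0 =
    k , ℚ.*-cancelˡ-<-nonNeg (fromℕ (suc k)) {{ℚ.nonNegative (ℚ.≤-trans (ℚ.nonNegative⁻¹ 1ℚ) (1≤fromℕ-suc k))}}
      (ℚ.≤-<-trans (fromℕ*½^ k) 1<)
    where
    instance
      _ = ℚ.positive ε>0
      _ = ℚ.pos⇒nonZero ε
      _ = ℚ.pos⇒nonNeg ε
    k = proj₁ (≤fromℕ (ℚ.1/ ε))
    1/ε≤k = proj₂ (≤fromℕ (ℚ.1/ ε))
    1< : 1ℚ ℚ.< fromℕ (suc k) ℚ.* ε
    1< = subst (ℚ._< fromℕ (suc k) ℚ.* ε) (ℚ.*-inverseˡ ε)
      (ℚ.≤-<-trans (ℚ.*-monoʳ-≤-nonNeg ε 1/ε≤k)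
        (ℚ.*-monoˡ-<-pos ε (subst (ℚ._< fromℕ (suc k)) (ℚ.+-identityˡ (fromℕ k)) (ℚ.+-monoˡ-< (fromℕ k) (ℚ.positive⁻¹ 1ℚ)))))

  -- The difference quotient `g` is supplied explicitly. Its nonnegativity makes `f` monotone, so
  -- checking the endpoints keeps the interval invariant; the bound ½ is the contraction factor.
  module MonotoneContraction
    (f : ℚ → ℚ) (g : ℚ → ℚ → ℚ) (lo hi : ℚ)
    (difference : ∀ x y → f x ℚ.- f y ≡ (x ℚ.- y) ℚ.* g x y)
    (0≤g : ∀ {x y} → lo ℚ.≤ x → x ℚ.≤ hi → lo ℚ.≤ y → y ℚ.≤ hi → 0ℚ ℚ.≤ g x y)
    (g≤½ : ∀ {x y} → lo ℚ.≤ x → x ℚ.≤ hi → lo ℚ.≤ y → y ℚ.≤ hi → g x y ℚ.≤ ½)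
    (lo≤flo : lo ℚ.≤ f lo) (fhi≤hi : f hi ℚ.≤ hi) (lo≤hi : lo ℚ.≤ hi) (hi-lo≤1 : hi ℚ.- lo ℚ.≤ 1ℚ)
    where

    Inside : ℚ → Set
    Inside x = lo ℚ.≤ x × x ℚ.≤ hi

    f-Inside : ∀ {x} → Inside x → Inside (f x)
    f-Inside {x} (lo≤x , x≤hi) =
      ℚ.≤-trans lo≤flo (0≤q-p⇒p≤q (subst (0ℚ ℚ.≤_) (sym (difference x lo))
        (0≤p*q (p≤q⇒0≤q-p lo≤x) (0≤g lo≤x x≤hi ℚ.≤-refl lo≤hi)))) ,
      ℚ.≤-trans (0≤q-p⇒p≤q (subst (0ℚ ℚ.≤_) (sym (difference hi x))
        (0≤p*q (p≤q⇒0≤q-p x≤hi) (0≤g lo≤hi ℚ.≤-refl lo≤x x≤hi)))) fhi≤hi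

    f-contracts : ∀ {x y} → Inside x → Inside y → ℚ.∣ f x ℚ.- f y ∣ ℚ.≤ ½ ℚ.* ℚ.∣ x ℚ.- y ∣
    f-contracts {x} {y} (lo≤x , x≤hi) (lo≤y , y≤hi) = subst₂ ℚ._≤_
      (sym (trans (cong ℚ.∣_∣ (difference x y)) (ℚ.∣p*q∣≡∣p∣*∣q∣ (x ℚ.- y) (g x y))))
      (ℚ.*-comm ℚ.∣ x ℚ.- y ∣ ½)
      (ℚ.*-monoˡ-≤-nonNeg ℚ.∣ x ℚ.- y ∣ {{ℚ.∣-∣-nonNeg (x ℚ.- y)}}
        (subst (ℚ._≤ ½) (sym (ℚ.0≤p⇒∣p∣≡p (0≤g lo≤x x≤hi lo≤y y≤hi))) (g≤½ lo≤x x≤hi lo≤y y≤hi)))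

    iterate : ℕ → ℚ → ℚ
    iterate zero    x = x
    iterate (suc k) x = f (iterate k x)

    iterate-Inside : ∀ k {x} → Inside x → Inside (iterate k x)
    iterate-Inside zero    x∈ = x∈
    iterate-Inside (suc k) x∈ = f-Inside (iterate-Inside k x∈)

    iterate-+ : ∀ k i x → iterate (k ℕ.+ i) x ≡ iterate k (iterate i x)
    iterate-+ zero    i x = refl
    iterate-+ (suc k) i x = cong f (iterate-+ k i x)

    iterate-close : ∀ k {x y} → Inside x → Inside y → ℚ.∣ iterate k x ℚ.- iterate k y ∣ ℚ.≤ ½^ k
    iterate-close zero {x} {y} (lo≤x , x≤hi) (lo≤y , y≤hi) = ∣p∣≤
      (ℚ.≤-trans (ℚ.+-mono-≤ x≤hi (ℚ.neg-antimono-≤ lo≤y)) hi-lo≤1)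
      (subst (ℚ._≤ 1ℚ) (solve 2 (λ x y → y :- x := :- (x :- y)) refl x y)
        (ℚ.≤-trans (ℚ.+-mono-≤ y≤hi (ℚ.neg-antimono-≤ lo≤x)) hi-lo≤1))
      where open +-*-Solver
    iterate-close (suc k) x∈ y∈ = ℚ.≤-trans
      (f-contracts (iterate-Inside k x∈) (iterate-Inside k y∈))
      (ℚ.*-monoˡ-≤-nonNeg ½ (iterate-close k x∈ y∈))

    orbit : ℕ → ℚ
    orbit k = iterate k lo

    orbit-Inside : ∀ k → Inside (orbit k)
    orbit-Inside k = iterate-Inside k (ℚ.≤-refl , lo≤hi)

    -- Both terms are `N`-fold iterates of points of the interval, whose length is at most 1.
    orbit-close : ∀ N m n → N ℕ.≤ m → N ℕ.≤ n → ℚ.∣ orbit m ℚ.- orbit n ∣ ℚ.≤ ½^ N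
    orbit-close N m n N≤m N≤n = subst₂ (λ x y → ℚ.∣ x ℚ.- y ∣ ℚ.≤ ½^ N)
      (split-orbit N≤m) (split-orbit N≤n)
      (iterate-close N (orbit-Inside (m ℕ.∸ N)) (orbit-Inside (n ℕ.∸ N)))
      where
      split-orbit : ∀ {m} → N ℕ.≤ m → iterate N (orbit (m ℕ.∸ N)) ≡ orbit m
      split-orbit {m} N≤m = trans (sym (iterate-+ N (m ℕ.∸ N) lo)) (cong orbit (ℕ.m+[n∸m]≡n N≤m))

    limit : ℝ
    limit = mkℝ orbit λ ε ε>0 → let N , small = ½^-small ε ε>0 in
      N , λ m n N≤m N≤n → ℚ.≤-<-trans (orbit-close N m n N≤m N≤n) small

    -- Applying `f` termwise shifts the orbit by one, so this sequence is Cauchy and has the same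
    -- limit because the orbit is Cauchy.
    f-limit : ℝ
    f-limit = mkℝ (λ n → f (orbit n)) λ ε ε>0 → let N , h = cauchy limit ε ε>0 in
      N , λ m n N≤m N≤n → h (suc m) (suc n) (ℕ.m≤n⇒m≤1+n N≤m) (ℕ.m≤n⇒m≤1+n N≤n)

    f-limit≈limit : f-limit ≈ℝ limit
    f-limit≈limit ε ε>0 with N , h ← cauchy limit ε ε>0 = N , λ n N≤n → h (suc n) n (ℕ.m≤n⇒m≤1+n N≤n) N≤n

-- Root sums of the cubic over a ℚ-algebra

module CubicEquation where

  open Counting using (freeWords; freeWords-recurrence)
  open RealNumbers
  open Contractions using (fromℕ)
  open import Algebra.Bundles using (CommutativeRing)
  open import Data.Integer.Base using (+_)
  open import Data.List.Base using (List; []; _∷_; map; foldr)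
  open import Data.List.Relation.Unary.All as All using (All; []; _∷_)
  open import Data.List.Relation.Unary.AllPairs as AllPairs using (AllPairs; []; _∷_)
  open import Data.List.Relation.Unary.Any as Any using (Any; here; there; _─_)
  import Data.List.Relation.Unary.All.Properties as All
  import Data.List.Relation.Unary.AllPairs.Properties as AllPairs
  import Data.List.Relation.Unary.Any.Properties as Any
  open import Data.Nat.Base as ℕ using (ℕ; zero; suc)
  open import Data.Product using (_,_)
  open import Data.Rational.Base as ℚ using (ℚ; 0ℚ; 1ℚ; ½; _/_)
  open import Data.Sum.Base using (_⊎_; inj₁; inj₂)
  open import Function.Base using (_∘_)
  open import Level using (0ℓ)
  open import Relation.Binary.PropositionalEquality as ≡ using (_≡_)
  open import Relation.Nullary using (contradiction)

  module DistinctSums (R : CommutativeRing 0ℓ 0ℓ) where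

    open CommutativeRing R
    open import Relation.Binary.Reasoning.Setoid setoid

    _∈_ : Carrier → List Carrier → Set
    x ∈ xs = Any (x ≈_) xs

    Distinct : List Carrier → Set
    Distinct = AllPairs _≉_

    private
      variable
        x y : Carrier
        xs ys : List Carrier

    ─-All : ∀ {P : Carrier → Set} (i : x ∈ ys) → All P ys → All P (ys ─ i)
    ─-All (here _)  (_ ∷ ps) = ps
    ─-All (there i) (p ∷ ps) = p ∷ ─-All i ps

    ─-Distinct : (i : x ∈ ys) → Distinct ys → Distinct (ys ─ i)
    ─-Distinct (here _)  (_ ∷ ds) = ds
    ─-Distinct (there i) (d ∷ ds) = ─-All i d ∷ ─-Distinct i ds

    ─-≉ : (i : x ∈ ys) → Distinct ys → All (_≉ x) (ys ─ i)
    ─-≉ (here x≈y) (d ∷ _)  = All.map (λ y≉z z≈x → y≉z (sym (trans z≈x x≈y))) d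
    ─-≉ (there i)  (d ∷ ds) =
      (λ y≈x → All.lookupWith (λ y≉z x≈z → y≉z (trans y≈x x≈z)) d i) ∷ ─-≉ i ds

    ─-∈ : (i : x ∈ ys) → y ∈ ys → y ≈ x ⊎ y ∈ (ys ─ i)
    ─-∈ (here x≈z) (here y≈z) = inj₁ (trans y≈z (sym x≈z))
    ─-∈ (here _)   (there j)  = inj₂ j
    ─-∈ (there _)  (here y≈z) = inj₂ (here y≈z)
    ─-∈ (there i)  (there j) with ─-∈ i j
    ... | inj₁ y≈x = inj₁ y≈x
    ... | inj₂ k   = inj₂ (there k)

    ∑ : (Carrier → Carrier) → List Carrier → Carrier
    ∑ f xs = foldr _+_ 0# (map f xs)

    module _ {f : Carrier → Carrier} (f-cong : ∀ {x y} → x ≈ y → f x ≈ f y) where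

      ∑-─ : (i : x ∈ ys) → ∑ f ys ≈ f x + ∑ f (ys ─ i)
      ∑-─ (here x≈y) = +-congʳ (f-cong (sym x≈y))
      ∑-─ {x} {y ∷ ys} (there i) = begin
        f y + ∑ f ys                 ≈⟨ +-congˡ (∑-─ i) ⟩
        f y + (f x + ∑ f (ys ─ i))   ≈⟨ +-assoc _ _ _ ⟨
        (f y + f x) + ∑ f (ys ─ i)   ≈⟨ +-congʳ (+-comm _ _) ⟩
        (f x + f y) + ∑ f (ys ─ i)   ≈⟨ +-assoc _ _ _ ⟩
        f x + (f y + ∑ f (ys ─ i))   ∎

      -- Induct on `xs`, deleting from `ys` the partner of its head. Every case split is on
      -- positions, as equality in the ring cannot be decided; distinctness prevents the deleted
      -- partner from being hit again.
      ∑-same-elements : Distinct xs → Distinct ys → All (_∈ ys) xs → All (_∈ xs) ys → ∑ f xs ≈ ∑ f ys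
      ∑-same-elements {[]} {[]} _ _ _ _ = refl
      ∑-same-elements {[]} {_ ∷ _} _ _ _ (() ∷ _)
      ∑-same-elements {x ∷ xs} {ys} (d ∷ ds) ds′ (i ∷ is) js = begin
        f x + ∑ f xs        ≈⟨ +-congˡ (∑-same-elements ds (─-Distinct i ds′) is′ js′) ⟩
        f x + ∑ f (ys ─ i)  ≈⟨ ∑-─ i ⟨
        ∑ f ys              ∎
        where
        is′ : All (_∈ (ys ─ i)) xs
        is′ = All.zipWith (λ (x≉y , j) → drop x≉y (─-∈ i j)) (d , is)
          where
          drop : x ≉ y → y ≈ x ⊎ y ∈ (ys ─ i) → y ∈ (ys ─ i)
          drop x≉y (inj₁ y≈x) = contradiction (sym y≈x) x≉y
          drop _   (inj₂ k)   = k
        js′ : All (_∈ xs) (ys ─ i)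
        js′ = All.zipWith (λ { (y≉x , here y≈x) → contradiction y≈x y≉x ; (_ , there j) → j })
          (─-≉ i ds′ , ─-All i js)

  module Cubic (A : ℚAlgebra) where

    open ℚAlgebra A
    open CommutativeRing commutativeRing hiding (_-_)
    open RingNotation rawRing using (_·_; _^_; _-_)
    open ℚAlgebraSolver A
    open DistinctSums commutativeRing using (∑; _∈_; Distinct; ∑-same-elements)
    open import Algebra.Properties.Ring ring using (-0#≈0#)
    open import Algebra.Properties.Group +-group using (x∙y⁻¹≈ε⇒x≈y)
    open import Algebra.Properties.Monoid.Mult +-monoid using (×-homo-+)
    open import Relation.Binary.Reasoning.Setoid setoid

    multiple-step : ∀ k {x y} → y ≈ ι (fromℕ k) * x → x + y ≈ ι (fromℕ (suc k)) * x
    multiple-step k {x} {y} y≈ = begin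
      x + y                          ≈⟨ +-cong (sym (*-identityˡ x)) y≈ ⟩
      1# * x + ι (fromℕ k) * x       ≈⟨ distribʳ x 1# _ ⟨
      (1# + ι (fromℕ k)) * x         ≈⟨ *-congʳ (+-congʳ 1-homo) ⟨
      (ι 1ℚ + ι (fromℕ k)) * x       ≈⟨ *-congʳ (+-homo 1ℚ (fromℕ k)) ⟨
      ι (fromℕ (suc k)) * x          ∎

    ×-ι : ∀ k x → k · x ≈ ι (fromℕ k) * x
    ×-ι zero    x = sym (trans (*-congʳ 0-homo) (zeroˡ x))
    ×-ι (suc k) x = multiple-step k (×-ι k x)

    -- The polynomial of `IsRoot` in the form to which the solver's expressions evaluate, with
    -- rational constants embedded by `ι`.
    cubic : Carrier → Carrier
    cubic z = (ι 1ℚ + - (z + z)) + - (z * (z * z))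

    cubic-notation : ∀ z → 1# - 2 · z - z ^ 3 ≈ cubic z
    cubic-notation z = +-cong (+-cong (sym 1-homo) (-‿cong (+-congˡ (+-identityʳ z))))
      (-‿cong (*-congˡ (*-congˡ (*-identityʳ z))))

    IsRoot : Carrier → Set
    IsRoot z = 1# - 2 · z - z ^ 3 ≈ 0#

    cubic≈0 : ∀ {z} → IsRoot z → cubic z ≈ 0#
    cubic≈0 {z} root = trans (sym (cubic-notation z)) root

    ≈0⇒*≈0 : ∀ {x} y → x ≈ 0# → x * y ≈ 0#
    ≈0⇒*≈0 y x≈0 = trans (*-congʳ x≈0) (zeroˡ y)

    -- The device for calculating modulo a vanishing polynomial: the solver checks `x ≈ y + c * r`
    -- with `c` vanishing, where the cofactor `r` is the quotient of a polynomial division.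
    drop-+ : ∀ {x y z} → x ≈ y + z → z ≈ 0# → x ≈ y
    drop-+ {x} {y} x≈ z≈0 = trans x≈ (trans (+-congˡ z≈0) (+-identityʳ y))

    reciprocal : Carrier → Carrier
    reciprocal z = z * z + ι (+ 2 / 1)

    reciprocal-inverse : ∀ {z} → IsRoot z → z * reciprocal z ≈ 1#
    reciprocal-inverse {z} root = trans
      (drop-+ (solve 1 (λ z → z :* (z :* z :+ con (+ 2 / 1)) :=
        con 1ℚ :+ ((con 1ℚ :+ :- (z :+ z)) :+ :- (z :* (z :* z))) :* con (ℚ.- 1ℚ)) refl z)
        (≈0⇒*≈0 _ (cubic≈0 root)))
      1-homo

    reciprocal-unique : ∀ {z w} → IsRoot z → z * w ≈ 1# → w ≈ reciprocal z
    reciprocal-unique {z} {w} root zw≈1 = begin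
      w                         ≈⟨ *-identityʳ w ⟨
      w * 1#                    ≈⟨ *-congˡ (reciprocal-inverse root) ⟨
      w * (z * reciprocal z)    ≈⟨ *-assoc w z _ ⟨
      (w * z) * reciprocal z    ≈⟨ *-congʳ (trans (*-comm w z) zw≈1) ⟩
      1# * reciprocal z         ≈⟨ *-identityˡ _ ⟩
      reciprocal z              ∎

    reciprocal-cong : ∀ {z w} → z ≈ w → reciprocal z ≈ reciprocal w
    reciprocal-cong z≈w = +-congʳ (*-cong z≈w z≈w)

    -- β³ = 2β² + 1 for β = z⁻¹
    reciprocal-cube : ∀ {z} → IsRoot z → let β = reciprocal z in
      ∀ x → β * (β * (β * x)) ≈ ι (+ 2 / 1) * (β * (β * x)) + x
    reciprocal-cube {z} root x = begin
      β * (β * (β * x))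
        ≈⟨ solve 2 (λ z x → let β = z :* z :+ con (+ 2 / 1) in
             β :* (β :* (β :* x)) := con (+ 2 / 1) :* (β :* (β :* x)) :+ ((z :* β) :* (z :* β)) :* x) refl z x ⟩
      ι (+ 2 / 1) * (β * (β * x)) + ((z * β) * (z * β)) * x
        ≈⟨ +-congˡ (*-congʳ (*-cong (reciprocal-inverse root) (reciprocal-inverse root))) ⟩
      ι (+ 2 / 1) * (β * (β * x)) + (1# * 1#) * x
        ≈⟨ +-congˡ (trans (*-congʳ (*-identityˡ 1#)) (*-identityˡ x)) ⟩
      ι (+ 2 / 1) * (β * (β * x)) + x ∎
      where β = reciprocal z

    pow : Carrier → ℕ → Carrier
    pow x zero    = 1#
    pow x (suc n) = x * pow x n

    weight : Carrier → Carrier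
    weight z = (ι (+ 13 / 1) * reciprocal z + ι (+ 11 / 1)) + - (ι (+ 5 / 1) * z)

    term : ℕ → Carrier → Carrier
    term n z = weight z * pow (reciprocal z) n

    pow-cong : ∀ n {x y} → x ≈ y → pow x n ≈ pow y n
    pow-cong zero    x≈y = refl
    pow-cong (suc n) x≈y = *-cong x≈y (pow-cong n x≈y)

    term-cong : ∀ n {z w} → z ≈ w → term n z ≈ term n w
    term-cong n z≈w = *-cong
      (+-cong (+-congʳ (*-congˡ (reciprocal-cong z≈w))) (-‿cong (*-congˡ z≈w)))
      (pow-cong n (reciprocal-cong z≈w))

    term-notation : ∀ n {z w a b c p} → IsRoot z → z * w ≈ 1# →
      a ≈ ι (fromℕ 13) * w → b ≈ ι (fromℕ 11) * 1# → c ≈ ι (fromℕ 5) * z → p ≈ pow w n →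
      (a + b - c) * p ≈ term n z
    term-notation n root zw≈1 a≈ b≈ c≈ p≈ = *-cong
      (+-cong (+-cong (trans a≈ (*-congˡ w≈)) (trans b≈ (*-identityʳ _))) (-‿cong c≈))
      (trans p≈ (pow-cong n w≈))
      where w≈ = reciprocal-unique root zw≈1

    term-recurrence : ∀ n {z} → IsRoot z →
      term (3 ℕ.+ n) z ≈ ι (+ 2 / 1) * term (2 ℕ.+ n) z + term n z
    term-recurrence n {z} root = begin
      c * (β * (β * (β * pow β n)))
        ≈⟨ *-congˡ (reciprocal-cube root (pow β n)) ⟩
      c * (ι (+ 2 / 1) * (β * (β * pow β n)) + pow β n)
        ≈⟨ solve 3 (λ c u x → c :* (con (+ 2 / 1) :* u :+ x) := con (+ 2 / 1) :* (c :* u) :+ c :* x)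
             refl c (β * (β * pow β n)) (pow β n) ⟩
      ι (+ 2 / 1) * (c * (β * (β * pow β n))) + c * pow β n ∎
      where
      c = weight z
      β = reciprocal z

    -- Together with `term-1` and `term-2` this reduces the first terms to degree two modulo the
    -- cubic, so that their sums over the roots need only the first two power sums.
    term-0 : ∀ z → term 0 z ≈ (ι (+ 13 / 1) * (z * z) + ι (ℚ.- (+ 5 / 1)) * z) + ι (+ 37 / 1)
    term-0 z = trans (*-identityʳ _) (solve 1 (λ z →
      (con (+ 13 / 1) :* (z :* z :+ con (+ 2 / 1)) :+ con (+ 11 / 1)) :+ :- (con (+ 5 / 1) :* z) :=
      (con (+ 13 / 1) :* (z :* z) :+ con (ℚ.- (+ 5 / 1)) :* z) :+ con (+ 37 / 1)) refl z)

    term-1 : ∀ {z} → IsRoot z → term 1 z ≈ (ι (+ 37 / 1) * (z * z) + ι (+ 13 / 1) * z) + ι (+ 69 / 1)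
    term-1 {z} root = trans (*-congˡ (*-identityʳ _)) (drop-+ (solve 1 (λ z →
      let β = z :* z :+ con (+ 2 / 1) in
      ((con (+ 13 / 1) :* β :+ con (+ 11 / 1)) :+ :- (con (+ 5 / 1) :* z)) :* β :=
      ((con (+ 37 / 1) :* (z :* z) :+ con (+ 13 / 1) :* z) :+ con (+ 69 / 1))
        :+ ((con 1ℚ :+ :- (z :+ z)) :+ :- (z :* (z :* z))) :* (con (+ 5 / 1) :- con (+ 13 / 1) :* z)) refl z)
      (≈0⇒*≈0 _ (cubic≈0 root)))

    term-2 : ∀ {z} → IsRoot z → term 2 z ≈ (ι (+ 69 / 1) * (z * z) + ι (+ 37 / 1) * z) + ι (+ 151 / 1)
    term-2 {z} root = begin
      weight z * (β * (β * 1#))     ≈⟨ *-congˡ (*-comm β _) ⟩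
      weight z * ((β * 1#) * β)     ≈⟨ *-assoc _ _ _ ⟨
      term 1 z * β                  ≈⟨ *-congʳ (term-1 root) ⟩
      ((ι (+ 37 / 1) * (z * z) + ι (+ 13 / 1) * z) + ι (+ 69 / 1)) * β
        ≈⟨ drop-+ (solve 1 (λ z →
            ((con (+ 37 / 1) :* (z :* z) :+ con (+ 13 / 1) :* z) :+ con (+ 69 / 1)) :* (z :* z :+ con (+ 2 / 1)) :=
            ((con (+ 69 / 1) :* (z :* z) :+ con (+ 37 / 1) :* z) :+ con (+ 151 / 1))
              :+ ((con 1ℚ :+ :- (z :+ z)) :+ :- (z :* (z :* z))) :* :- (con (+ 37 / 1) :* z :+ con (+ 13 / 1))) refl z)
            (≈0⇒*≈0 _ (cubic≈0 root)) ⟩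
      (ι (+ 69 / 1) * (z * z) + ι (+ 37 / 1) * z) + ι (+ 151 / 1) ∎
      where β = reciprocal z

    -- Given one root R and a square root V of -(2 + ¾R²), the other roots are -½R ± V.
    module Roots (R V : Carrier) (R-root : IsRoot R)
      (V² : V * V ≈ - (ι (+ 2 / 1) + ι (+ 3 / 4) * (R * R))) where

      γ₊ γ₋ : Carrier
      γ₊ = ι (ℚ.- ½) * R + V
      γ₋ = ι (ℚ.- ½) * R + - V

      defect : Carrier
      defect = V * V + (ι (+ 2 / 1) + ι (+ 3 / 4) * (R * R))

      defect≈0 : defect ≈ 0#
      defect≈0 = trans (+-congʳ V²) (-‿inverseˡ _)

      -- Dividing the difference of the cubic at `z` and at `R` by -(z - R) leaves z² + Rz + R² + 2
      -- = (z + ½R)² + (2 + ¾R²). Up to `defect` this is (z + ½R)² - V², a difference of squares.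
      factorisation : ∀ z → cubic z ≈ - ((z - R) * ((z - γ₊) * (z - γ₋)))
      factorisation z = drop-+ (drop-+ (solve 3 (λ z R V →
          let c z = (con 1ℚ :+ :- (z :+ z)) :+ :- (z :* (z :* z))
              e   = V :* V :+ (con (+ 2 / 1) :+ con (+ 3 / 4) :* (R :* R))
          in c z := (:- ((z :+ :- R) :* ((z :+ :- (con (ℚ.- ½) :* R :+ V)) :* (z :+ :- (con (ℚ.- ½) :* R :+ :- V))))
               :+ e :* :- (z :+ :- R)) :+ c R) refl z R V)
          (cubic≈0 R-root)) (≈0⇒*≈0 _ defect≈0)

      root⇒product≈0 : ∀ {z} → IsRoot z → (z - R) * ((z - γ₊) * (z - γ₋)) ≈ 0#
      root⇒product≈0 {z} root = begin
        x          ≈⟨ solve 1 (λ x → x := :- (:- x)) refl x ⟩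
        - (- x)    ≈⟨ -‿cong (factorisation z) ⟨
        - cubic z  ≈⟨ -‿cong (cubic≈0 root) ⟩
        - 0#       ≈⟨ -0#≈0# ⟩
        0#         ∎
        where x = (z - R) * ((z - γ₊) * (z - γ₋))

      product≈0⇒root : ∀ {z} → (z - γ₊) * (z - γ₋) ≈ 0# → IsRoot z
      product≈0⇒root {z} eq = begin
        1# - 2 · z - z ^ 3                     ≈⟨ cubic-notation z ⟩
        cubic z                                ≈⟨ factorisation z ⟩
        - ((z - R) * ((z - γ₊) * (z - γ₋)))    ≈⟨ -‿cong (trans (*-congˡ eq) (zeroʳ _)) ⟩
        - 0#                                   ≈⟨ -0#≈0# ⟩
        0#                                     ∎

      γ₊-root : IsRoot γ₊
      γ₊-root = product≈0⇒root (trans (*-congʳ (-‿inverseʳ γ₊)) (zeroˡ _))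

      γ₋-root : IsRoot γ₋
      γ₋-root = product≈0⇒root (trans (*-congˡ (-‿inverseʳ γ₋)) (zeroʳ _))

      -- Cancellability of `z - w`, in place of the zero-product property: if two of the three
      -- factors in the factorisation can be cancelled, the third vanishes.
      Separated : Carrier → Carrier → Set
      Separated z w = ∀ u → (z - w) * u ≈ 0# → u ≈ 0#

      root≈R : ∀ {z} → IsRoot z → Separated z γ₊ → Separated z γ₋ → z ≈ R
      root≈R {z} root reg₊ reg₋ = x∙y⁻¹≈ε⇒x≈y z R (reg₋ _ (reg₊ _ (trans
        (solve 3 (λ x y w → y :* (w :* x) := x :* (y :* w)) refl (z - R) (z - γ₊) (z - γ₋))
        (root⇒product≈0 root))))

      root≈γ₊ : ∀ {z} → IsRoot z → Separated z R → Separated z γ₋ → z ≈ γ₊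
      root≈γ₊ {z} root regR reg₋ = x∙y⁻¹≈ε⇒x≈y z γ₊ (reg₋ _ (trans (*-comm _ _) (regR _ (root⇒product≈0 root))))

      root≈γ₋ : ∀ {z} → IsRoot z → Separated z R → Separated z γ₊ → z ≈ γ₋
      root≈γ₋ {z} root regR reg₊ = x∙y⁻¹≈ε⇒x≈y z γ₋ (reg₊ _ (regR _ (root⇒product≈0 root)))

      roots : List Carrier
      roots = R ∷ γ₊ ∷ γ₋ ∷ []

      -- The roots sum to zero, so `b` drops out; their squares sum to -4 plus twice the defect.
      quadratic-sum : ∀ {f : Carrier → Carrier} a b c →
        (∀ {z} → IsRoot z → f z ≈ (ι a * (z * z) + ι b * z) + ι c) →
        ∑ f roots ≈ ι (ℚ.- (+ 4 / 1)) * ι a + ι (+ 3 / 1) * ι c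
      quadratic-sum a b c f≈ = trans
        (+-cong (f≈ R-root) (+-cong (f≈ γ₊-root) (trans (+-identityʳ _) (f≈ γ₋-root))))
        (drop-+ (solve 5 (λ a b c R V →
          let p = con (ℚ.- ½) :* R :+ V
              m = con (ℚ.- ½) :* R :+ :- V
              f z = (a :* (z :* z) :+ b :* z) :+ c
              e   = V :* V :+ (con (+ 2 / 1) :+ con (+ 3 / 4) :* (R :* R))
          in f R :+ (f p :+ f m) := (con (ℚ.- (+ 4 / 1)) :* a :+ con (+ 3 / 1) :* c) :+ e :* (con (+ 2 / 1) :* a))
          refl (ι a) (ι b) (ι c) R V) (≈0⇒*≈0 _ defect≈0))

      -- The sequence n ↦ freeWords (n - 1), continued backwards by its recurrence.
      shifted : ℕ → ℕ
      shifted zero    = 1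
      shifted (suc n) = freeWords n

      shifted-recurrence : ∀ n → shifted (3 ℕ.+ n) ≡ 2 ℕ.* shifted (2 ℕ.+ n) ℕ.+ shifted n
      shifted-recurrence zero    = ≡.refl
      shifted-recurrence (suc n) = freeWords-recurrence n

      ∑-recurrence : ∀ n → ∑ (term (3 ℕ.+ n)) roots ≈ ι (+ 2 / 1) * ∑ (term (2 ℕ.+ n)) roots + ∑ (term n) roots
      ∑-recurrence n = trans
        (+-cong (term-recurrence n R-root) (+-cong (term-recurrence n γ₊-root) (+-congʳ (term-recurrence n γ₋-root))))
        (begin
          (t * a + a′) + ((t * b + b′) + ((t * c + c′) + 0#))
            ≈⟨ +-congˡ (+-congˡ (+-identityʳ _)) ⟩
          (t * a + a′) + ((t * b + b′) + (t * c + c′))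
            ≈⟨ solve 6 (λ a b c a′ b′ c′ → let t = con (+ 2 / 1) in
                 (t :* a :+ a′) :+ ((t :* b :+ b′) :+ (t :* c :+ c′)) := t :* (a :+ (b :+ c)) :+ (a′ :+ (b′ :+ c′)))
                 refl a b c a′ b′ c′ ⟩
          t * (a + (b + c)) + (a′ + (b′ + c′))
            ≈⟨ +-cong (*-congˡ (+-congˡ (+-congˡ (+-identityʳ _)))) (+-congˡ (+-congˡ (+-identityʳ _))) ⟨
          t * (a + (b + (c + 0#))) + (a′ + (b′ + (c′ + 0#))) ∎)
        where
        t = ι (+ 2 / 1)
        a = term (2 ℕ.+ n) R
        b = term (2 ℕ.+ n) γ₊
        c = term (2 ℕ.+ n) γ₋
        a′ = term n R
        b′ = term n γ₊
        c′ = term n γ₋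

      -- Both sides satisfy the same third-order recurrence, and the first three sums are 59, 59 and
      -- 177, that is 59 times 1, 1 and 3.
      ∑-roots : ∀ n → ∑ (term n) roots ≈ ι (+ 59 / 1) * (shifted n · 1#)
      ∑-roots 0 = trans (quadratic-sum (+ 13 / 1) (ℚ.- (+ 5 / 1)) (+ 37 / 1) (λ {z} _ → term-0 z))
        (trans (solve 0 (con (ℚ.- (+ 4 / 1)) :* con (+ 13 / 1) :+ con (+ 3 / 1) :* con (+ 37 / 1)
          := con (+ 59 / 1) :* con (+ 1 / 1)) refl) (*-congˡ (trans (sym (*-identityʳ _)) (sym (×-ι 1 1#)))))
      ∑-roots 1 = trans (quadratic-sum (+ 37 / 1) (+ 13 / 1) (+ 69 / 1) term-1)
        (trans (solve 0 (con (ℚ.- (+ 4 / 1)) :* con (+ 37 / 1) :+ con (+ 3 / 1) :* con (+ 69 / 1)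
          := con (+ 59 / 1) :* con (+ 1 / 1)) refl) (*-congˡ (trans (sym (*-identityʳ _)) (sym (×-ι 1 1#)))))
      ∑-roots 2 = trans (quadratic-sum (+ 69 / 1) (+ 37 / 1) (+ 151 / 1) term-2)
        (trans (solve 0 (con (ℚ.- (+ 4 / 1)) :* con (+ 69 / 1) :+ con (+ 3 / 1) :* con (+ 151 / 1)
          := con (+ 59 / 1) :* con (+ 3 / 1)) refl) (*-congˡ (trans (sym (*-identityʳ _)) (sym (×-ι 3 1#)))))
      ∑-roots (suc m@(suc (suc n))) = begin
        ∑ (term (3 ℕ.+ n)) roots
          ≈⟨ ∑-recurrence n ⟩
        ι (+ 2 / 1) * ∑ (term (2 ℕ.+ n)) roots + ∑ (term n) roots
          ≈⟨ +-cong (*-congˡ (∑-roots m)) (∑-roots n) ⟩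
        ι (+ 2 / 1) * (ι (+ 59 / 1) * (a · 1#)) + ι (+ 59 / 1) * (b · 1#)
          ≈⟨ solve 2 (λ x y → con (+ 2 / 1) :* (con (+ 59 / 1) :* x) :+ con (+ 59 / 1) :* y :=
               con (+ 59 / 1) :* ((x :+ x) :+ y)) refl (a · 1#) (b · 1#) ⟩
        ι (+ 59 / 1) * ((a · 1# + a · 1#) + b · 1#)
          ≈⟨ *-congˡ (+-congʳ (+-congˡ (+-identityʳ _))) ⟨
        ι (+ 59 / 1) * ((a · 1# + (a · 1# + 0#)) + b · 1#)
          ≈⟨ *-congˡ (+-congʳ (trans (×-homo-+ 1# a (a ℕ.+ 0)) (+-congˡ (×-homo-+ 1# a 0)))) ⟨
        ι (+ 59 / 1) * ((2 ℕ.* a) · 1# + b · 1#)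
          ≈⟨ *-congˡ (×-homo-+ 1# (2 ℕ.* a) b) ⟨
        ι (+ 59 / 1) * ((2 ℕ.* a ℕ.+ b) · 1#)
          ≈⟨ *-congˡ (reflexive (≡.cong (_· 1#) (shifted-recurrence n))) ⟨
        ι (+ 59 / 1) * (shifted (3 ℕ.+ n) · 1#) ∎
        where
        a = shifted (2 ℕ.+ n)
        b = shifted n

      ∑-closed-form : ∀ n {k} → suc k ≡ shifted n → k · 1# ≈ ι (+ 1 / 59) * ∑ (term n) roots - 1#
      ∑-closed-form n {k} eq = sym (begin
        ι (+ 1 / 59) * ∑ (term n) roots - 1#
          ≈⟨ +-congʳ (*-congˡ (∑-roots n)) ⟩
        ι (+ 1 / 59) * (ι (+ 59 / 1) * (shifted n · 1#)) - 1#
          ≈⟨ +-congʳ (solve 1 (λ x → con (+ 1 / 59) :* (con (+ 59 / 1) :* x) := x) refl _) ⟩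
        shifted n · 1# - 1#
          ≈⟨ +-congʳ (reflexive (≡.cong (_· 1#) (≡.sym eq))) ⟩
        (1# + k · 1#) - 1#
          ≈⟨ solve 2 (λ u x → (u :+ x) :- u := x) refl 1# (k · 1#) ⟩
        k · 1# ∎)

      ∑-term : ∀ n {X : Set} {value f : X → Carrier} →
        (∀ x → IsRoot (value x) → f x ≈ term n (value x)) → ∀ {xs} → All (IsRoot ∘ value) xs →
        foldr _+_ 0# (map f xs) ≈ ∑ (term n) (map value xs)
      ∑-term n f≈ []            = refl
      ∑-term n f≈ (root ∷ rs) = +-cong (f≈ _ root) (∑-term n f≈ rs)

      -- The given listing, indexed by any type `X`, and `roots` are duplicate-free and contain each
      -- other's members, so the known sum over `roots` transfers to the listing.
      closed-form : ∀ n {k y} → suc k ≡ shifted n → y ≈ ι (fromℕ k) * 1# →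
        Distinct roots → (∀ z → IsRoot z → z ∈ roots) →
        ∀ {X : Set} {value f : X → Carrier} → (∀ x → IsRoot (value x) → f x ≈ term n (value x)) →
        ∀ {xs} → All (IsRoot ∘ value) xs → AllPairs (λ x x′ → value x ≉ value x′) xs →
        (∀ z → IsRoot z → Any (λ x → z ≈ value x) xs) →
        y ≈ ι (+ 1 / 59) * foldr _+_ 0# (map f xs) - 1#
      closed-form n {k} {y} eq y≈ roots-distinct roots-complete {X} {value} {f} f≈ {xs} rs distinct complete = begin
        y                                                  ≈⟨ y≈ ⟩
        ι (fromℕ k) * 1#                                   ≈⟨ ×-ι k 1# ⟨
        k · 1#                                             ≈⟨ ∑-closed-form n eq ⟩
        ι (+ 1 / 59) * ∑ (term n) roots - 1#               ≈⟨ +-congʳ (*-congˡ same-sum) ⟨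
        ι (+ 1 / 59) * ∑ (term n) (map value xs) - 1#      ≈⟨ +-congʳ (*-congˡ (∑-term n f≈ rs)) ⟨
        ι (+ 1 / 59) * foldr _+_ 0# (map f xs) - 1#        ∎
        where
        listed : ∀ {z} → IsRoot z → z ∈ map value xs
        listed root = Any.map⁺ (complete _ root)
        same-sum : ∑ (term n) (map value xs) ≈ ∑ (term n) roots
        same-sum = ∑-same-elements (term-cong n) (AllPairs.map⁺ distinct) roots-distinct
          (All.map⁺ (All.map (roots-complete _) rs)) (listed R-root ∷ listed γ₊-root ∷ listed γ₋-root ∷ [])

  module RootIdentities (A : ℚAlgebra) where

    open ℚAlgebra A
    open CommutativeRing commutativeRing
    open ℚAlgebraSolver A
    open Cubic A using (cubic; ≈0⇒*≈0; drop-+)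
    open import Relation.Binary.Reasoning.Setoid setoid

    -- Turns a fixed point of x ↦ x + c p(x) into a zero of p, the rational `c` having inverse `d`.
    fixed⇒≈0 : ∀ c d → d ℚ.* c ≡ 1ℚ → ∀ {x y} → x + ι c * y ≈ x → y ≈ 0#
    fixed⇒≈0 c d dc≡1 {x} {y} fixed = begin
      y                                ≈⟨ *-identityˡ y ⟨
      1# * y                           ≈⟨ *-congʳ (trans (reflexive (≡.cong ι dc≡1)) 1-homo) ⟨
      ι (d ℚ.* c) * y                  ≈⟨ *-congʳ (*-homo d c) ⟩
      (ι d * ι c) * y                  ≈⟨ solve 4 (λ c d x y → (d :* c) :* y := ((x :+ c :* y) :- x) :* d) refl (ι c) (ι d) x y ⟩
      ((x + ι c * y) + - x) * ι d      ≈⟨ ≈0⇒*≈0 (ι d) (trans (+-congʳ fixed) (-‿inverseʳ x)) ⟩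
      0# ∎

    imaginaryPart : Carrier → Carrier → Carrier
    imaginaryPart r t = t * (ι (+ 1 / 118) * ((ι (+ 12 / 1) * (r * r) + ι (+ 9 / 1) * r) + ι (+ 16 / 1)))

    -- At a root r the discriminant of the cubic is -59, so √59 / (6r² + 4) is the
    -- imaginary part of the other two roots; (12r² + 9r + 16) / 118 inverts 6r² + 4 modulo the cubic.
    imaginaryPart² : ∀ {r t} → cubic r ≈ 0# → ι (+ 59 / 1) + - (t * t) ≈ 0# →
      imaginaryPart r t * imaginaryPart r t ≈ ι (+ 2 / 1) + ι (+ 3 / 4) * (r * r)
    imaginaryPart² {r} {t} root square = drop-+ (drop-+ (solve 2 (λ r t →
        let h = (con (+ 12 / 1) :* (r :* r) :+ con (+ 9 / 1) :* r) :+ con (+ 16 / 1)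
            v = t :* (con (+ 1 / 118) :* h)
            c = (con 1ℚ :+ :- (r :+ r)) :+ :- (r :* (r :* r))
            d = con (+ 59 / 1) :+ :- (t :* t)
        in v :* v := ((con (+ 2 / 1) :+ con (+ 3 / 4) :* (r :* r))
             :+ c :* :- (con (+ 36 / 59) :* r :+ con (+ 54 / 59)))
             :+ d :* :- (con (+ 1 / 13924) :* (h :* h))) refl r t)
        (≈0⇒*≈0 _ square)) (≈0⇒*≈0 _ root)

    private
      o : Carrier
      o = ι 0ℚ

    -- The real part of the complex cubic at a real argument. The zeros `o` are imaginary parts,
    -- kept in place so that the expression is literally the unfolded complex one.
    cubic-re : ∀ {r} → cubic r ≈ 0# →
      (ι 1ℚ + - (r + r)) + - (r * (r * r + - (o * o)) + - (o * (r * o + o * r))) ≈ ι 0ℚ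
    cubic-re {r} root = trans (solve 1 (λ r → let o = con 0ℚ in
        (con 1ℚ :+ :- (r :+ r)) :+ :- (r :* (r :* r :+ :- (o :* o)) :+ :- (o :* (r :* o :+ o :* r)))
        := (con 1ℚ :+ :- (r :+ r)) :+ :- (r :* (r :* r))) refl r)
      (trans root (sym 0-homo))

    cubic-im : ∀ r → (o + - (o + o)) + - (r * (r * o + o * r) + o * (r * r + - (o * o))) ≈ ι 0ℚ
    cubic-im = solve 1 (λ r → let o = con 0ℚ in
      (o :+ :- (o :+ o)) :+ :- (r :* (r :* o :+ o :* r) :+ o :* (r :* r :+ :- (o :* o))) := o) refl

    square-re : ∀ {r v} → v * v ≈ ι (+ 2 / 1) + ι (+ 3 / 4) * (r * r) →
      o * o + - (v * v) ≈
      - (ι (+ 2 / 1) + (ι (+ 3 / 4) * (r * r + - (o * o)) + - (o * (r * o + o * r))))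
    square-re {r} {v} eq = trans (+-congˡ (-‿cong eq)) (solve 1 (λ r → let o = con 0ℚ in
      o :* o :+ :- (con (+ 2 / 1) :+ con (+ 3 / 4) :* (r :* r)) :=
      :- (con (+ 2 / 1) :+ (con (+ 3 / 4) :* (r :* r :+ :- (o :* o)) :+ :- (o :* (r :* o :+ o :* r))))) refl r)

    square-im : ∀ r v → o * v + v * o ≈ - (o + (ι (+ 3 / 4) * (r * o + o * r) + o * (r * r + - (o * o))))
    square-im = solve 2 (λ r v → let o = con 0ℚ in
      o :* v :+ v :* o := :- (o :+ (con (+ 3 / 4) :* (r :* o :+ o :* r) :+ o :* (r :* r :+ :- (o :* o))))) refl

    -- Multiply the vanishing product (a + bi)(c + di) by the conjugate a - bi and take the real
    -- part.
    norm-re : ∀ {a b c d} → a * c + - (b * d) ≈ ι 0ℚ → a * d + b * c ≈ ι 0ℚ → (a * a + b * b) * c ≈ ι 0ℚ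
    norm-re {a} {b} {c} {d} re≈0 im≈0 = trans
      (solve 4 (λ a b c d → (a :* a :+ b :* b) :* c := a :* (a :* c :+ :- (b :* d)) :+ b :* (a :* d :+ b :* c)) refl a b c d)
      (trans (+-cong (*-congˡ re≈0) (*-congˡ im≈0)) (solve 2 (λ a b → a :* con 0ℚ :+ b :* con 0ℚ := con 0ℚ) refl a b))

    norm-im : ∀ {a b c d} → a * c + - (b * d) ≈ ι 0ℚ → a * d + b * c ≈ ι 0ℚ → (a * a + b * b) * d ≈ ι 0ℚ
    norm-im {a} {b} {c} {d} re≈0 im≈0 = trans
      (solve 4 (λ a b c d → (a :* a :+ b :* b) :* d := a :* (a :* d :+ b :* c) :+ :- b :* (a :* c :+ :- (b :* d))) refl a b c d)
      (trans (+-cong (*-congˡ im≈0) (*-congˡ re≈0)) (solve 2 (λ a b → a :* con 0ℚ :+ :- b :* con 0ℚ := con 0ℚ) refl a b))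

-- The real root, the square root of 59, and the imaginary part

module RealRoot where

  open RealNumbers
  open Contractions
  open CubicEquation
  open import Data.Integer.Base using (+_)
  open import Data.Rational.Base as ℚ using (ℚ; 0ℚ; 1ℚ; ½; _/_)
  import Data.Rational.Properties as ℚ
  open import Data.Rational.Solver using (module +-*-Solver)
  open import Relation.Binary.PropositionalEquality
  open import Data.Unit.Base using (tt)

  open +-*-Solver

  -- With the factor ¼ the derivative is ½ - ¾x², which stays between 5/16 and ½ on [0, ½].
  ρ-step : ℚ → ℚ
  ρ-step x = x ℚ.+ (+ 1 / 4) ℚ.* ((1ℚ ℚ.+ ℚ.- (x ℚ.+ x)) ℚ.+ ℚ.- (x ℚ.* (x ℚ.* x)))

  ρ-slope : ℚ → ℚ → ℚ
  ρ-slope x y = ½ ℚ.- (+ 1 / 4) ℚ.* (x ℚ.* x ℚ.+ x ℚ.* y ℚ.+ y ℚ.* y)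

  ρ-difference : ∀ x y → ρ-step x ℚ.- ρ-step y ≡ (x ℚ.- y) ℚ.* ρ-slope x y
  ρ-difference = solve 2 (λ x y →
    let f x = x :+ con (+ 1 / 4) :* ((con 1ℚ :+ :- (x :+ x)) :+ :- (x :* (x :* x)))
    in f x :- f y := (x :- y) :* (con ½ :- con (+ 1 / 4) :* (x :* x :+ x :* y :+ y :* y))) refl

  -- The constant 5/16 is the slope at x = y = ½. The excess is a quarter of the sum of ¼ - x², ¼ -
  -- xy and ¼ - y², each written as a sum of products of nonnegative factors.
  0≤ρ-slope : ∀ {x y} → 0ℚ ℚ.≤ x → x ℚ.≤ ½ → 0ℚ ℚ.≤ y → y ℚ.≤ ½ → 0ℚ ℚ.≤ ρ-slope x y
  0≤ρ-slope {x} {y} 0≤x x≤½ 0≤y y≤½ = subst (0ℚ ℚ.≤_)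
    (solve 2 (λ x y →
      con (+ 5 / 16) :+ con (+ 1 / 4) :*
        ((con ½ :- x) :* (con ½ :+ x) :+ (con ½ :* (con ½ :- y) :+ y :* (con ½ :- x)) :+ (con ½ :- y) :* (con ½ :+ y))
      := con ½ :- con (+ 1 / 4) :* (x :* x :+ x :* y :+ y :* y)) refl x y)
    (0≤p+q (ℚ.nonNegative⁻¹ (+ 5 / 16)) (0≤p*q (ℚ.nonNegative⁻¹ (+ 1 / 4))
      (0≤p+q (0≤p+q
        (0≤p*q (p≤q⇒0≤q-p x≤½) (0≤p+q (ℚ.nonNegative⁻¹ ½) 0≤x))
        (0≤p+q (0≤p*q (ℚ.nonNegative⁻¹ ½) (p≤q⇒0≤q-p y≤½)) (0≤p*q 0≤y (p≤q⇒0≤q-p x≤½))))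
        (0≤p*q (p≤q⇒0≤q-p y≤½) (0≤p+q (ℚ.nonNegative⁻¹ ½) 0≤y)))))

  ρ-slope≤½ : ∀ {x y} → 0ℚ ℚ.≤ x → x ℚ.≤ ½ → 0ℚ ℚ.≤ y → y ℚ.≤ ½ → ρ-slope x y ℚ.≤ ½
  ρ-slope≤½ {x} {y} 0≤x _ 0≤y _ = 0≤q-p⇒p≤q (subst (0ℚ ℚ.≤_)
    (solve 2 (λ x y → con (+ 1 / 4) :* (x :* x :+ x :* y :+ y :* y)
      := con ½ :- (con ½ :- con (+ 1 / 4) :* (x :* x :+ x :* y :+ y :* y))) refl x y)
    (0≤p*q (ℚ.nonNegative⁻¹ (+ 1 / 4))
      (0≤p+q (0≤p+q (0≤p*q 0≤x 0≤x) (0≤p*q 0≤x 0≤y)) (0≤p*q 0≤y 0≤y))))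

  module ρ = MonotoneContraction ρ-step ρ-slope 0ℚ ½ ρ-difference 0≤ρ-slope ρ-slope≤½
    (ℚ.≤ᵇ⇒≤ tt) (ℚ.≤ᵇ⇒≤ tt) (ℚ.≤ᵇ⇒≤ tt) (ℚ.≤ᵇ⇒≤ tt)

  -- As 7² < 59 < 8², iterate on [7, 8]; the factor 1/16 makes the slope 1 - (x + y)/16, which lies
  -- between 0 and 1/8 there.
  √59-step : ℚ → ℚ
  √59-step x = x ℚ.+ (+ 1 / 16) ℚ.* ((+ 59 / 1) ℚ.+ ℚ.- (x ℚ.* x))

  √59-slope : ℚ → ℚ → ℚ
  √59-slope x y = 1ℚ ℚ.- (+ 1 / 16) ℚ.* (x ℚ.+ y)

  √59-difference : ∀ x y → √59-step x ℚ.- √59-step y ≡ (x ℚ.- y) ℚ.* √59-slope x y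
  √59-difference = solve 2 (λ x y →
    let f x = x :+ con (+ 1 / 16) :* (con (+ 59 / 1) :+ :- (x :* x))
    in f x :- f y := (x :- y) :* (con 1ℚ :- con (+ 1 / 16) :* (x :+ y))) refl

  0≤√59-slope : ∀ {x y} → + 7 / 1 ℚ.≤ x → x ℚ.≤ + 8 / 1 → + 7 / 1 ℚ.≤ y → y ℚ.≤ + 8 / 1 →
    0ℚ ℚ.≤ √59-slope x y
  0≤√59-slope {x} {y} _ x≤8 _ y≤8 = subst (0ℚ ℚ.≤_)
    (solve 2 (λ x y → con (+ 1 / 16) :* ((con (+ 8 / 1) :- x) :+ (con (+ 8 / 1) :- y))
      := con 1ℚ :- con (+ 1 / 16) :* (x :+ y)) refl x y)
    (0≤p*q (ℚ.nonNegative⁻¹ (+ 1 / 16)) (0≤p+q (p≤q⇒0≤q-p x≤8) (p≤q⇒0≤q-p y≤8)))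

  √59-slope≤½ : ∀ {x y} → + 7 / 1 ℚ.≤ x → x ℚ.≤ + 8 / 1 → + 7 / 1 ℚ.≤ y → y ℚ.≤ + 8 / 1 →
    √59-slope x y ℚ.≤ ½
  √59-slope≤½ {x} {y} 7≤x _ 7≤y _ = 0≤q-p⇒p≤q (subst (0ℚ ℚ.≤_)
    (solve 2 (λ x y → con (+ 3 / 8) :+ con (+ 1 / 16) :* ((x :- con (+ 7 / 1)) :+ (y :- con (+ 7 / 1)))
      := con ½ :- (con 1ℚ :- con (+ 1 / 16) :* (x :+ y))) refl x y)
    (0≤p+q (ℚ.nonNegative⁻¹ (+ 3 / 8))
      (0≤p*q (ℚ.nonNegative⁻¹ (+ 1 / 16)) (0≤p+q (p≤q⇒0≤q-p 7≤x) (p≤q⇒0≤q-p 7≤y)))))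

  module √59 = MonotoneContraction √59-step √59-slope (+ 7 / 1) (+ 8 / 1)
    √59-difference 0≤√59-slope √59-slope≤½
    (ℚ.≤ᵇ⇒≤ tt) (ℚ.≤ᵇ⇒≤ tt) (ℚ.≤ᵇ⇒≤ tt) (ℚ.≤ᵇ⇒≤ tt)

  ρ √59 : ℝ
  ρ   = ρ.limit
  √59 = √59.limit

  private
    module I = RootIdentities ℝ-algebra

  v : ℝ
  v = I.imaginaryPart ρ √59

  ρ-root : Cubic.cubic ℝ-algebra ρ ≈ℝ fromℚ 0ℚ
  -- `_≈ℝ_` inspects only the sequences, and that of `f-limit` is termwise the one of `ρ` plus a
  -- quarter of the cubic at `ρ`.
  ρ-root = I.fixed⇒≈0 (+ 1 / 4) (+ 4 / 1) refl {ρ} {Cubic.cubic ℝ-algebra ρ} ρ.f-limit≈limit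

  v² : v *ℝ v ≈ℝ fromℚ (+ 2 / 1) +ℝ (fromℚ (+ 3 / 4) *ℝ (ρ *ℝ ρ))
  v² = I.imaginaryPart² {ρ} {√59} ρ-root
    (I.fixed⇒≈0 (+ 1 / 16) (+ 16 / 1) refl {√59} {fromℚ (+ 59 / 1) +ℝ (-ℝ (√59 *ℝ √59))} √59.f-limit≈limit)

-- Completeness and distinctness of the three complex roots

module ComplexRoots where

  open RealNumbers
  open ComplexNumbers
  open Contractions
  open CubicEquation
  open RealRoot
  open import Algebra.Bundles using (CommutativeRing)
  open import Data.Integer.Base using (+_)
  open import Data.List.Base using (List; []; _∷_)
  open import Data.List.Relation.Unary.All using ([]; _∷_)
  open import Data.List.Relation.Unary.AllPairs as AllPairs using (AllPairs; []; _∷_)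
  import Data.List.Relation.Unary.AllPairs.Properties as AllPairs
  open import Data.List.Relation.Unary.Any as Any using (Any; here; there)
  import Data.List.Relation.Unary.Any.Properties as Any
  open import Data.Nat.Base as ℕ using (ℕ)
  import Data.Nat.Properties as ℕ
  open import Data.Product using (∃-syntax; _×_; _,_; proj₂)
  open import Data.Rational.Base as ℚ using (ℚ; 0ℚ; 1ℚ; ½; _/_)
  import Data.Rational.Properties as ℚ
  open import Data.Rational.Solver using (module +-*-Solver)
  open import Data.Sum.Base using (_⊎_; inj₁; inj₂)
  open import Relation.Binary.PropositionalEquality
  open import Relation.Nullary using (¬_)

  open ℝ
  open ℂ
  open CauchyProperties

  infix 4 _≤∞_
  -- Eventual rational lower bounds take the place of an order on ℝ; upper bounds are expressed
  -- through the negated sequence.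
  _≤∞_ : ℚ → (ℕ → ℚ) → Set
  p ≤∞ x = ∃[ N ] (∀ n → N ℕ.≤ n → p ℚ.≤ x n)

  ≤∞-pointwise : ∀ {p x y} → (∀ n → x n ≡ y n) → p ≤∞ x → p ≤∞ y
  ≤∞-pointwise x≡y (N , h) = N , λ n N≤n → subst (_ ℚ.≤_) (x≡y n) (h n N≤n)

  ≤∞-+ : ∀ {p q x y} → p ≤∞ x → q ≤∞ y → p ℚ.+ q ≤∞ (λ n → x n ℚ.+ y n)
  ≤∞-+ (M , h) (N , k) = M ℕ.⊔ N , λ n n≥ → ℚ.+-mono-≤ (h n (⊔ˡ {M} {N} n≥)) (k n (⊔ʳ {M} {N} n≥))

  -- A decidable comparison with overlap: the rational `x N` can be compared with `m`, and all later
  -- terms stay within `ε` of it.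
  bounds-apart : ∀ {x} m ε → 0ℚ ℚ.< ε → IsCauchy x → (m ℚ.- ε ≤∞ x) ⊎ (ℚ.- (m ℚ.+ ε) ≤∞ (λ n → ℚ.- x n))
  bounds-apart {x} m ε ε>0 cx with N , close ← cx ε ε>0 | ℚ.≤-total m (x N)
  ... | inj₁ m≤xN = inj₁ (N , λ n N≤n → 0≤q-p⇒p≤q (subst (0ℚ ℚ.≤_)
    (solve 4 (λ m xN xn e → (xN :- m) :+ (e :- (xN :- xn)) := xn :- (m :- e)) refl m (x N) (x n) ε)
    (0≤p+q (p≤q⇒0≤q-p m≤xN) (p≤q⇒0≤q-p (ℚ.≤-trans (p≤∣p∣ (x N ℚ.- x n)) (ℚ.<⇒≤ (close N n ℕ.≤-refl N≤n)))))))
    where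
    open +-*-Solver
  ... | inj₂ xN≤m = inj₂ (N , λ n N≤n → 0≤q-p⇒p≤q (subst (0ℚ ℚ.≤_)
    (solve 4 (λ m xN xn e → (m :- xN) :+ (e :- (xn :- xN)) := (:- xn) :- (:- (m :+ e))) refl m (x N) (x n) ε)
    (0≤p+q (p≤q⇒0≤q-p xN≤m) (p≤q⇒0≤q-p (ℚ.≤-trans (p≤∣p∣ (x n ℚ.- x N)) (ℚ.<⇒≤ (close n N N≤n ℕ.≤-refl)))))))
    where
    open +-*-Solver

  -- Apartness from zero with an explicit bound, which permits cancellation.
  Apart₀ : (ℕ → ℚ) → Set
  Apart₀ x = ∃[ δ ] (0ℚ ℚ.< δ × δ ≤∞ (λ n → ℚ.∣ x n ∣))

  positive-apart : ∀ {x} δ → 0ℚ ℚ.< δ → δ ≤∞ x → Apart₀ x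
  positive-apart δ δ>0 (N , h) = δ , δ>0 , N , λ n N≤n → ℚ.≤-trans (h n N≤n) (p≤∣p∣ _)

  negative-apart : ∀ {x} δ → 0ℚ ℚ.< δ → δ ≤∞ (λ n → ℚ.- x n) → Apart₀ x
  negative-apart {x} δ δ>0 (N , h) = δ , δ>0 , N , λ n N≤n →
    ℚ.≤-trans (h n N≤n) (subst (ℚ.- x n ℚ.≤_) (ℚ.∣-p∣≡∣p∣ (x n)) (p≤∣p∣ (ℚ.- x n)))

  apart⇒≉ : ∀ {x y} → Apart₀ (λ n → seq x n ℚ.- seq y n) → ¬ (x ≈ℝ y)
  apart⇒≉ (δ , δ>0 , M , h) x≈y with N , k ← x≈y δ δ>0 =
    ℚ.<-irrefl refl (ℚ.<-≤-trans (k (M ℕ.⊔ N) (ℕ.m≤n⊔m M N)) (h (M ℕ.⊔ N) (ℕ.m≤m⊔n M N)))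

  -- Eventually δ∣c∣ ≤ ∣mc∣ < δε, and the positive δ cancels.
  apart-cancel : ∀ m c → Apart₀ (seq m) → m *ℝ c ≈ℝ fromℚ 0ℚ → c ≈ℝ fromℚ 0ℚ
  apart-cancel m c (δ , δ>0 , M , h) mc≈0 ε ε>0
    with N , k ← mc≈0 (δ ℚ.* ε) (subst (ℚ._< δ ℚ.* ε) (ℚ.*-zeroʳ δ) (ℚ.*-monoʳ-<-pos δ {{ℚ.positive δ>0}} ε>0)) =
    M ℕ.⊔ N , λ n n≥ → subst (ℚ._< ε) (cong ℚ.∣_∣ (sym (ℚ.+-identityʳ (seq c n))))
      (ℚ.*-cancelˡ-<-nonNeg δ {{ℚ.nonNegative (ℚ.<⇒≤ δ>0)}} (ℚ.≤-<-trans
        (ℚ.*-monoʳ-≤-nonNeg ℚ.∣ seq c n ∣ {{ℚ.∣-∣-nonNeg (seq c n)}} (h n (⊔ˡ {M} {N} n≥)))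
        (subst (ℚ._< δ ℚ.* ε)
          (trans (cong ℚ.∣_∣ (ℚ.+-identityʳ (seq m n ℚ.* seq c n))) (ℚ.∣p*q∣≡∣p∣*∣q∣ (seq m n) (seq c n)))
          (k n (⊔ʳ {M} {N} n≥)))))

  sum-of-squares-apart : ∀ a b → Apart₀ (seq b) → Apart₀ (seq ((a *ℝ a) +ℝ (b *ℝ b)))
  sum-of-squares-apart a b (δ , δ>0 , N , h) = positive-apart (δ ℚ.* δ)
    (subst (ℚ._< δ ℚ.* δ) (ℚ.*-zeroʳ δ) (ℚ.*-monoʳ-<-pos δ {{ℚ.positive δ>0}} δ>0))
    (N , λ n N≤n → ℚ.≤-trans
      (ℚ.≤-trans (ℚ.*-monoʳ-≤-nonNeg δ {{ℚ.nonNegative (ℚ.<⇒≤ δ>0)}} (h n N≤n))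
        (subst (ℚ.∣ seq b n ∣ ℚ.* δ ℚ.≤_) (sym (square (seq b n)))
          (ℚ.*-monoˡ-≤-nonNeg ℚ.∣ seq b n ∣ {{ℚ.∣-∣-nonNeg (seq b n)}} (h n N≤n))))
      (subst (ℚ._≤ seq a n ℚ.* seq a n ℚ.+ seq b n ℚ.* seq b n) (ℚ.+-identityˡ (seq b n ℚ.* seq b n))
        (ℚ.+-monoˡ-≤ (seq b n ℚ.* seq b n) (subst (0ℚ ℚ.≤_) (sym (square (seq a n)))
          (0≤p*q (ℚ.0≤∣p∣ (seq a n)) (ℚ.0≤∣p∣ (seq a n)))))))
    where
    square : ∀ p → p ℚ.* p ≡ ℚ.∣ p ∣ ℚ.* ℚ.∣ p ∣
    square p with ℚ.∣p∣≡p∨∣p∣≡-p p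
    ... | inj₁ eq = sym (cong₂ ℚ._*_ eq eq)
    ... | inj₂ eq = trans (solve 1 (λ p → p :* p := (:- p) :* (:- p)) refl p) (sym (cong₂ ℚ._*_ eq eq))
      where open +-*-Solver

  module I = RootIdentities ℝ-algebra
  module C = Cubic ℂ-algebra
  module ℂR = CommutativeRing ℂ-commutativeRing

  R V : ℂ
  R = ρ +i fromℚ 0ℚ
  V = fromℚ 0ℚ +i v

  R-root : Complex.IsRoot R
  R-root = ℂR.trans {1# - 2 · R - R ^ 3} {C.cubic R} {0#} (C.cubic-notation R) (I.cubic-re {ρ} ρ-root , I.cubic-im ρ)
    where open Complex

  V² : (V ℂR.* V) ℂR.≈ (ℂR.- (Complex.ratio (+ 2 / 1) ℂR.+ Complex.ratio (+ 3 / 4) ℂR.* (R ℂR.* R)))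
  V² = I.square-re {ρ} {v} v² , I.square-im ρ v

  open C.Roots R V R-root V² public

  im-γ₊ : ∀ n → seq (im γ₊) n ≡ seq v n
  im-γ₊ n = solve 2 (λ r v → (con (ℚ.- ½) :* con 0ℚ :+ con 0ℚ :* r) :+ v := v) refl (seq ρ n) (seq v n)
    where open +-*-Solver

  im-γ₋ : ∀ n → seq (im γ₋) n ≡ ℚ.- seq v n
  im-γ₋ n = solve 2 (λ r v → (con (ℚ.- ½) :* con 0ℚ :+ con 0ℚ :* r) :+ :- v := :- v) refl (seq ρ n) (seq v n)
    where open +-*-Solver

  -- Since t ≥ 7 and 12r² + 9r + 16 ≥ 16, the value is at least 7·16/118 = ¾ + 47/236.
  v≥¾ : + 3 / 4 ≤∞ seq v
  v≥¾ = 0 , λ n _ →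
    let 0≤r , _ = ρ.orbit-Inside n
        7≤t , _ = √59.orbit-Inside n
        r = ρ.orbit n
        t = √59.orbit n
        0≤k = 0≤p+q (0≤p+q (0≤p*q (ℚ.nonNegative⁻¹ (+ 12 / 1)) (0≤p*q 0≤r 0≤r))
                (0≤p*q (ℚ.nonNegative⁻¹ (+ 9 / 1)) 0≤r)) (ℚ.nonNegative⁻¹ (+ 16 / 1))
    in 0≤q-p⇒p≤q (subst (0ℚ ℚ.≤_)
      (solve 2 (λ r t →
        let s = con (+ 12 / 1) :* (r :* r) :+ con (+ 9 / 1) :* r
            k = s :+ con (+ 16 / 1)
        in (t :- con (+ 7 / 1)) :* (con (+ 1 / 118) :* k) :+ (con (+ 7 / 118) :* s :+ con (+ 47 / 236))
           := t :* (con (+ 1 / 118) :* k) :- con (+ 3 / 4)) refl r t)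
      (0≤p+q (0≤p*q (p≤q⇒0≤q-p 7≤t) (0≤p*q (ℚ.nonNegative⁻¹ (+ 1 / 118)) 0≤k))
        (0≤p+q (0≤p*q (ℚ.nonNegative⁻¹ (+ 7 / 118))
          (0≤p+q (0≤p*q (ℚ.nonNegative⁻¹ (+ 12 / 1)) (0≤p*q 0≤r 0≤r)) (0≤p*q (ℚ.nonNegative⁻¹ (+ 9 / 1)) 0≤r)))
          (ℚ.nonNegative⁻¹ (+ 47 / 236)))))
    where open +-*-Solver

  -- Multiplication by the conjugate reduces cancelling `z - w` to cancelling its squared modulus,
  -- which is bounded below by the square of the imaginary difference.
  apart⇒Separated : ∀ z w → Apart₀ (λ n → seq (im z) n ℚ.- seq (im w) n) → Separated z w
  apart⇒Separated (x +i y) (x′ +i y′) apart (c +i d) (re≈0 , im≈0) =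
    apart-cancel ((a *ℝ a) +ℝ (b *ℝ b)) c (sum-of-squares-apart a b apart) (I.norm-re {a} {b} {c} {d} re≈0 im≈0) ,
    apart-cancel ((a *ℝ a) +ℝ (b *ℝ b)) d (sum-of-squares-apart a b apart) (I.norm-im {a} {b} {c} {d} re≈0 im≈0)
    where
    a = x +ℝ (-ℝ x′)
    b = y +ℝ (-ℝ y′)

  separated-R : ∀ z → Apart₀ (seq (im z)) → Separated z R
  separated-R z (δ , δ>0 , apart) = apart⇒Separated z R
    (δ , δ>0 , ≤∞-pointwise (λ n → cong ℚ.∣_∣ (sym (ℚ.+-identityʳ (seq (im z) n)))) apart)

  -- The imaginary part of `γ₊` exceeds that of `z` by at least p + ¾. In the recognition of roots
  -- `p` is ¼ or -½, leaving a margin of at least ¼.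
  separated-γ₊ : ∀ z {p} → p ≤∞ (λ n → ℚ.- seq (im z) n) → 0ℚ ℚ.< p ℚ.+ + 3 / 4 → Separated z γ₊
  separated-γ₊ z {p} p≤-z 0<p+¾ = apart⇒Separated z γ₊ (negative-apart (p ℚ.+ + 3 / 4) 0<p+¾
    (≤∞-pointwise (λ n → trans (solve 2 (λ y v → (:- y) :+ v := :- (y :- v)) refl (seq (im z) n) (seq v n))
      (cong (λ t → ℚ.- (seq (im z) n ℚ.- t)) (sym (im-γ₊ n)))) (≤∞-+ p≤-z v≥¾)))
    where open +-*-Solver

  separated-γ₋ : ∀ z {p} → p ≤∞ seq (im z) → 0ℚ ℚ.< p ℚ.+ + 3 / 4 → Separated z γ₋
  separated-γ₋ z {p} p≤z 0<p+¾ = apart⇒Separated z γ₋ (positive-apart (p ℚ.+ + 3 / 4) 0<p+¾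
    (≤∞-pointwise (λ n → trans (solve 2 (λ y v → y :+ v := y :- (:- v)) refl (seq (im z) n) (seq v n))
      (cong (λ t → seq (im z) n ℚ.- t) (sym (im-γ₋ n)))) (≤∞-+ p≤z v≥¾)))
    where open +-*-Solver

  -- A root is recognised by comparing its imaginary part with ±⅜.
  roots-complete : ∀ z → Complex.IsRoot z → Any (λ w → z ℂR.≈ w) roots
  roots-complete z root = compare (bounds-apart (+ 3 / 8) (+ 1 / 8) (ℚ.positive⁻¹ (+ 1 / 8)) (cauchy (im z)))
    (bounds-apart (ℚ.- (+ 3 / 8)) (+ 1 / 8) (ℚ.positive⁻¹ (+ 1 / 8)) (cauchy (im z)))
    where
    compare : (+ 1 / 4 ≤∞ seq (im z)) ⊎ (ℚ.- ½ ≤∞ (λ n → ℚ.- seq (im z) n)) →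
      (ℚ.- ½ ≤∞ seq (im z)) ⊎ (+ 1 / 4 ≤∞ (λ n → ℚ.- seq (im z) n)) → Any (λ w → z ℂR.≈ w) roots
    compare (inj₁ high) _ = there (here (root≈γ₊ {z} root
      (separated-R z (positive-apart (+ 1 / 4) (ℚ.positive⁻¹ (+ 1 / 4)) high))
      (separated-γ₋ z high (ℚ.positive⁻¹ 1ℚ))))
    compare (inj₂ _) (inj₂ low) = there (there (here (root≈γ₋ {z} root
      (separated-R z (negative-apart (+ 1 / 4) (ℚ.positive⁻¹ (+ 1 / 4)) low))
      (separated-γ₊ z low (ℚ.positive⁻¹ 1ℚ)))))
    compare (inj₂ not-high) (inj₁ not-low) = here (root≈R {z} root
      (separated-γ₊ z not-high (ℚ.positive⁻¹ (+ 1 / 4)))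
      (separated-γ₋ z not-low (ℚ.positive⁻¹ (+ 1 / 4))))

  roots-distinct : AllPairs ℂR._≉_ roots
  roots-distinct =
    ((λ eq → R≉γ₊ (proj₂ eq)) ∷ (λ eq → R≉γ₋ (proj₂ eq)) ∷ []) ∷ ((λ eq → γ₊≉γ₋ (proj₂ eq)) ∷ []) ∷ [] ∷ []
    where
    open +-*-Solver
    ¾>0 = ℚ.positive⁻¹ (+ 3 / 4)
    R≉γ₊ : ¬ (im R ≈ℝ im γ₊)
    R≉γ₊ = apart⇒≉ {im R} {im γ₊} (negative-apart (+ 3 / 4) ¾>0 (≤∞-pointwise
      (λ n → trans (solve 1 (λ v → v := :- (con 0ℚ :- v)) refl (seq v n)) (cong (λ t → ℚ.- (0ℚ ℚ.- t)) (sym (im-γ₊ n)))) v≥¾))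
    R≉γ₋ : ¬ (im R ≈ℝ im γ₋)
    R≉γ₋ = apart⇒≉ {im R} {im γ₋} (positive-apart (+ 3 / 4) ¾>0 (≤∞-pointwise
      (λ n → trans (solve 1 (λ v → v := con 0ℚ :- (:- v)) refl (seq v n)) (cong (λ t → 0ℚ ℚ.- t) (sym (im-γ₋ n)))) v≥¾))
    γ₊≉γ₋ : ¬ (im γ₊ ≈ℝ im γ₋)
    γ₊≉γ₋ = apart⇒≉ {im γ₊} {im γ₋} (positive-apart (+ 3 / 2) (ℚ.positive⁻¹ (+ 3 / 2)) (≤∞-pointwise
      (λ n → trans (solve 1 (λ v → v :+ v := v :- (:- v)) refl (seq v n)) (sym (cong₂ ℚ._-_ (im-γ₊ n) (im-γ₋ n))))
      (≤∞-+ v≥¾ v≥¾)))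

  open Complex using (ℂˣ; value; inverse; invertible; EnumeratesRoots; ∑[_]_)

  invert : ∀ z → Complex.IsRoot z → ℂˣ
  invert z root = record { value = z ; inverse = C.reciprocal z ; invertible = C.reciprocal-inverse {z} root }

  allRoots : List ℂˣ
  allRoots = invert R R-root ∷ invert γ₊ γ₊-root ∷ invert γ₋ γ₋-root ∷ []

  allRoots-enumerates : EnumeratesRoots allRoots
  allRoots-enumerates = record
    { roots    = R-root ∷ γ₊-root ∷ γ₋-root ∷ []
    ; distinct = AllPairs.map⁻ {f = value} {xs = allRoots} roots-distinct
    ; complete = λ z root → Any.map⁻ {f = value} {xs = allRoots} (roots-complete z root)
    }

-- The closed form in the notation of the complex numbers

module ClosedForms where

  open ComplexRoots
  open Contractions
  open Counting using (pds; suc-pds)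
  open import Data.Integer.Base using (+_)
  open import Data.List.Base using (List)
  open import Data.Nat.Base as ℕ using (ℕ; zero; suc; z≤n; s≤s)
  open import Data.Rational.Base using (0ℚ; _/_)
  open import Relation.Binary.PropositionalEquality

  open Complex using (ℂˣ; value; inverse; invertible; EnumeratesRoots; ∑[_]_; ratio)

  ·-ratio : ∀ k z → (k Complex.· z) ℂR.≈ (ratio (fromℕ k) ℂR.* z)
  ·-ratio zero    z = ℂR.sym {ratio 0ℚ ℂR.* z} {ratio 0ℚ} (ℂR.zeroˡ z)
  ·-ratio (suc k) z = C.multiple-step k {z} {k Complex.· z} (·-ratio k z)

  ^-pow : ∀ z n → (z Complex.^ n) ℂR.≈ C.pow z n
  ^-pow z zero    = ℂR.refl {ℂR.1#}
  ^-pow z (suc n) = ℂR.*-congˡ {z} {z Complex.^ n} {C.pow z n} (^-pow z n)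

  -- A record, so that the summand is read off the type without unfolding the
  -- equality of complex numbers down to Cauchy sequences.
  record ClosedForm (y : ℂ) (αs : List ℂˣ) (f : ℂˣ → ℂ) : Set where
    constructor closed
    open Complex
    field
      equation : y ≈ ratio (+ 1 / 59) * (∑[ αs ] f) - 1#

  closed-form-∑ : ∀ n k → suc k ≡ shifted n →
    ∀ (f : ℂˣ → ℂ) → (∀ α → C.IsRoot (value α) → f α ℂR.≈ C.term n (value α)) →
    ∀ αs → EnumeratesRoots αs → ClosedForm (k Complex.· Complex.1#) αs f
  closed-form-∑ n k eq f f≈ αs enumerates = closed (closed-form n {k} {k Complex.· Complex.1#} eq (·-ratio k Complex.1#)
    roots-distinct roots-complete {ℂˣ} {value} {f} f≈ {αs}
    (EnumeratesRoots.roots enumerates) (EnumeratesRoots.distinct enumerates) (EnumeratesRoots.complete enumerates))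

  summand≈term : ∀ n α → Complex.IsRoot (value α) → let open Complex in
    ((13 · inverse α + 11 · 1# - 5 · value α) * inverse α ^ n) ℂR.≈ C.term n (value α)
  summand≈term n α root = C.term-notation n
    {value α} {inverse α} {13 · inverse α} {11 · 1#} {5 · value α} {inverse α ^ n}
    root (invertible α) (·-ratio 13 (inverse α)) (·-ratio 11 1#) (·-ratio 5 (value α)) (^-pow (inverse α) n)
    where open Complex

  -- The summand is left to unification with the goal: written out here, it would
  -- be compared with the goal's copy by unfolding.
  pds-closed-form : ∀ αs → EnumeratesRoots αs → ∀ n → 2 ℕ.≤ n → let open Complex in
    ClosedForm (pds n · 1#) αs (λ α → (13 · inverse α + 11 · 1# - 5 · value α) * inverse α ^ n)
  pds-closed-form αs enumerates (suc (suc m)) (s≤s (s≤s z≤n)) =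
    closed-form-∑ (suc (suc m)) _ (suc-pds m) _ (summand≈term (suc (suc m))) αs enumerates

open import Relation.Binary.PropositionalEquality using (refl)
open Counting
open GeneratingFunction
open ComplexRoots
open ClosedForms

mainTheorem1 : ∃[ pds ]
    ( (∀ (n : ℕ) → HasCardinality (PDS-setoid n) (pds n))
    × (let open PowerSeries in
    generatingFunction pds ≈ numerator ÷ denominator)
    × pds 0 ≡ 1
    × pds 1 ≡ 1
    × (let open Complex in
    (∃[ αs ] EnumeratesRoots αs)
    × (∀ (αs : List ℂˣ) → EnumeratesRoots αs →
    ∀ (n : ℕ) → 2 ≤ n →
    pds n · 1# ≈
    ratio (+ 1 / 59)
    * (∑[ αs ] (λ α → (13 · inverse α + 11 · 1# - 5 · value α)
    * inverse α ^ n))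
    - 1#)))
mainTheorem1 =
  pds , PDS-cardinality , generatingFunction-pds , refl , refl ,
  (allRoots , allRoots-enumerates) ,
  λ αs enumerates n 2≤n → ClosedForm.equation (pds-closed-form αs enumerates n 2≤n)
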